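{- Let $G$ be a finitely generated group. Assume that $G$ is neither abelian nor generalized dicyclic, and moreover that $G$ has an element of order at least $(2\operatorname{rank}(G))^{36}$ (infinite order being allowed). Then $G$ admits a locally finite Cayley graph $\mathrm{Cay}(G,S)$ whose only automorphisms are the left-multiplications by elements of $G$.
   Context: A graph is a simple undirected graph $(V,E)$: $E\subset V\times V$ is symmetric and disjoint from the diagonal. An automorphism is a permutation $\varphi$ of $V$ with $(x,y)\in E$ iff $(\varphi(x),\varphi(y))\in E$. A graph is locally finite if every vertex belongs to finitely many edges. For a generating set $S$ of $G$ with $1_G\notin S$, the Cayley graph $\mathrm{Cay}(G,S)$ has vertex set $G$ and edge set $\{(g,h)\mid g^{ -1}h\in S\cup S^{ -1}\}$; $G$ acts on it by left multiplication. $\operatorname{rank}(G)$ is the smallest cardinality of a generating set of $G$. A group $G$ is generalized dicyclic if it is non-abelian and has an abelian normal subgroup $A$ of index $2$ and an element $x\notin A$ of order $4$ such that $xax^{ -1}=a^{ -1}$ for every $a\in A$. -}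

module Defs where

open import Level using (Level; _⊔_; suc)
open import Algebra.Bundles using (Group)
open import Algebra.Definitions using (Commutative)
import Algebra.Definitions.RawMonoid as RawMonoidDefs
import Algebra.Properties.Group as GroupProperties
open import Data.Fin.Base using (Fin)
open import Data.Nat.Base using (ℕ; _≤_; _<_)
open import Data.Product.Base using (Σ; ∃; _×_; _,_; proj₁)
open import Data.Product.Relation.Binary.Pointwise.NonDependent using (_×ₛ_)
open import Data.Sum.Base using (_⊎_; inj₁; inj₂) renaming (map to map-⊎)
open import Function.Bundles using (Bijection; _⇔_)
open import Relation.Binary.Bundles using (Setoid)
open import Relation.Binary.Definitions using (_Respects_)
import Relation.Binary.Construct.On as On
open import Relation.Binary.PropositionalEquality.Properties using () renaming (setoid to ≡-setoid)
open import Relation.Nullary.Negation.Core using (¬_)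

record Subset {a ℓ} (A : Setoid a ℓ) (p : Level) : Set (a ⊔ ℓ ⊔ suc p) where
  open Setoid A
  field
    Member : Carrier → Set p
    resp   : Member Respects _≈_

module _ {a ℓ p : Level} {A : Setoid a ℓ} where
  open Setoid A

  infix 4 _∈_ _∉_

  _∈_ : Carrier → Subset A p → Set p
  x ∈ S = Subset.Member S x

  _∉_ : Carrier → Subset A p → Set p
  x ∉ S = ¬ (x ∈ S)

  subsetSetoid : Subset A p → Setoid (a ⊔ p) ℓ
  subsetSetoid S = On.setoid A (proj₁ {B = _∈ S})

module _ {a ℓ p q : Level} {A : Setoid a ℓ} where

  infixr 6 _∪_

  _∪_ : Subset A p → Subset A q → Subset A (p ⊔ q)
  S ∪ T = record
    { Member = λ x → x ∈ S ⊎ x ∈ T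
    ; resp   = λ x≈y → map-⊎ (Subset.resp S x≈y) (Subset.resp T x≈y)
    }

HasCardinality : ∀ {a ℓ} → Setoid a ℓ → ℕ → Set (a ⊔ ℓ)
HasCardinality A n = Bijection (≡-setoid (Fin n)) A

Finite : ∀ {a ℓ} → Setoid a ℓ → Set (a ⊔ ℓ)
Finite A = ∃ λ n → HasCardinality A n

record Graph (v ℓ e : Level) : Set (suc (v ⊔ ℓ ⊔ e)) where
  field
    V : Setoid v ℓ
  open Setoid V public using (_≈_) renaming (Carrier to Vertex)
  field
    E           : Subset (V ×ₛ V) e
    symmetric   : ∀ {x y} → (x , y) ∈ E → (y , x) ∈ E
    irreflexive : ∀ {x} → (x , x) ∉ E

module _ {v ℓ e : Level} (Γ : Graph v ℓ e) where
  open Graph Γ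
  private module V = Setoid V

  -- Each undirected edge {y , z} occurs as the two pairs (y , z) and (z , y).
  incidentEdges : Vertex → Subset (V ×ₛ V) (ℓ ⊔ e)
  incidentEdges x = record
    { Member = λ (y , z) → (y , z) ∈ E × (x ≈ y ⊎ x ≈ z)
    ; resp   = λ { (y≈y′ , z≈z′) (yz∈E , x∈yz) →
                   Subset.resp E (y≈y′ , z≈z′) yz∈E
                 , map-⊎ (λ x≈y → V.trans x≈y y≈y′) (λ x≈z → V.trans x≈z z≈z′) x∈yz }
    }

  LocallyFinite : Set (v ⊔ ℓ ⊔ e)
  LocallyFinite = ∀ x → Finite (subsetSetoid (incidentEdges x))

  IsAutomorphism : Bijection V V → Set (v ⊔ e)
  IsAutomorphism φ = ∀ x y → (x , y) ∈ E ⇔ (to x , to y) ∈ E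
    where open Bijection φ using (to)

module _ {c ℓ : Level} (G : Group c ℓ) where
  open Group G
  open GroupProperties G
  open RawMonoidDefs rawMonoid using () renaming (_×_ to _times_)

  Abelian : Set (c ⊔ ℓ)
  Abelian = Commutative _≈_ _∙_

  infixr 8 _^ᴳ_

  _^ᴳ_ : Carrier → ℕ → Carrier
  g ^ᴳ n = n times g

  HasOrder : Carrier → ℕ → Set ℓ
  HasOrder g n = 0 < n × g ^ᴳ n ≈ ε × (∀ m → 0 < m → g ^ᴳ m ≈ ε → n ≤ m)

  HasInfiniteOrder : Carrier → Set ℓ
  HasInfiniteOrder g = ∀ n → 0 < n → ¬ (g ^ᴳ n ≈ ε)

  HasOrderAtLeast : Carrier → ℕ → Set ℓ
  HasOrderAtLeast g N = HasInfiniteOrder g ⊎ (∃ λ n → HasOrder g n × N ≤ n)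

  data Generated {p} (S : Subset setoid p) : Carrier → Set (c ⊔ ℓ ⊔ p) where
    gen  : ∀ {g} → g ∈ S → Generated S g
    unit : Generated S ε
    mul  : ∀ {g h} → Generated S g → Generated S h → Generated S (g ∙ h)
    inv  : ∀ {g} → Generated S g → Generated S (g ⁻¹)
    resp : ∀ {g h} → g ≈ h → Generated S g → Generated S h

  Generates : ∀ {p} → Subset setoid p → Set (c ⊔ ℓ ⊔ p)
  Generates S = ∀ g → Generated S g

  FinitelyGenerated : Set (suc (c ⊔ ℓ))
  FinitelyGenerated =
    Σ (Subset setoid (c ⊔ ℓ)) λ S → Generates S × Finite (subsetSetoid S)

  -- r is the least cardinality of a finite generating set; when G is finitely
  -- generated this is the least cardinality among all generating sets.
  IsRank : ℕ → Set (suc (c ⊔ ℓ))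
  IsRank r =
    (Σ (Subset setoid (c ⊔ ℓ)) λ S → Generates S × HasCardinality (subsetSetoid S) r) ×
    (∀ (S : Subset setoid (c ⊔ ℓ)) n →
       Generates S → HasCardinality (subsetSetoid S) n → r ≤ n)

  record IsSubgroup {p} (A : Subset setoid p) : Set (c ⊔ p) where
    field
      ε-closed  : ε ∈ A
      ∙-closed  : ∀ {a b} → a ∈ A → b ∈ A → a ∙ b ∈ A
      ⁻¹-closed : ∀ {a} → a ∈ A → a ⁻¹ ∈ A

  IsNormal : ∀ {p} → Subset setoid p → Set (c ⊔ p)
  IsNormal A = ∀ g {a} → a ∈ A → g ∙ a ∙ g ⁻¹ ∈ A

  -- The coset gA is represented by g; two cosets agree when g⁻¹h ∈ A.
  leftCosets : ∀ {p} (A : Subset setoid p) → IsSubgroup A → Setoid c p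
  leftCosets A A≤G = record
    { Carrier       = Carrier
    ; _≈_           = λ g h → g ⁻¹ ∙ h ∈ A
    ; isEquivalence = record
      { refl  = λ {g} → Subset.resp A (sym (inverseˡ g)) ε-closed
      ; sym   = λ {g} {h} gh → Subset.resp A (⁻¹-anti-homo-\\ g h) (⁻¹-closed gh)
      ; trans = λ {g} {h} {k} gh hk →
          Subset.resp A
            (trans (assoc (g ⁻¹) h (h ⁻¹ ∙ k)) (∙-congˡ (\\-leftDividesˡ h k)))
            (∙-closed gh hk)
      }
    }
    where open IsSubgroup A≤G

  HasIndex : ∀ {p} (A : Subset setoid p) → IsSubgroup A → ℕ → Set (c ⊔ p)
  HasIndex A A≤G n = HasCardinality (leftCosets A A≤G) n

  record IsGeneralizedDicyclic : Set (suc (c ⊔ ℓ)) where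
    field
      nonAbelian  : ¬ Abelian
      A           : Subset setoid (c ⊔ ℓ)
      A-subgroup  : IsSubgroup A
      A-abelian   : ∀ {a b} → a ∈ A → b ∈ A → a ∙ b ≈ b ∙ a
      A-normal    : IsNormal A
      A-index     : HasIndex A A-subgroup 2
      x           : Carrier
      x∉A         : x ∉ A
      x-order     : HasOrder x 4
      x-inverts-A : ∀ {a} → a ∈ A → x ∙ a ∙ x ⁻¹ ≈ a ⁻¹

  inverses : ∀ {p} → Subset setoid p → Subset setoid (c ⊔ ℓ ⊔ p)
  inverses S = record
    { Member = λ g → ∃ λ s → s ∈ S × g ≈ s ⁻¹
    ; resp   = λ { g≈h (s , s∈S , g≈s⁻¹) → s , s∈S , trans (sym g≈h) g≈s⁻¹ }
    }

  Cay : ∀ {p} (S : Subset setoid p) → ε ∉ S → Graph c ℓ (c ⊔ ℓ ⊔ p)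
  Cay S ε∉S = record
    { V           = setoid
    ; E           = record
      { Member = λ (g , h) → g ⁻¹ ∙ h ∈ S ∪ inverses S
      ; resp   = λ { (g≈g′ , h≈h′) →
                     Subset.resp (S ∪ inverses S) (∙-cong (⁻¹-cong g≈g′) h≈h′) }
      }
    ; symmetric   = λ {g} {h} → λ
      { (inj₁ gh∈S) → inj₂ (g ⁻¹ ∙ h , gh∈S , sym (⁻¹-anti-homo-\\ g h))
      ; (inj₂ (s , s∈S , gh≈s⁻¹)) → inj₁ (Subset.resp S
          (trans (sym (⁻¹-involutive s)) (trans (⁻¹-cong (sym gh≈s⁻¹)) (⁻¹-anti-homo-\\ g h)))
          s∈S)
      }
    ; irreflexive = λ {g} → λ
      { (inj₁ gg∈S) → ε∉S (Subset.resp S (inverseˡ g) gg∈S)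
      ; (inj₂ (s , s∈S , gg≈s⁻¹)) → ε∉S (Subset.resp S
          (trans (sym (⁻¹-involutive s))
                 (trans (⁻¹-cong (trans (sym gg≈s⁻¹) (inverseˡ g))) ε⁻¹≈ε))
          s∈S)
      }
    }

  IsLeftMultiplication : Bijection setoid setoid → Set (c ⊔ ℓ)
  IsLeftMultiplication φ = ∃ λ g → ∀ x → to x ≈ g ∙ x
    where open Bijection φ using (to)

module Submission where

open import Defs
open import Level using (Level; _⊔_; Lift; lift)
open import Algebra.Bundles using (Group)
import Algebra.Properties.Group as GroupProperties
open import Axiom.ExcludedMiddle using (ExcludedMiddle)
open import Data.Bool.Base using (Bool; true; false; not)
open import Data.Empty using (⊥; ⊥-elim)
open import Data.Fin.Base using (Fin; zero; suc; toℕ; fromℕ<; combine; remQuot; splitAt; _↑ˡ_; _↑ʳ_)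
import Data.Fin.Properties as Fin
open import Data.Integer.Base as ℤ using (ℤ; +_; -[1+_]; ∣_∣)
import Data.Integer.Properties as ℤ
import Data.Integer.Tactic.RingSolver as ℤ-Ring
open import Data.List.Base using (List; []; _∷_)
open import Data.Nat.Base as ℕ using (ℕ; zero; suc; z≤n; s≤s; _<_; _*_; _^_)
import Data.Nat.Properties as ℕ
import Data.Nat.Tactic.RingSolver as ℕ-Ring
open import Data.Product.Base using (Σ; ∃; ∃₂; _×_; _,_; proj₁; proj₂)
open import Data.Product.Relation.Binary.Pointwise.NonDependent using (_×ₛ_)
open import Data.Sum.Base using (_⊎_; inj₁; inj₂; [_,_]′)
open import Data.Vec.Base using (Vec; lookup)
open import Function.Base using (_∘_; case_of_)
open import Function.Bundles using (Bijection; _⇔_; mk⇔; Equivalence)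
open import Relation.Binary.Bundles using (Setoid)
open import Relation.Binary.PropositionalEquality.Core as ≡ using (_≡_)
import Relation.Binary.Reasoning.Setoid as SetoidReasoning
import Relation.Binary.Reflection as Reflection
open import Relation.Nullary.Decidable.Core using (Dec; yes; no)
open import Relation.Nullary.Negation.Core using (¬_; contradiction)

-- Idea.  Let C = ⟨g⟩ and call t normalising if t g t⁻¹ is g or g⁻¹.  From the words of length at
-- most five in a minimal generating set pick representatives tᵢ of the double cosets C tᵢ^±1 C
-- other than C.  The connection set consists of a long segment gᶻ, 0 < |z| ≤ M, and of the marks
-- tᵢ, tᵢ g, tᵢ g^(4+2i) with their inverses.  An edge labelled by the segment lies on many
-- triangles and an edge labelled by a mark on few, so an automorphism φ respects both kinds of
-- edges, and comparing the balls around 1 and gᶻ it even respects the edges labelled g^±1.  Thus φ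
-- respects distances within the cosets of C, and the distances 1 and 4 + 2i between the three
-- marks in tᵢ C single out tᵢ, up to inversion if tᵢ is normalising.
--
-- Put δ x h = φ(x)⁻¹ φ(x h), a cocycle.  For a word h of length at most five it follows that
-- δ x h = h if h is not normalising, and δ x h ∈ {h, h⁻¹} otherwise.  If some generator is not
-- normalising this forces δ x h = h for all h.  If all generators centralise g, the failure of
-- δ x g = g would invert all words of length two, and G would be abelian.  If a generator t
-- inverts g, then the failure of δ x t = t would make t invert the centraliser of g, and G would
-- be generalised dicyclic.  So δ x h = h always, that is, φ is the left multiplication by φ(1).

-- Knowing δ x h up to inversion is too weak to propagate, because the sign may change with the base
-- point x. What decides it is having this information for h and h g together: δ x (h g) = δ x h · δ
-- (x h) g ties their signs to that of g, and a wrong combination either is harmless (h = h⁻¹) or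
-- makes g² or g⁴ trivial.
--
-- The obstacle to recognising tᵢ by spacings is that inverses of marks may fall into tᵢ C and
-- create spurious spacings there. Replacing tᵢ by another element of its coset removes them; this
-- replacement is what makes the required order grow like n³, where n bounds the number of
-- representatives. Inverse marks also lie in cosets of their own, where spacings are those of tᵢ C
-- conjugated by tᵢ; they show the right pattern only if tᵢ is normalising.
--
-- The rank enters through n = (r + 1)⁵, the number of words of length five over the letters and 1.
-- With q = 2r this is at most q⁵, so 8n ≤ q⁸ and 48 (8n)³ < q³⁶.

-- Group identities by free reduction

module GroupSolver {c ℓ} (G : Group c ℓ) where
  open Group G
  open GroupProperties G
  open SetoidReasoning setoid

  infixl 7 _⊕_
  infix 8 ⊝_

  data Expr (n : ℕ) : Set where
    var : Fin n → Expr n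
    e   : Expr n
    _⊕_ : Expr n → Expr n → Expr n
    ⊝_  : Expr n → Expr n

  ⟦_⟧ : ∀ {n} → Expr n → Vec Carrier n → Carrier
  ⟦ var i ⟧ ρ = lookup ρ i
  ⟦ e     ⟧ ρ = ε
  ⟦ a ⊕ b ⟧ ρ = ⟦ a ⟧ ρ ∙ ⟦ b ⟧ ρ
  ⟦ ⊝ a   ⟧ ρ = ⟦ a ⟧ ρ ⁻¹

  Word : ℕ → Set
  Word n = List (Bool × Fin n)

  letter : ∀ {n} → Bool × Fin n → Vec Carrier n → Carrier
  letter (true  , i) ρ = lookup ρ i
  letter (false , i) ρ = lookup ρ i ⁻¹

  ⟦_⟧ʷ : ∀ {n} → Word n → Vec Carrier n → Carrier
  ⟦ []    ⟧ʷ ρ = ε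
  ⟦ l ∷ w ⟧ʷ ρ = letter l ρ ∙ ⟦ w ⟧ʷ ρ

  push : ∀ {n} → Bool × Fin n → Word n → Word n
  push l [] = l ∷ []
  push (s , i) ((s′ , j) ∷ w) with i Fin.≟ j
  push (true  , i) ((false , j) ∷ w) | yes _ = w
  push (false , i) ((true  , j) ∷ w) | yes _ = w
  push (s     , i) ((s′    , j) ∷ w) | _     = (s , i) ∷ (s′ , j) ∷ w

  push-correct : ∀ {n} (l : Bool × Fin n) w ρ → ⟦ push l w ⟧ʷ ρ ≈ letter l ρ ∙ ⟦ w ⟧ʷ ρ
  push-correct l [] ρ = refl
  push-correct (s , i) ((s′ , j) ∷ w) ρ with i Fin.≟ j
  push-correct (true  , i) ((false , .i) ∷ w) ρ | yes ≡.refl = sym (\\-leftDividesˡ _ _)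
  push-correct (false , i) ((true  , .i) ∷ w) ρ | yes ≡.refl = sym (\\-leftDividesʳ _ _)
  push-correct (true  , i) ((true  , j) ∷ w) ρ | yes _ = refl
  push-correct (false , i) ((false , j) ∷ w) ρ | yes _ = refl
  push-correct (true  , i) ((s′ , j) ∷ w) ρ | no _ = refl
  push-correct (false , i) ((s′ , j) ∷ w) ρ | no _ = refl

  -- act true a w and act false a w are the reduced forms of a w and a⁻¹ w.
  act : ∀ {n} → Bool → Expr n → Word n → Word n
  act s     (var i) w = push (s , i) w
  act s     e       w = w
  act true  (a ⊕ b) w = act true a (act true b w)
  act false (a ⊕ b) w = act false b (act false a w)
  act s     (⊝ a)   w = act (not s) a w

  signed : Bool → Carrier → Carrier
  signed true  x = x
  signed false x = x ⁻¹

  act-correct : ∀ {n} s (a : Expr n) w ρ → ⟦ act s a w ⟧ʷ ρ ≈ signed s (⟦ a ⟧ ρ) ∙ ⟦ w ⟧ʷ ρ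
  act-correct true  (var i) w ρ = push-correct (true , i) w ρ
  act-correct false (var i) w ρ = push-correct (false , i) w ρ
  act-correct true  e w ρ = sym (identityˡ _)
  act-correct false e w ρ = sym (trans (∙-congʳ ε⁻¹≈ε) (identityˡ _))
  act-correct true (a ⊕ b) w ρ = begin
    ⟦ act true a (act true b w) ⟧ʷ ρ        ≈⟨ act-correct true a _ ρ ⟩
    ⟦ a ⟧ ρ ∙ ⟦ act true b w ⟧ʷ ρ           ≈⟨ ∙-congˡ (act-correct true b w ρ) ⟩
    ⟦ a ⟧ ρ ∙ (⟦ b ⟧ ρ ∙ ⟦ w ⟧ʷ ρ)          ≈⟨ assoc _ _ _ ⟨
    ⟦ a ⟧ ρ ∙ ⟦ b ⟧ ρ ∙ ⟦ w ⟧ʷ ρ            ∎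
  act-correct false (a ⊕ b) w ρ = begin
    ⟦ act false b (act false a w) ⟧ʷ ρ      ≈⟨ act-correct false b _ ρ ⟩
    ⟦ b ⟧ ρ ⁻¹ ∙ ⟦ act false a w ⟧ʷ ρ       ≈⟨ ∙-congˡ (act-correct false a w ρ) ⟩
    ⟦ b ⟧ ρ ⁻¹ ∙ (⟦ a ⟧ ρ ⁻¹ ∙ ⟦ w ⟧ʷ ρ)    ≈⟨ assoc _ _ _ ⟨
    ⟦ b ⟧ ρ ⁻¹ ∙ ⟦ a ⟧ ρ ⁻¹ ∙ ⟦ w ⟧ʷ ρ      ≈⟨ ∙-congʳ (⁻¹-anti-homo-∙ _ _) ⟨
    (⟦ a ⟧ ρ ∙ ⟦ b ⟧ ρ) ⁻¹ ∙ ⟦ w ⟧ʷ ρ       ∎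
  act-correct true  (⊝ a) w ρ = act-correct false a w ρ
  act-correct false (⊝ a) w ρ = trans (act-correct true a w ρ) (∙-congʳ (sym (⁻¹-involutive _)))

  ⟦_⇓⟧ : ∀ {n} → Expr n → Vec Carrier n → Carrier
  ⟦ a ⇓⟧ ρ = ⟦ act true a [] ⟧ʷ ρ

  correct : ∀ {n} (a : Expr n) ρ → ⟦ a ⇓⟧ ρ ≈ ⟦ a ⟧ ρ
  correct a ρ = trans (act-correct true a [] ρ) (identityʳ _)

  open Reflection setoid var ⟦_⟧ ⟦_⇓⟧ correct public using (solve; _⊜_)

-- Integer powers

module Power {c ℓ} (G : Group c ℓ) where
  open Group G
  open GroupProperties G
  open SetoidReasoning setoid
  open GroupSolver G using (solve; _⊜_; _⊕_; ⊝_; e)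

  pow : Carrier → ℤ → Carrier
  pow x (+ n)    = _^ᴳ_ G x n
  pow x -[1+ n ] = (_^ᴳ_ G x (suc n)) ⁻¹

  times-comm : ∀ x n → _^ᴳ_ G x n ∙ x ≈ x ∙ _^ᴳ_ G x n
  times-comm x zero    = trans (identityˡ x) (sym (identityʳ x))
  times-comm x (suc n) = trans (assoc _ _ _) (∙-congˡ (times-comm x n))

  pow-suc : ∀ x i → pow x (ℤ.suc i) ≈ x ∙ pow x i
  pow-suc x (+ n) = refl
  pow-suc x -[1+ zero ] = sym (solve 1 (λ x → x ⊕ ⊝ (x ⊕ e) ⊜ e) refl x)
  pow-suc x -[1+ suc n ] =
    trans (solve 2 (λ x y → ⊝ y ⊜ x ⊕ ⊝ (y ⊕ x)) refl x (_^ᴳ_ G x (suc n)))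
          (∙-congˡ (⁻¹-cong (times-comm x (suc n))))

  pow-pred : ∀ x i → pow x (ℤ.pred i) ≈ x ⁻¹ ∙ pow x i
  pow-pred x i = begin
    pow x (ℤ.pred i)                     ≈⟨ \\-leftDividesʳ x _ ⟨
    x ⁻¹ ∙ (x ∙ pow x (ℤ.pred i))        ≈⟨ ∙-congˡ (pow-suc x (ℤ.pred i)) ⟨
    x ⁻¹ ∙ pow x (ℤ.suc (ℤ.pred i))      ≡⟨ ≡.cong (λ j → x ⁻¹ ∙ pow x j) (ℤ.suc-pred i) ⟩
    x ⁻¹ ∙ pow x i                       ∎

  ℤ-induction : ∀ {p} (P : ℤ → Set p) → P (+ 0) → (∀ i → P i → P (ℤ.suc i)) →
                (∀ i → P i → P (ℤ.pred i)) → ∀ i → P i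
  ℤ-induction P p₀ up down (+ zero)     = p₀
  ℤ-induction P p₀ up down (+ suc n)    = up (+ n) (ℤ-induction P p₀ up down (+ n))
  ℤ-induction P p₀ up down -[1+ zero ]  = down (+ 0) p₀
  ℤ-induction P p₀ up down -[1+ suc n ] = down -[1+ n ] (ℤ-induction P p₀ up down -[1+ n ])

  -- The common principle behind the power laws: sums and products of exponents, congruence and
  -- conjugation each exhibit such an `f`.
  hom-unique : ∀ x (f : ℤ → Carrier) → f (+ 0) ≈ ε → (∀ i → f (ℤ.suc i) ≈ x ∙ f i) →
               ∀ i → f i ≈ pow x i
  hom-unique x f f0 fs = ℤ-induction (λ i → f i ≈ pow x i) f0
    (λ i fi → trans (fs i) (trans (∙-congˡ fi) (sym (pow-suc x i))))
    (λ i fi → begin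
      f (ℤ.pred i)                    ≈⟨ \\-leftDividesʳ x _ ⟨
      x ⁻¹ ∙ (x ∙ f (ℤ.pred i))       ≈⟨ ∙-congˡ (fs (ℤ.pred i)) ⟨
      x ⁻¹ ∙ f (ℤ.suc (ℤ.pred i))     ≡⟨ ≡.cong (λ j → x ⁻¹ ∙ f j) (ℤ.suc-pred i) ⟩
      x ⁻¹ ∙ f i                      ≈⟨ ∙-congˡ fi ⟩
      x ⁻¹ ∙ pow x i                  ≈⟨ pow-pred x i ⟨
      pow x (ℤ.pred i)                ∎)

  pow-+ : ∀ x i j → pow x (i ℤ.+ j) ≈ pow x i ∙ pow x j
  pow-+ x i j = begin
    pow x (i ℤ.+ j)                      ≈⟨ solve 2 (λ a b → a ⊜ a ⊕ ⊝ b ⊕ b) refl _ (pow x j) ⟩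
    pow x (i ℤ.+ j) ∙ pow x j ⁻¹ ∙ pow x j
      ≈⟨ ∙-congʳ (hom-unique x (λ i → pow x (i ℤ.+ j) ∙ pow x j ⁻¹) f0 fs i) ⟩
    pow x i ∙ pow x j                    ∎
    where
    f0 : pow x (+ 0 ℤ.+ j) ∙ pow x j ⁻¹ ≈ ε
    f0 = trans (∙-congʳ (reflexive (≡.cong (pow x) (ℤ.+-identityˡ j)))) (inverseʳ _)
    fs : ∀ i → pow x (ℤ.suc i ℤ.+ j) ∙ pow x j ⁻¹ ≈ x ∙ (pow x (i ℤ.+ j) ∙ pow x j ⁻¹)
    fs i = trans (∙-congʳ (trans (reflexive (≡.cong (pow x) (ℤ.+-assoc (+ 1) i j)))
                                 (pow-suc x (i ℤ.+ j)))) (assoc _ _ _)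

  pow-1 : ∀ x → pow x (+ 1) ≈ x
  pow-1 x = identityʳ x

  pow-neg : ∀ x i → pow x (ℤ.- i) ≈ pow x i ⁻¹
  pow-neg x i = inverseˡ-unique _ _ (begin
    pow x (ℤ.- i) ∙ pow x i   ≈⟨ pow-+ x (ℤ.- i) i ⟨
    pow x (ℤ.- i ℤ.+ i)       ≡⟨ ≡.cong (pow x) (ℤ.+-inverseˡ i) ⟩
    ε                         ∎)

  pow-- : ∀ x i j → pow x (i ℤ.- j) ≈ pow x i ∙ pow x j ⁻¹
  pow-- x i j = trans (pow-+ x i (ℤ.- j)) (∙-congˡ (pow-neg x j))

  pow-comm : ∀ x i j → pow x i ∙ pow x j ≈ pow x j ∙ pow x i
  pow-comm x i j = begin
    pow x i ∙ pow x j  ≈⟨ pow-+ x i j ⟨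
    pow x (i ℤ.+ j)    ≡⟨ ≡.cong (pow x) (ℤ.+-comm i j) ⟩
    pow x (j ℤ.+ i)    ≈⟨ pow-+ x j i ⟩
    pow x j ∙ pow x i  ∎

  pow-cong : ∀ {x y} → x ≈ y → ∀ i → pow x i ≈ pow y i
  pow-cong {x} {y} x≈y = hom-unique y (pow x) refl (λ i → trans (pow-suc x i) (∙-congʳ x≈y))

  pow-* : ∀ x i j → pow x (i ℤ.* j) ≈ pow (pow x i) j
  pow-* x i = hom-unique (pow x i) (λ j → pow x (i ℤ.* j))
    (reflexive (≡.cong (pow x) (ℤ.*-zeroʳ i)))
    (λ j → trans (reflexive (≡.cong (pow x) (ℤ.*-suc i j))) (pow-+ x i (i ℤ.* j)))

  pow-conj : ∀ t x i → t ∙ pow x i ∙ t ⁻¹ ≈ pow (t ∙ x ∙ t ⁻¹) i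
  pow-conj t x = hom-unique (t ∙ x ∙ t ⁻¹) (λ i → t ∙ pow x i ∙ t ⁻¹)
    (solve 1 (λ t → t ⊕ e ⊕ ⊝ t ⊜ e) refl t)
    (λ i → trans (∙-congʳ (∙-congˡ (pow-suc x i)))
      (solve 3 (λ t x y → t ⊕ (x ⊕ y) ⊕ ⊝ t ⊜ t ⊕ x ⊕ ⊝ t ⊕ (t ⊕ y ⊕ ⊝ t)) refl t x (pow x i)))

  conj-pow : ∀ t x a b k → t ∙ pow x a ∙ t ⁻¹ ≈ pow x b →
             t ∙ pow x (a ℤ.* k) ∙ t ⁻¹ ≈ pow x (b ℤ.* k)
  conj-pow t x a b k eq = begin
    t ∙ pow x (a ℤ.* k) ∙ t ⁻¹       ≈⟨ ∙-congʳ (∙-congˡ (pow-* x a k)) ⟩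
    t ∙ pow (pow x a) k ∙ t ⁻¹       ≈⟨ pow-conj t (pow x a) k ⟩
    pow (t ∙ pow x a ∙ t ⁻¹) k       ≈⟨ pow-cong eq k ⟩
    pow (pow x b) k                  ≈⟨ pow-* x b k ⟨
    pow x (b ℤ.* k)                  ∎

  pow-sucʳ : ∀ x i → pow x (ℤ.suc i) ≈ pow x i ∙ x
  pow-sucʳ x i = begin
    pow x (ℤ.suc i)        ≡⟨ ≡.cong (pow x) (ℤ.+-comm (+ 1) i) ⟩
    pow x (i ℤ.+ + 1)      ≈⟨ pow-+ x i (+ 1) ⟩
    pow x i ∙ pow x (+ 1)  ≈⟨ ∙-congˡ (pow-1 x) ⟩
    pow x i ∙ x            ∎

  pow-predʳ : ∀ x i → pow x (ℤ.pred i) ∙ x ≈ pow x i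
  pow-predʳ x i = trans (sym (pow-sucʳ x (ℤ.pred i))) (reflexive (≡.cong (pow x) (ℤ.suc-pred i)))

  pow-⁻¹ : ∀ x i → pow (x ⁻¹) i ≈ pow x (ℤ.- i)
  pow-⁻¹ x i = begin
    pow (x ⁻¹) i               ≈⟨ pow-cong (⁻¹-cong (pow-1 x)) i ⟨
    pow (pow x (ℤ.- + 1)) i    ≈⟨ pow-* x (ℤ.- + 1) i ⟨
    pow x (ℤ.- + 1 ℤ.* i)      ≡⟨ ≡.cong (pow x) (ℤ.-1*i≡-i i) ⟩
    pow x (ℤ.- i)              ∎

-- Generated subgroups and centralisers

module Conversion {c ℓ} (G : Group c ℓ) where
  open Group G

  -- An equation follows from any equation of which it is a two-sided multiple.
  via : ∀ a b {u v x y} → u ≈ v → x ≈ a ∙ u ∙ b → a ∙ v ∙ b ≈ y → x ≈ y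
  via a b u≈v l r = trans l (trans (∙-congʳ (∙-congˡ u≈v)) r)

module Generation {c ℓ} (G : Group c ℓ) where
  open Group G
  open SetoidReasoning setoid

  image : ∀ {r} → (Fin r → Carrier) → Subset setoid ℓ
  image X = record
    { Member = λ y → ∃ λ i → y ≈ X i
    ; resp   = λ { y≈z (i , y≈Xi) → i , trans (sym y≈z) y≈Xi } }

  record SubgroupPredicate {q} (P : Carrier → Set q) : Set (c ⊔ ℓ ⊔ q) where
    field
      ε∈   : P ε
      ∙∈   : ∀ {x y} → P x → P y → P (x ∙ y)
      ⁻¹∈  : ∀ {x} → P x → P (x ⁻¹)
      resp∈ : ∀ {x y} → x ≈ y → P x → P y

  generated-induction : ∀ {p q} {S : Subset setoid p} {P : Carrier → Set q} → SubgroupPredicate P →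
                        (∀ {x} → x ∈ S → P x) → ∀ {x} → Generated G S x → P x
  generated-induction {S = S} {P} sub base = go
    where
    open SubgroupPredicate sub
    go : ∀ {x} → Generated G S x → P x
    go (gen x∈S)    = base x∈S
    go unit         = ε∈
    go (mul a b)    = ∙∈ (go a) (go b)
    go (inv a)      = ⁻¹∈ (go a)
    go (resp a≈b a) = resp∈ a≈b (go a)

  centralizer : ∀ y → SubgroupPredicate (λ x → x ∙ y ≈ y ∙ x)
  centralizer y = record
    { ε∈ = trans (identityˡ y) (sym (identityʳ y))
    ; ∙∈ = λ {a} {b} p q → begin
        a ∙ b ∙ y   ≈⟨ assoc _ _ _ ⟩
        a ∙ (b ∙ y) ≈⟨ ∙-congˡ q ⟩
        a ∙ (y ∙ b) ≈⟨ assoc _ _ _ ⟨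
        a ∙ y ∙ b   ≈⟨ ∙-congʳ p ⟩
        y ∙ a ∙ b   ≈⟨ assoc _ _ _ ⟩
        y ∙ (a ∙ b) ∎
    ; ⁻¹∈ = λ {a} p → via (a ⁻¹) (a ⁻¹) (sym p)
        (solve 2 (λ a y → ⊝ a ⊕ y ⊜ ⊝ a ⊕ (y ⊕ a) ⊕ ⊝ a) refl a y)
        (solve 2 (λ a y → ⊝ a ⊕ (a ⊕ y) ⊕ ⊝ a ⊜ y ⊕ ⊝ a) refl a y)
    ; resp∈ = λ p q → trans (∙-congʳ (sym p)) (trans q (∙-congˡ p))
    }
    where
    open GroupSolver G using (solve; _⊜_; _⊕_; ⊝_)
    open Conversion G

  -- Commutation extends one side at a time: induct on `y` inside the centraliser of a fixed letter,
  -- then on `x` inside the centraliser of `y`.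
  generated-commute : ∀ {p} {S : Subset setoid p} → (∀ {x y} → x ∈ S → y ∈ S → x ∙ y ≈ y ∙ x) →
                      ∀ {x y} → Generated G S x → Generated G S y → x ∙ y ≈ y ∙ x
  generated-commute comm {x} {y} x∈ y∈ =
    generated-induction (centralizer y)
      (λ {a} a∈S → sym (generated-induction (centralizer a) (λ b∈S → comm b∈S a∈S) y∈)) x∈

-- Elements that centralise or invert `g`

-- Treats infinite order and large finite order uniformly.
NoSmallPower : ∀ {c ℓ} (G : Group c ℓ) → Group.Carrier G → ℕ → Set ℓ
NoSmallPower G g N = ∀ m → 0 ℕ.< m → m ℕ.< N → ¬ (_^ᴳ_ G g m ≈ ε)
  where open Group G

module Normalizer {c ℓ} (G : Group c ℓ) (g : Group.Carrier G) where
  open Group G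
  open GroupProperties G
  open GroupSolver G using (solve; _⊜_; _⊕_; ⊝_; e)
  open Conversion G
  open Generation G
  open SetoidReasoning setoid

  Cent Flip Norm : Carrier → Set ℓ
  Cent h = h ∙ g ≈ g ∙ h
  Flip h = h ∙ g ≈ g ⁻¹ ∙ h
  Norm h = Cent h ⊎ Flip h

  flip-flip : ∀ {a b} → Flip a → Flip b → Cent (a ∙ b)
  flip-flip {a} {b} p q = begin
    a ∙ b ∙ g        ≈⟨ assoc _ _ _ ⟩
    a ∙ (b ∙ g)      ≈⟨ ∙-congˡ q ⟩
    a ∙ (g ⁻¹ ∙ b)   ≈⟨ via g (g ⁻¹ ∙ b) (sym p)
                          (solve 3 (λ a b g → a ⊕ (⊝ g ⊕ b) ⊜ g ⊕ (⊝ g ⊕ a) ⊕ (⊝ g ⊕ b)) refl a b g)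
                          (solve 3 (λ a b g → g ⊕ (a ⊕ g) ⊕ (⊝ g ⊕ b) ⊜ g ⊕ (a ⊕ b)) refl a b g) ⟩
    g ∙ (a ∙ b)      ∎

  flip-⁻¹ : ∀ {a} → Flip a → Flip (a ⁻¹)
  flip-⁻¹ {a} p = begin
    a ⁻¹ ∙ g          ≈⟨ solve 2 (λ a g → ⊝ a ⊕ g ⊜ ⊝ (⊝ g ⊕ a)) refl a g ⟩
    (g ⁻¹ ∙ a) ⁻¹     ≈⟨ ⁻¹-cong p ⟨
    (a ∙ g) ⁻¹        ≈⟨ solve 2 (λ a g → ⊝ (a ⊕ g) ⊜ ⊝ g ⊕ ⊝ a) refl a g ⟩
    g ⁻¹ ∙ a ⁻¹       ∎

  cent∙flip : ∀ {a b} → Cent a → Flip b → Flip (a ∙ b)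
  cent∙flip {a} {b} p q = begin
    a ∙ b ∙ g        ≈⟨ assoc _ _ _ ⟩
    a ∙ (b ∙ g)      ≈⟨ ∙-congˡ q ⟩
    a ∙ (g ⁻¹ ∙ b)   ≈⟨ via (g ⁻¹) (g ⁻¹ ∙ b) (sym p)
                          (solve 3 (λ a b g → a ⊕ (⊝ g ⊕ b) ⊜ ⊝ g ⊕ (g ⊕ a) ⊕ (⊝ g ⊕ b)) refl a b g)
                          (solve 3 (λ a b g → ⊝ g ⊕ (a ⊕ g) ⊕ (⊝ g ⊕ b) ⊜ ⊝ g ⊕ (a ⊕ b)) refl a b g) ⟩
    g ⁻¹ ∙ (a ∙ b)   ∎

  norm-resp : ∀ {a b} → a ≈ b → Norm a → Norm b
  norm-resp a≈b (inj₁ p) = inj₁ (trans (∙-congʳ (sym a≈b)) (trans p (∙-congˡ a≈b)))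
  norm-resp a≈b (inj₂ p) = inj₂ (trans (∙-congʳ (sym a≈b)) (trans p (∙-congˡ a≈b)))

  cent-⁻¹ : ∀ {a} → Cent a → Cent (a ⁻¹)
  cent-⁻¹ = SubgroupPredicate.⁻¹∈ (centralizer g)

  flip∙cent : ∀ {a b} → Flip a → Cent b → Flip (a ∙ b)
  flip∙cent {a} {b} p q = begin
    a ∙ b ∙ g        ≈⟨ assoc _ _ _ ⟩
    a ∙ (b ∙ g)      ≈⟨ ∙-congˡ q ⟩
    a ∙ (g ∙ b)      ≈⟨ assoc _ _ _ ⟨
    a ∙ g ∙ b        ≈⟨ ∙-congʳ p ⟩
    g ⁻¹ ∙ a ∙ b     ≈⟨ assoc _ _ _ ⟩
    g ⁻¹ ∙ (a ∙ b)   ∎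

  norm-∙ : ∀ {a b} → Norm a → Norm b → Norm (a ∙ b)
  norm-∙ (inj₁ p) (inj₁ q) = inj₁ (SubgroupPredicate.∙∈ (centralizer g) p q)
  norm-∙ (inj₁ p) (inj₂ q) = inj₂ (cent∙flip p q)
  norm-∙ (inj₂ p) (inj₁ q) = inj₂ (flip∙cent p q)
  norm-∙ (inj₂ p) (inj₂ q) = inj₁ (flip-flip p q)

  norm-⁻¹ : ∀ {a} → Norm a → Norm (a ⁻¹)
  norm-⁻¹ (inj₁ p) = inj₁ (cent-⁻¹ p)
  norm-⁻¹ (inj₂ p) = inj₂ (flip-⁻¹ p)

  module Torsion (g-order : NoSmallPower G g 5) where
    g⁴≉ε : ¬ (g ∙ g ∙ (g ∙ g) ≈ ε)
    g⁴≉ε p = g-order 4 (s≤s z≤n) ℕ.≤-refl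
      (trans (solve 1 (λ g → g ⊕ (g ⊕ (g ⊕ (g ⊕ e))) ⊜ g ⊕ g ⊕ (g ⊕ g)) refl g) p)

    g²≉ε : ¬ (g ∙ g ≈ ε)
    g²≉ε p = g⁴≉ε (trans (∙-cong p p) (identityˡ ε))

    g≉g⁻¹ : ¬ (g ≈ g ⁻¹)
    g≉g⁻¹ p = g²≉ε (trans (∙-congˡ p) (inverseʳ g))

    -- Conjugation by `h` fixes `h²` but inverts `g²`, so equality of the two squares gives
    -- `g⁴ = 1`.
    flip-square : ∀ {h} → Flip h → ¬ (h ∙ h ≈ g ∙ g)
    flip-square {h} p hh≈gg = g⁴≉ε (begin
      g ∙ g ∙ (g ∙ g)                            ≈⟨ ∙-congˡ hh≈gg ⟨
      g ∙ g ∙ (h ∙ h)                            ≈⟨ solve 2 (λ g h →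
        g ⊕ g ⊕ (h ⊕ h) ⊜ g ⊕ g ⊕ h ⊕ (h ⊕ h) ⊕ ⊝ h) refl g h ⟩
      g ∙ g ∙ h ∙ (h ∙ h) ∙ h ⁻¹                 ≈⟨ ∙-congʳ (∙-congˡ hh≈gg) ⟩
      g ∙ g ∙ h ∙ (g ∙ g) ∙ h ⁻¹                 ≈⟨ via (g ∙ g) (g ∙ h ⁻¹) p
        (solve 2 (λ g h → g ⊕ g ⊕ h ⊕ (g ⊕ g) ⊕ ⊝ h ⊜ g ⊕ g ⊕ (h ⊕ g) ⊕ (g ⊕ ⊝ h)) refl g h)
        (solve 2 (λ g h → g ⊕ g ⊕ (⊝ g ⊕ h) ⊕ (g ⊕ ⊝ h) ⊜ g ⊕ (h ⊕ g) ⊕ ⊝ h) refl g h) ⟩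
      g ∙ (h ∙ g) ∙ h ⁻¹                         ≈⟨ via g (h ⁻¹) p refl
        (solve 2 (λ g h → g ⊕ (⊝ g ⊕ h) ⊕ ⊝ h ⊜ e) refl g h) ⟩
      ε                                          ∎)

-- Cocycles

-- Keeps only the differences `φ(x)⁻¹ φ(x h)` of a vertex map φ. For such a cocycle, φ is a left
-- multiplication exactly if every `h` is `Fixed`.
record Cocycle {c ℓ} (G : Group c ℓ) : Set (c ⊔ ℓ) where
  open Group G
  field
    δ      : Carrier → Carrier → Carrier
    δ-cong : ∀ {x y h k} → x ≈ y → h ≈ k → δ x h ≈ δ y k
    δ-∙    : ∀ x h k → δ x (h ∙ k) ≈ δ x h ∙ δ (x ∙ h) k

  open GroupProperties G
  open Generation G
  open SetoidReasoning setoid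

  Fixed : Carrier → Set (c ⊔ ℓ)
  Fixed h = ∀ x → δ x h ≈ h

  Signed : Carrier → Set (c ⊔ ℓ)
  Signed h = ∀ x → δ x h ≈ h ⊎ δ x h ≈ h ⁻¹

  δ-ε : ∀ x → δ x ε ≈ ε
  δ-ε x = identityʳ-unique (δ x ε) _ (begin
    δ x ε ∙ δ x ε         ≈⟨ ∙-congˡ (δ-cong (identityʳ x) refl) ⟨
    δ x ε ∙ δ (x ∙ ε) ε   ≈⟨ δ-∙ x ε ε ⟨
    δ x (ε ∙ ε)           ≈⟨ δ-cong refl (identityˡ ε) ⟩
    δ x ε                 ∎)

  δ-⁻¹ : ∀ x h → δ x (h ⁻¹) ≈ δ (x ∙ h ⁻¹) h ⁻¹
  δ-⁻¹ x h = inverseˡ-unique _ _ (begin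
    δ x (h ⁻¹) ∙ δ (x ∙ h ⁻¹) h   ≈⟨ δ-∙ x (h ⁻¹) h ⟨
    δ x (h ⁻¹ ∙ h)                ≈⟨ δ-cong refl (inverseˡ h) ⟩
    δ x ε                         ≈⟨ δ-ε x ⟩
    ε                             ∎)

  -- Closure under products needs the quantification over all base points, since the second factor
  -- is evaluated at `x ∙ a`. `Signed` has no such closure, as the signs of the two factors may
  -- differ.
  fixed-subgroup : SubgroupPredicate Fixed
  fixed-subgroup = record
    { ε∈ = δ-ε
    ; ∙∈ = λ {a} {b} p q x → trans (δ-∙ x a b) (∙-cong (p x) (q (x ∙ a)))
    ; ⁻¹∈ = λ {a} p x → trans (δ-⁻¹ x a) (⁻¹-cong (p (x ∙ a ⁻¹)))
    ; resp∈ = λ a≈b p x → trans (δ-cong refl (sym a≈b)) (trans (p x) a≈b)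
    }

  signed-⁻¹ : ∀ {h} → Signed h → Signed (h ⁻¹)
  signed-⁻¹ {h} s x = [ (λ p → inj₁ (trans (δ-⁻¹ x h) (⁻¹-cong p)))
                      , (λ p → inj₂ (trans (δ-⁻¹ x h) (⁻¹-cong p))) ]′ (s (x ∙ h ⁻¹))

  signed-resp : ∀ {h k} → h ≈ k → Signed h → Signed k
  signed-resp h≈k s x = [ (λ p → inj₁ (trans (δ-cong refl (sym h≈k)) (trans p h≈k)))
                        , (λ p → inj₂ (trans (δ-cong refl (sym h≈k)) (trans p (⁻¹-cong h≈k)))) ]′ (s x)

-- Words of bounded length

module Words {c ℓ} (G : Group c ℓ) {r : ℕ} (X : Fin r → Group.Carrier G) where
  open Group G

  data Word : ℕ → Carrier → Set (c ⊔ ℓ) where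
    empty : ∀ {k h} → h ≈ ε → Word k h
    cons  : ∀ {k h} i w → Word k w → h ≈ X i ∙ w → Word (suc k) h

  word-resp : ∀ {k x y} → x ≈ y → Word k x → Word k y
  word-resp x≈y (empty x≈ε)     = empty (trans (sym x≈y) x≈ε)
  word-resp x≈y (cons i w p eq) = cons i w p (trans (sym x≈y) eq)

  word-mono : ∀ {j k x} → j ℕ.≤ k → Word j x → Word k x
  word-mono _         (empty x≈ε)     = empty x≈ε
  word-mono (s≤s j≤k) (cons i w p eq) = cons i w (word-mono j≤k p) eq

  word-∙ : ∀ {j k x y} → Word j x → Word k y → Word (j ℕ.+ k) (x ∙ y)
  word-∙ {j} {k} (empty x≈ε) q =
    word-mono (ℕ.m≤n+m k j) (word-resp (sym (trans (∙-congʳ x≈ε) (identityˡ _))) q)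
  word-∙ (cons i w p eq) q = cons i _ (word-∙ p q) (trans (∙-congʳ eq) (assoc _ _ _))

  letter-word : ∀ i → Word 1 (X i)
  letter-word i = cons i ε (empty refl) (sym (identityʳ _))

  -- The additional letter `ε` pads short words, so that `(r + 1)ᵏ` codes cover all words of length
  -- at most `k`.
  letterOrε : Fin (suc r) → Carrier
  letterOrε zero    = ε
  letterOrε (suc i) = X i

  word : ∀ k → Fin (suc r ℕ.^ k) → Carrier
  word zero    _ = ε
  word (suc k) i = let (l , j) = remQuot (suc r ℕ.^ k) i in letterOrε l ∙ word k j

  word-combine : ∀ k l j → word (suc k) (combine {suc r} l j) ≡ letterOrε l ∙ word k j
  word-combine k l j = ≡.cong (λ (l , j) → letterOrε l ∙ word k j) (Fin.remQuot-combine {suc r} {suc r ℕ.^ k} l j)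

  word-covers : ∀ {k h} → Word k h → ∃ λ i → h ≈ word k i
  word-covers {zero}  (empty h≈ε) = zero , h≈ε
  word-covers {suc k} (empty h≈ε) = let (j , ε≈) = word-covers {k} (empty refl) in
    combine {suc r} zero j ,
    trans h≈ε (trans ε≈ (trans (sym (identityˡ _)) (reflexive (≡.sym (word-combine k zero j)))))
  word-covers {suc k} (cons i w p h≈) = let (j , w≈) = word-covers p in
    combine {suc r} (suc i) j , trans h≈ (trans (∙-congˡ w≈) (reflexive (≡.sym (word-combine k (suc i) j))))

-- From signs on short words to rigidity

module Rigidity
  (em : ∀ {a} → ExcludedMiddle a) {c ℓ} (G : Group c ℓ)
  (¬abelian : ¬ Abelian G) (¬dicyclic : ¬ IsGeneralizedDicyclic G)
  {r : ℕ} (X : Fin r → Group.Carrier G) (X-generates : Generates G (Generation.image G X))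
  (g : Group.Carrier G) (g-order : NoSmallPower G g 5)
  where
  open Group G
  open Generation G
  open GroupProperties G
  open GroupSolver G using (solve; _⊜_; _⊕_; ⊝_; e)
  open Conversion G
  open Normalizer G g
  open Torsion g-order
  open Words G X
  open SetoidReasoning setoid

  module _ (Δ : Cocycle G) where
    open Cocycle Δ
    open SubgroupPredicate fixed-subgroup using () renaming (∙∈ to fixed-∙; ⁻¹∈ to fixed-⁻¹; resp∈ to fixed-resp)

    -- The longest words needed are t s s′ in the module Dicyclic, where t is a letter and s, s′ have
    -- length two.
    module _
      (δ-g : ∀ x → (δ x g ≈ g × δ x (g ∙ g) ≈ g ∙ g) ⊎ (δ x g ≈ g ⁻¹ × δ x (g ∙ g) ≈ (g ∙ g) ⁻¹))
      (fixed : ∀ {h} → Word 5 h → ¬ Norm h → Fixed h × Fixed g)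
      (signed : ∀ {h} → Word 5 h → Norm h → Signed h × Signed (h ∙ g))
      where

      -- If `δ x h = h⁻¹`, then `δ x (h g) = h⁻¹ g`. Equality with `h g` says `h = h⁻¹`, and
      -- equality with `(h g)⁻¹ = h⁻¹ g⁻¹` is impossible.
      fixed-cent : Fixed g → ∀ {h} → Word 5 h → Cent h → Fixed h
      fixed-cent fix {h} w hg≈gh x with proj₁ (signed w (inj₁ hg≈gh)) x | proj₂ (signed w (inj₁ hg≈gh)) x
      ... | inj₁ p | _      = p
      ... | inj₂ p | inj₁ q = trans p (∙-cancelʳ g _ _ (begin
        h ⁻¹ ∙ g              ≈⟨ ∙-cong p (fix (x ∙ h)) ⟨
        δ x h ∙ δ (x ∙ h) g   ≈⟨ δ-∙ x h g ⟨
        δ x (h ∙ g)           ≈⟨ q ⟩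
        h ∙ g                 ∎))
      ... | inj₂ p | inj₂ q = contradiction (∙-cancelˡ (h ⁻¹) _ _ (begin
        h ⁻¹ ∙ g              ≈⟨ ∙-cong p (fix (x ∙ h)) ⟨
        δ x h ∙ δ (x ∙ h) g   ≈⟨ δ-∙ x h g ⟨
        δ x (h ∙ g)           ≈⟨ q ⟩
        (h ∙ g) ⁻¹            ≈⟨ ⁻¹-cong hg≈gh ⟩
        (g ∙ h) ⁻¹            ≈⟨ ⁻¹-anti-homo-∙ g h ⟩
        h ⁻¹ ∙ g ⁻¹           ∎)) g≉g⁻¹

      -- Applied at x = y h⁻¹ this determines δ y g.
      flip-fixes-g : ∀ {h} → Word 5 h → Flip h → Fixed g
      flip-fixes-g {h} w hg≈g⁻¹h y with δ-g y
      ... | inj₁ (p , _) = p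
      ... | inj₂ (p , _) = ⊥-elim (signs (proj₁ S x) (proj₂ S x))
        where
        S = signed w (inj₂ hg≈g⁻¹h)
        x = y ∙ h ⁻¹
        xh≈y : x ∙ h ≈ y
        xh≈y = //-rightDividesˡ h y
        expand : ∀ {v} → δ x h ≈ v → δ x (h ∙ g) ≈ v ∙ g ⁻¹
        expand q = trans (δ-∙ x h g) (∙-cong q (trans (δ-cong xh≈y refl) p))
        hg⁻¹ : (h ∙ g) ⁻¹ ≈ h ⁻¹ ∙ g
        hg⁻¹ = trans (⁻¹-cong hg≈g⁻¹h) (solve 2 (λ g h → ⊝ (⊝ g ⊕ h) ⊜ ⊝ h ⊕ g) refl g h)
        signs : δ x h ≈ h ⊎ δ x h ≈ h ⁻¹ → δ x (h ∙ g) ≈ h ∙ g ⊎ δ x (h ∙ g) ≈ (h ∙ g) ⁻¹ → ⊥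
        signs (inj₁ q) (inj₁ q′) = g≉g⁻¹ (sym (∙-cancelˡ h _ _ (trans (sym (expand q)) q′)))
        signs (inj₂ q) (inj₂ q′) =
          g≉g⁻¹ (sym (∙-cancelˡ (h ⁻¹) _ _ (trans (sym (expand q)) (trans q′ hg⁻¹))))
        -- Unequal signs would give `h² = g²` here and `h⁻² = g²` in the next clause; both `h` and
        -- `h⁻¹` invert `g`.
        signs (inj₁ q) (inj₂ q′) = flip-square hg≈g⁻¹h
          (via h g (trans (sym (expand q)) (trans q′ hg⁻¹))
            (solve 2 (λ g h → h ⊕ h ⊜ h ⊕ (h ⊕ ⊝ g) ⊕ g) refl g h)
            (solve 2 (λ g h → h ⊕ (⊝ h ⊕ g) ⊕ g ⊜ g ⊕ g) refl g h))
        signs (inj₂ q) (inj₁ q′) = flip-square (flip-⁻¹ hg≈g⁻¹h)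
          (via (h ⁻¹) g (trans (sym (expand q)) q′)
            (solve 2 (λ g h → ⊝ h ⊕ ⊝ h ⊜ ⊝ h ⊕ (⊝ h ⊕ ⊝ g) ⊕ g) refl g h)
            (solve 2 (λ g h → ⊝ h ⊕ (h ⊕ g) ⊕ g ⊜ g ⊕ g) refl g h))

      -- The instances k = g and k = g² together are contradictory.
      cent-sign : ∀ {v w} k → ¬ (k ∙ k ≈ ε) → v ∙ k ≈ k ∙ v → w ≈ v ⊎ w ≈ v ⁻¹ →
                  v ∙ k ≈ k ⁻¹ ∙ w → v ∙ v ≈ (k ∙ k) ⁻¹
      cent-sign {v} {w} k k²≉ε vk≈kv (inj₁ w≈v) eq = contradiction
        (via k (v ⁻¹) (trans (sym vk≈kv) (trans eq (∙-congˡ w≈v)))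
          (solve 2 (λ k v → k ⊕ k ⊜ k ⊕ (k ⊕ v) ⊕ ⊝ v) refl k v)
          (solve 2 (λ k v → k ⊕ (⊝ k ⊕ v) ⊕ ⊝ v ⊜ e) refl k v)) k²≉ε
      cent-sign {v} {w} k k²≉ε vk≈kv (inj₂ w≈v⁻¹) eq =
        via (k ⁻¹) v (trans (sym vk≈kv) (trans eq (∙-congˡ w≈v⁻¹)))
          (solve 2 (λ k v → v ⊕ v ⊜ ⊝ k ⊕ (k ⊕ v) ⊕ v) refl k v)
          (solve 2 (λ k v → ⊝ k ⊕ (⊝ k ⊕ ⊝ v) ⊕ v ⊜ ⊝ (k ⊕ k)) refl k v)

      signed-either : ∀ {h} → Signed h → ∀ {v} x y → δ x h ≈ v → δ y h ≈ v ⊎ δ y h ≈ v ⁻¹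
      signed-either {h} s {v} x y p with s x | s y
      ... | inj₁ q | inj₁ q′ = inj₁ (trans q′ (trans (sym q) p))
      ... | inj₁ q | inj₂ q′ = inj₂ (trans q′ (⁻¹-cong (trans (sym q) p)))
      ... | inj₂ q | inj₁ q′ = inj₂ (trans q′ (trans (sym (⁻¹-involutive h)) (⁻¹-cong (trans (sym q) p))))
      ... | inj₂ q | inj₂ q′ = inj₁ (trans q′ (trans (sym q) p))

      -- Passing from `x` to `x ∙ h` cannot change the sign at `g`. Otherwise, with `v = δ x h`,
      -- expanding `δ x (h k) = δ x (k h)` in both orders yields `v² = g⁻²` for `k = g` and
      -- `v² = g⁻⁴` for `k = g²`, whence `g² = 1`.
      cent-inverts-g : ∀ {h x} → Word 5 h → Cent h → δ x g ≈ g ⁻¹ → δ x (g ∙ g) ≈ (g ∙ g) ⁻¹ →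
                       δ (x ∙ h) g ≈ g ⁻¹ × δ (x ∙ h) (g ∙ g) ≈ (g ∙ g) ⁻¹
      cent-inverts-g {h} {x} w hg≈gh p p² with δ-g (x ∙ h)
      ... | inj₂ q = q
      ... | inj₁ (q , q²) = contradiction
          (trans (sym (v²≈ g g²≉ε hg≈gh q p)) (v²≈ (g ∙ g) g⁴≉ε hgg≈ggh q² p²))
          (λ eq → g²≉ε (via (g ∙ g ∙ (g ∙ g)) ε eq
             (solve 1 (λ g → g ⊕ g ⊜ g ⊕ g ⊕ (g ⊕ g) ⊕ ⊝ (g ⊕ g) ⊕ e) refl g)
             (solve 1 (λ g → g ⊕ g ⊕ (g ⊕ g) ⊕ ⊝ (g ⊕ g ⊕ (g ⊕ g)) ⊕ e ⊜ e) refl g)))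
        where
        v = δ x h
        S = proj₁ (signed w (inj₁ hg≈gh))
        hgg≈ggh : h ∙ (g ∙ g) ≈ g ∙ g ∙ h
        hgg≈ggh = sym (∙∈ (sym hg≈gh) (sym hg≈gh)) where open SubgroupPredicate (centralizer h)
        v-comm : ∀ {k} → h ∙ k ≈ k ∙ h → v ∙ k ≈ k ∙ v
        v-comm {k} hk≈kh with S x
        ... | inj₁ v≈h = trans (∙-congʳ v≈h) (trans hk≈kh (∙-congˡ (sym v≈h)))
        ... | inj₂ v≈h⁻¹ = trans (∙-congʳ v≈h⁻¹)
                (trans (SubgroupPredicate.⁻¹∈ (centralizer k) hk≈kh) (∙-congˡ (sym v≈h⁻¹)))
        v²≈ : ∀ k → ¬ (k ∙ k ≈ ε) → h ∙ k ≈ k ∙ h → δ (x ∙ h) k ≈ k → δ x k ≈ k ⁻¹ → v ∙ v ≈ (k ∙ k) ⁻¹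
        v²≈ k k²≉ε hk≈kh δk δ′k = cent-sign k k²≉ε (v-comm hk≈kh) (signed-either S x (x ∙ k) refl) (begin
          v ∙ k                     ≈⟨ ∙-congˡ δk ⟨
          v ∙ δ (x ∙ h) k           ≈⟨ δ-∙ x h k ⟨
          δ x (h ∙ k)               ≈⟨ δ-cong refl hk≈kh ⟩
          δ x (k ∙ h)               ≈⟨ δ-∙ x k h ⟩
          δ x k ∙ δ (x ∙ k) h       ≈⟨ ∙-congʳ δ′k ⟩
          k ⁻¹ ∙ δ (x ∙ k) h        ∎)

      -- If `δ x h = h`, then `δ x (h g) = h g⁻¹`. This cannot be `h g`, and if it is `(h g)⁻¹` then
      -- `h = h⁻¹`, so that the claim holds in this case too.
      cent-inverted : ∀ {h x} → Word 5 h → Cent h → δ x g ≈ g ⁻¹ → δ x (g ∙ g) ≈ (g ∙ g) ⁻¹ → δ x h ≈ h ⁻¹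
      cent-inverted {h} {x} w hg≈gh p p²
        with proj₁ (signed w (inj₁ hg≈gh)) x | proj₂ (signed w (inj₁ hg≈gh)) x
      ... | inj₂ q | _ = q
      ... | inj₁ q | s = trans q ([ (λ q′ → contradiction (sym (∙-cancelˡ h _ _ (trans (sym hg⁻¹) q′))) g≉g⁻¹) ,
                                   (λ q′ → via ε g (trans (sym hg⁻¹) (trans q′ (⁻¹-cong hg≈gh)))
                                     (solve 2 (λ g h → h ⊜ e ⊕ (h ⊕ ⊝ g) ⊕ g) refl g h)
                                     (solve 2 (λ g h → e ⊕ ⊝ (g ⊕ h) ⊕ g ⊜ ⊝ h) refl g h)) ]′ s)
        where
        hg⁻¹ : δ x (h ∙ g) ≈ h ∙ g ⁻¹
        hg⁻¹ = trans (δ-∙ x h g) (∙-cong q (proj₁ (cent-inverts-g w hg≈gh p p²)))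

      fixed-letters : (∀ i → Fixed (X i)) → ∀ h → Fixed h
      fixed-letters fix h = generated-induction fixed-subgroup
        (λ { (i , y≈Xi) → fixed-resp (sym y≈Xi) (fix i) }) (X-generates h)

      -- A normalising letter `X j` is the quotient of `X i ∙ X j` by `X i`, and neither of these is
      -- normalising.
      some-not-norm : ∀ {i} → ¬ Norm (X i) → ∀ j → Fixed (X j)
      some-not-norm {i} ¬norm j with em {P = Norm (X j)}
      ... | no ¬norm-j = proj₁ (fixed (word-mono (s≤s z≤n) (letter-word j)) ¬norm-j)
      ... | yes norm-j = fixed-resp (\\-leftDividesʳ (X i) (X j))
          (fixed-∙ (fixed-⁻¹ (proj₁ (fixed (word-mono (s≤s z≤n) (letter-word i)) ¬norm)))
                   (proj₁ (fixed (word-mono (s≤s (s≤s z≤n)) (word-∙ (letter-word i) (letter-word j)))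
                                 (¬norm ∘ quotient))))
        where
        X≈ : X i ∙ X j ∙ X j ⁻¹ ≈ X i
        X≈ = //-rightDividesʳ (X j) (X i)
        quotient : Norm (X i ∙ X j) → Norm (X i)
        quotient n = norm-resp X≈ (norm-∙ n (norm-⁻¹ norm-j))

      all-cent : (∀ i → Cent (X i)) → ∀ i → Fixed (X i)
      all-cent cent i = fixed-cent fixed-g (word-mono (s≤s z≤n) (letter-word i)) (cent i)
        where
        fixed-g : Fixed g
        fixed-g x with δ-g x
        ... | inj₁ (p , _) = p
        ... | inj₂ (p , p²) = contradiction abelian ¬abelian
          where
          -- `δ x` inverts the two-letter word as a whole, and also letter by letter, because the
          -- sign at `g` is the same at `x` and at `x ∙ X i`.
          letters-commute : ∀ i j → X i ∙ X j ≈ X j ∙ X i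
          letters-commute i j = ⁻¹-injective (begin
            (X i ∙ X j) ⁻¹                    ≈⟨ cent-inverted
              (word-mono (s≤s (s≤s z≤n)) (word-∙ (letter-word i) (letter-word j)))
              (SubgroupPredicate.∙∈ (centralizer g) (cent i) (cent j)) p p² ⟨
            δ x (X i ∙ X j)                   ≈⟨ δ-∙ x (X i) (X j) ⟩
            δ x (X i) ∙ δ (x ∙ X i) (X j)     ≈⟨ ∙-cong (inverted i p p²) (inverted j (proj₁ q) (proj₂ q)) ⟩
            X i ⁻¹ ∙ X j ⁻¹                   ≈⟨ ⁻¹-anti-homo-∙ (X j) (X i) ⟨
            (X j ∙ X i) ⁻¹                    ∎)
            where
            inverted : ∀ {x} i → δ x g ≈ g ⁻¹ → δ x (g ∙ g) ≈ (g ∙ g) ⁻¹ → δ x (X i) ≈ X i ⁻¹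
            inverted i = cent-inverted (word-mono (s≤s z≤n) (letter-word i)) (cent i)
            q = cent-inverts-g (word-mono (s≤s z≤n) (letter-word i)) (cent i) p p²
          abelian : Abelian G
          abelian x y = generated-commute
            (λ { (i , x≈Xi) (j , y≈Xj) →
                 trans (∙-cong x≈Xi y≈Xj) (trans (letters-commute i j) (∙-cong (sym y≈Xj) (sym x≈Xi))) })
            (X-generates x) (X-generates y)

      module Flipping (all-norm : ∀ i → Norm (X i)) (i₀ : Fin r) (flip₀ : Flip (X i₀)) where
        t : Carrier
        t = X i₀

        fixed-g : Fixed g
        fixed-g = flip-fixes-g (word-mono (s≤s z≤n) (letter-word i₀)) flip₀

        centralise : ∀ i → ∃ λ s → Word 2 s × Cent s × (s ≈ X i ⊎ s ≈ t ∙ X i)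
        centralise i with all-norm i
        ... | inj₁ cent = X i , word-mono (s≤s z≤n) (letter-word i) , cent , inj₁ refl
        ... | inj₂ flip = t ∙ X i , word-∙ (letter-word i₀) (letter-word i) , flip-flip flip₀ flip , inj₂ refl

        -- Elements centralising `g` that generate the index-two subgroup of the dicyclic case.
        -- Including `t ∙ t` places each inverting letter in `t A`, by `t⁻¹ X i = t⁻² (t X i)`.
        s : Fin (suc r) → Carrier
        s zero    = t ∙ t
        s (suc i) = proj₁ (centralise i)

        s-word : ∀ i → Word 2 (s i)
        s-word zero    = word-∙ (letter-word i₀) (letter-word i₀)
        s-word (suc i) = proj₁ (proj₂ (centralise i))

        s-cent : ∀ i → Cent (s i)
        s-cent zero    = flip-flip flip₀ flip₀
        s-cent (suc i) = proj₁ (proj₂ (proj₂ (centralise i)))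

        s-fixed : ∀ i → Fixed (s i)
        s-fixed i = fixed-cent fixed-g (word-mono (s≤s (s≤s z≤n)) (s-word i)) (s-cent i)

        t-fixed⇒ : Fixed t → ∀ i → Fixed (X i)
        t-fixed⇒ fix i with proj₂ (proj₂ (proj₂ (centralise i)))
        ... | inj₁ p = fixed-resp p (s-fixed (suc i))
        ... | inj₂ p = fixed-resp (\\-leftDividesʳ t (X i))
                         (fixed-∙ (fixed-⁻¹ fix) (fixed-resp p (s-fixed (suc i))))

        module Dicyclic (x : Carrier) (δt : ¬ (δ x t ≈ t)) where
          δt≈t⁻¹ : δ x t ≈ t ⁻¹
          δt≈t⁻¹ with proj₁ (signed (word-mono (s≤s z≤n) (letter-word i₀)) (inj₂ flip₀)) x
          ... | inj₁ p = contradiction p δt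
          ... | inj₂ p = p

          t⁻¹≉t : ¬ (t ⁻¹ ≈ t)
          t⁻¹≉t p = δt (trans δt≈t⁻¹ p)

          δ-ts : ∀ {s} → Fixed s → δ x (t ∙ s) ≈ t ⁻¹ ∙ s
          δ-ts {s} fix = trans (δ-∙ x t s) (∙-cong δt≈t⁻¹ (fix (x ∙ t)))

          -- `δ x (t s) = t⁻¹ s` must be `t s` or `(t s)⁻¹`. The former would give `t⁻¹ = t`, the
          -- latter is the claim.
          inverts : ∀ {s} → Word 4 s → Cent s → Fixed s → t ∙ s ∙ t ⁻¹ ≈ s ⁻¹
          inverts {s} w cent fix with proj₁ (signed (word-∙ (letter-word i₀) w) (inj₂ flip)) x
            where
            flip : Flip (t ∙ s)
            flip = trans (assoc _ _ _) (trans (∙-congˡ cent) (trans (sym (assoc _ _ _))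
                     (trans (∙-congʳ flip₀) (assoc _ _ _))))
          ... | inj₁ p = contradiction (∙-cancelʳ s _ _ (trans (sym (δ-ts fix)) p)) t⁻¹≉t
          ... | inj₂ p = via ε (t ⁻¹) (sym (⁻¹-cong (trans (sym (δ-ts fix)) p)))
                  (solve 2 (λ t s → t ⊕ s ⊕ ⊝ t ⊜ e ⊕ ⊝ (⊝ (t ⊕ s)) ⊕ ⊝ t) refl t s)
                  (solve 2 (λ t s → e ⊕ ⊝ (⊝ t ⊕ s) ⊕ ⊝ t ⊜ ⊝ s) refl t s)

          s-inverted : ∀ i → t ∙ s i ∙ t ⁻¹ ≈ s i ⁻¹
          s-inverted i = inverts (word-mono (s≤s (s≤s z≤n)) (s-word i)) (s-cent i) (s-fixed i)

          -- Conjugation by `t` is a homomorphism and inverts `s i`, `s j` and also their product.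
          s-commute : ∀ i j → s i ∙ s j ≈ s j ∙ s i
          s-commute i j = ⁻¹-injective (begin
            (s i ∙ s j) ⁻¹           ≈⟨ inverts (word-∙ (s-word i) (s-word j))
                                          (SubgroupPredicate.∙∈ (centralizer g) (s-cent i) (s-cent j))
                                          (fixed-∙ (s-fixed i) (s-fixed j)) ⟨
            t ∙ (s i ∙ s j) ∙ t ⁻¹   ≈⟨ solve 3 (λ t a b → t ⊕ (a ⊕ b) ⊕ ⊝ t ⊜ t ⊕ a ⊕ ⊝ t ⊕ (t ⊕ b ⊕ ⊝ t))
                                          refl t (s i) (s j) ⟩
            t ∙ s i ∙ t ⁻¹ ∙ (t ∙ s j ∙ t ⁻¹)   ≈⟨ ∙-cong (s-inverted i) (s-inverted j) ⟩
            s i ⁻¹ ∙ s j ⁻¹          ≈⟨ ⁻¹-anti-homo-∙ (s j) (s i) ⟨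
            (s j ∙ s i) ⁻¹           ∎)

          A : Subset setoid (c ⊔ ℓ)
          A = record { Member = Generated G (image s) ; resp = resp }

          A-abelian : ∀ {a b} → a ∈ A → b ∈ A → a ∙ b ≈ b ∙ a
          A-abelian = generated-commute λ { (i , x≈si) (j , y≈sj) →
            trans (∙-cong x≈si y≈sj) (trans (s-commute i j) (∙-cong (sym y≈sj) (sym x≈si))) }

          A-inverted : ∀ {a} → a ∈ A → t ∙ a ∙ t ⁻¹ ≈ a ⁻¹
          A-inverted = proj₂ ∘ generated-induction {P = λ a → a ∈ A × t ∙ a ∙ t ⁻¹ ≈ a ⁻¹} (record
            { ε∈ = unit , solve 1 (λ t → t ⊕ e ⊕ ⊝ t ⊜ ⊝ e) refl t
            ; ∙∈ = λ { {a} {b} (a∈ , p) (b∈ , q) → mul a∈ b∈ , (begin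
                t ∙ (a ∙ b) ∙ t ⁻¹              ≈⟨ solve 3 (λ t a b →
                  t ⊕ (a ⊕ b) ⊕ ⊝ t ⊜ t ⊕ a ⊕ ⊝ t ⊕ (t ⊕ b ⊕ ⊝ t)) refl t a b ⟩
                t ∙ a ∙ t ⁻¹ ∙ (t ∙ b ∙ t ⁻¹)   ≈⟨ ∙-cong p q ⟩
                a ⁻¹ ∙ b ⁻¹                     ≈⟨ ⁻¹-anti-homo-∙ b a ⟨
                (b ∙ a) ⁻¹                      ≈⟨ ⁻¹-cong (A-abelian b∈ a∈) ⟩
                (a ∙ b) ⁻¹                      ∎) }
            ; ⁻¹∈ = λ { {a} (a∈ , p) → inv a∈ ,
                trans (solve 2 (λ t a → t ⊕ ⊝ a ⊕ ⊝ t ⊜ ⊝ (t ⊕ a ⊕ ⊝ t)) refl t a) (⁻¹-cong p) }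
            ; resp∈ = λ { a≈b (a∈ , p) → resp a≈b a∈ ,
                trans (∙-congʳ (∙-congˡ (sym a≈b))) (trans p (⁻¹-cong a≈b)) }
            }) (λ { (i , x≈si) → gen (i , x≈si) ,
                trans (∙-congʳ (∙-congˡ x≈si)) (trans (s-inverted i) (⁻¹-cong (sym x≈si))) })

          A-inverted′ : ∀ {a} → a ∈ A → t ⁻¹ ∙ a ∙ t ≈ a ⁻¹
          A-inverted′ {a} a∈ = via (t ⁻¹) t (sym (A-inverted (inv a∈)))
            (∙-congʳ (∙-congˡ (sym (⁻¹-involutive a))))
            (solve 2 (λ t a → ⊝ t ⊕ (t ⊕ ⊝ a ⊕ ⊝ t) ⊕ t ⊜ ⊝ a) refl t a)

          -- The generators of `A` centralise `g`, whereas `t` inverts it.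
          t∉A : ¬ (t ∈ A)
          t∉A t∈A = g≉g⁻¹ (∙-cancelʳ t _ _ (trans (sym (generated-induction (centralizer g)
            (λ { (i , x≈si) → SubgroupPredicate.resp∈ (centralizer g) (sym x≈si) (s-cent i) }) t∈A)) flip₀))

          t²∈A : t ∙ t ∈ A
          t²∈A = gen (zero , refl)

          InCosets : Carrier → Set (c ⊔ ℓ)
          InCosets x = x ∈ A ⊎ t ⁻¹ ∙ x ∈ A

          in-cosets : ∀ x → InCosets x
          in-cosets x = generated-induction {P = InCosets} (record
            { ε∈ = inj₁ unit
            ; ∙∈ = λ
              { (inj₁ p) (inj₁ q) → inj₁ (mul p q)
              ; {a} {b} (inj₁ p) (inj₂ q) → inj₂ (resp
                  (solve 3 (λ t a b → ⊝ t ⊕ a ⊕ t ⊕ (⊝ t ⊕ b) ⊜ ⊝ t ⊕ (a ⊕ b)) refl t a b)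
                  (mul (resp (sym (A-inverted′ p)) (inv p)) q))
              ; (inj₂ p) (inj₁ q) → inj₂ (resp (assoc _ _ _) (mul p q))
              -- With `a = t u` and `b = t v` the product is `(t u t⁻¹) t² v`, and all three factors
              -- lie in `A`.
              ; {a} {b} (inj₂ p) (inj₂ q) → inj₁ (resp
                  (solve 3 (λ t a b → t ⊕ (⊝ t ⊕ a) ⊕ ⊝ t ⊕ (t ⊕ t) ⊕ (⊝ t ⊕ b) ⊜ a ⊕ b) refl t a b)
                  (mul (mul (resp (sym (A-inverted p)) (inv p)) t²∈A) q)) }
            ; ⁻¹∈ = λ
              { (inj₁ p) → inj₁ (inv p)
              ; {a} (inj₂ p) → inj₂ (resp
                  (solve 2 (λ t a → ⊝ t ⊕ ⊝ (⊝ t ⊕ a) ⊕ t ⊕ ⊝ (t ⊕ t) ⊜ ⊝ t ⊕ ⊝ a) refl t a)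
                  (mul (resp (sym (A-inverted′ (inv p))) (inv (inv p))) (inv t²∈A))) }
            ; resp∈ = λ { a≈b (inj₁ p) → inj₁ (resp a≈b p) ; a≈b (inj₂ p) → inj₂ (resp (∙-congˡ a≈b) p) }
            }) letter-in (X-generates x)
            where
            letter-in : ∀ {y} → y ∈ image X → InCosets y
            letter-in {y} (i , y≈Xi) with proj₂ (proj₂ (proj₂ (centralise i)))
            ... | inj₁ p = inj₁ (resp (trans p (sym y≈Xi)) (gen (suc i , refl)))
            ... | inj₂ p = inj₂ (resp
                (trans (solve 2 (λ t y → ⊝ (t ⊕ t) ⊕ (t ⊕ y) ⊜ ⊝ t ⊕ y) refl t (X i)) (∙-congˡ (sym y≈Xi)))
                (mul (inv t²∈A) (resp p (gen (suc i , refl)))))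

          A-normal : IsNormal G A
          A-normal h {a} a∈ with in-cosets h
          ... | inj₁ h∈ = mul (mul h∈ a∈) (inv h∈)
          ... | inj₂ u∈ = resp
                  (solve 3 (λ t h a → t ⊕ (⊝ t ⊕ h ⊕ a ⊕ ⊝ (⊝ t ⊕ h)) ⊕ ⊝ t ⊜ h ⊕ a ⊕ ⊝ h) refl t h a)
                  (resp (sym (A-inverted uau∈)) (inv uau∈))
            where
            uau∈ = mul (mul u∈ a∈) (inv u∈)

          A-subgroup : IsSubgroup G A
          A-subgroup = record { ε-closed = unit ; ∙-closed = mul ; ⁻¹-closed = inv }

          A-index : HasIndex G A A-subgroup 2
          A-index = record
            { to = to
            ; cong = λ { ≡.refl → resp (sym (inverseˡ _)) unit }
            ; bijective = injective , surjective
            }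
            where
            to : Fin 2 → Carrier
            to zero       = ε
            to (suc zero) = t
            injective : ∀ {i j} → to i ⁻¹ ∙ to j ∈ A → i ≡ j
            injective {zero}     {zero}     p = ≡.refl
            injective {suc zero} {suc zero} p = ≡.refl
            injective {zero}     {suc zero} p =
              contradiction (resp (solve 1 (λ t → ⊝ e ⊕ t ⊜ t) refl t) p) t∉A
            injective {suc zero} {zero}     p =
              contradiction (resp (solve 1 (λ t → ⊝ (⊝ t ⊕ e) ⊜ t) refl t) (inv p)) t∉A
            surjective : ∀ y → ∃ λ i → ∀ {j} → j ≡ i → to j ⁻¹ ∙ y ∈ A
            surjective y with in-cosets y
            ... | inj₁ p = zero , λ { ≡.refl → resp (solve 1 (λ y → y ⊜ ⊝ e ⊕ y) refl y) p }
            ... | inj₂ p = suc zero , λ { ≡.refl → p }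

          -- As an element of `A`, `t²` is inverted by `t`, yet `t` commutes with it; so `t⁴ = 1`,
          -- while `t² ≠ 1` because `t⁻¹ ≠ t`.
          t-order : HasOrder G t 4
          t-order = s≤s z≤n , t⁴≈ε , minimal
            where
            t²≉ε : ¬ (t ∙ t ≈ ε)
            t²≉ε p = t⁻¹≉t (sym (inverseˡ-unique t t p))
            t⁴≈ε : _^ᴳ_ G t 4 ≈ ε
            t⁴≈ε = via ε (t ∙ t) (A-inverted t²∈A)
              (solve 1 (λ t → t ⊕ (t ⊕ (t ⊕ (t ⊕ e))) ⊜ e ⊕ (t ⊕ (t ⊕ t) ⊕ ⊝ t) ⊕ (t ⊕ t)) refl t)
              (solve 1 (λ t → e ⊕ ⊝ (t ⊕ t) ⊕ (t ⊕ t) ⊜ e) refl t)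
            minimal : ∀ m → 0 ℕ.< m → _^ᴳ_ G t m ≈ ε → 4 ℕ.≤ m
            t≉ε : ¬ (t ≈ ε)
            t≉ε p = t²≉ε (trans (∙-cong p p) (identityˡ ε))
            minimal 1 _ p = contradiction (trans (sym (identityʳ t)) p) t≉ε
            minimal 2 _ p = contradiction (trans (∙-congˡ (sym (identityʳ t))) p) t²≉ε
            minimal 3 _ p = contradiction (trans (sym (trans (∙-congˡ p) (identityʳ t))) t⁴≈ε) t≉ε
            minimal (suc (suc (suc (suc m)))) _ _ = s≤s (s≤s (s≤s (s≤s z≤n)))

          dicyclic : IsGeneralizedDicyclic G
          dicyclic = record
            { nonAbelian  = ¬abelian
            ; A           = A
            ; A-subgroup  = A-subgroup
            ; A-abelian   = A-abelian
            ; A-normal    = A-normal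
            ; A-index     = A-index
            ; x           = t
            ; x∉A         = t∉A
            ; x-order     = t-order
            ; x-inverts-A = A-inverted
            }

      all-normalising : (∀ i → Norm (X i)) → ∀ i → Fixed (X i)
      all-normalising norm with em {P = ∃ λ i → Flip (X i)}
      ... | no ¬flip = all-cent (λ i → [ (λ p → p) , (λ p → contradiction (i , p) ¬flip) ]′ (norm i))
      ... | yes (i₀ , flip₀) = t-fixed⇒ t-fixed
        where
        open Flipping norm i₀ flip₀
        t-fixed : Fixed t
        t-fixed x with em {P = δ x t ≈ t}
        ... | yes p = p
        ... | no ¬p = contradiction (Dicyclic.dicyclic x ¬p) ¬dicyclic

      all-fixed : ∀ h → Fixed h
      all-fixed = fixed-letters (go em)
        where
        go : Dec (∃ λ i → ¬ Norm (X i)) → ∀ i → Fixed (X i)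
        go (yes (_ , ¬norm)) = some-not-norm ¬norm
        go (no ¬∃) = all-normalising λ i → case em {P = Norm (X i)} of λ
          { (yes p) → p ; (no ¬p) → contradiction (i , ¬p) ¬∃ }

-- Small exponents and clean representatives

∣+∣-mono : ∀ i j {a b} → ∣ i ∣ ℕ.≤ a → ∣ j ∣ ℕ.≤ b → ∣ i ℤ.+ j ∣ ℕ.≤ a ℕ.+ b
∣+∣-mono i j i≤a j≤b = ℕ.≤-trans (ℤ.∣i+j∣≤∣i∣+∣j∣ i j) (ℕ.+-mono-≤ i≤a j≤b)

∣-∣-mono : ∀ i j {a b} → ∣ i ∣ ℕ.≤ a → ∣ j ∣ ℕ.≤ b → ∣ i ℤ.- j ∣ ℕ.≤ a ℕ.+ b
∣-∣-mono i j i≤a j≤b = ℕ.≤-trans (ℤ.∣i-j∣≤∣i∣+∣j∣ i j) (ℕ.+-mono-≤ i≤a j≤b)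

*-distribʳ-minus : ∀ a b d → (a ℤ.- b) ℤ.* d ≡ a ℤ.* d ℤ.- b ℤ.* d
*-distribʳ-minus = ℤ-Ring.solve-∀

private
  4W≡ : ∀ W → W ℕ.+ W ℕ.+ W ℕ.+ W ≡ 4 ℕ.* W
  4W≡ = ℕ-Ring.solve-∀

  10Wd≡ : ∀ W d → 10 ℕ.* W ℕ.* d ≡ 2 ℕ.* (5 ℕ.* W ℕ.* d)
  10Wd≡ = ℕ-Ring.solve-∀

  expand : ∀ W → (2 ℕ.* (5 ℕ.* W ℕ.* (W ℕ.+ W)) ℕ.+ (W ℕ.+ W ℕ.+ W ℕ.+ W)) ℕ.* (W ℕ.+ W)
                 ≡ 40 ℕ.* (W ℕ.* W ℕ.* W) ℕ.+ 8 ℕ.* (W ℕ.* W ℕ.* 1)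
  expand = ℕ-Ring.solve-∀

module Cyclic {c ℓ} (G : Group c ℓ) (g : Group.Carrier G) (N : ℕ) (g-order : NoSmallPower G g N) where
  open Group G
  open Power G
  open GroupProperties G
  open GroupSolver G using (solve; _⊜_; _⊕_; ⊝_; e)
  open Conversion G

  γ : ℤ → Carrier
  γ = pow g

  γ≈ε⇒≡0 : ∀ i → ∣ i ∣ ℕ.< N → γ i ≈ ε → i ≡ + 0
  γ≈ε⇒≡0 (+ zero)  _   _ = ≡.refl
  γ≈ε⇒≡0 (+ suc n) i<N p = contradiction p (g-order (suc n) (s≤s z≤n) i<N)
  γ≈ε⇒≡0 -[1+ n ]  i<N p = contradiction
    (trans (sym (⁻¹-involutive _)) (trans (⁻¹-cong p) ε⁻¹≈ε)) (g-order (suc n) (s≤s z≤n) i<N)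

  γ-injective : ∀ i j → ∣ i ℤ.- j ∣ ℕ.< N → γ i ≈ γ j → i ≡ j
  γ-injective i j i-j<N p = ℤ.i-j≡0⇒i≡j i j
    (γ≈ε⇒≡0 (i ℤ.- j) i-j<N (trans (pow-- g i j) (x≈y⇒x∙y⁻¹≈ε p)))

  γ-injective-bounded : ∀ i j {a b} → ∣ i ∣ ℕ.≤ a → ∣ j ∣ ℕ.≤ b → a ℕ.+ b ℕ.< N → γ i ≈ γ j → i ≡ j
  γ-injective-bounded i j i≤a j≤b a+b<N =
    γ-injective i j (ℕ.≤-<-trans (∣-∣-mono i j i≤a j≤b) a+b<N)

  module Cleaning (em : ∀ {a} → ExcludedMiddle a)
    (W : ℕ) (1≤W : 1 ℕ.≤ W) (48W³<N : 48 ℕ.* (W ℕ.* W ℕ.* W) ℕ.< N) where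

    -- If t is clean, the inverse of t gᵏ can only be a nearby element of t C if it is t gᵏ itself.
    Clean : Carrier → Set ℓ
    Clean t = ∀ k w → ∣ k ∣ ℕ.≤ W → ∣ w ∣ ℕ.≤ W → t ∙ γ k ∙ (t ∙ γ w) ≈ ε → k ≡ w

    private
      -- Divide `t γᵃ t = γ⁻ᵇ` by `t γᶜ t = γ⁻ᵈ`.
      quotient : ∀ t a b c d → t ∙ γ a ∙ (t ∙ γ b) ≈ ε → t ∙ γ c ∙ (t ∙ γ d) ≈ ε →
                 t ∙ γ (a ℤ.- c) ∙ t ⁻¹ ≈ γ (d ℤ.- b)
      quotient t a b c d p q = begin
        t ∙ γ (a ℤ.- c) ∙ t ⁻¹                       ≈⟨ ∙-congʳ (∙-congˡ (pow-- g a c)) ⟩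
        t ∙ (γ a ∙ γ c ⁻¹) ∙ t ⁻¹                    ≈⟨ solve 5 (λ t a b c d →
          t ⊕ (a ⊕ ⊝ c) ⊕ ⊝ t ⊜ t ⊕ a ⊕ (t ⊕ b) ⊕ ⊝ b ⊕ d ⊕ ⊝ (t ⊕ c ⊕ (t ⊕ d)))
          refl t (γ a) (γ b) (γ c) (γ d) ⟩
        t ∙ γ a ∙ (t ∙ γ b) ∙ γ b ⁻¹ ∙ γ d ∙ (t ∙ γ c ∙ (t ∙ γ d)) ⁻¹
                                                     ≈⟨ ∙-cong (∙-congʳ (∙-congʳ p)) (⁻¹-cong q) ⟩
        ε ∙ γ b ⁻¹ ∙ γ d ∙ ε ⁻¹                      ≈⟨ solve 2 (λ b d →
          e ⊕ ⊝ b ⊕ d ⊕ ⊝ e ⊜ ⊝ b ⊕ d) refl (γ b) (γ d) ⟩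
        γ b ⁻¹ ∙ γ d                                 ≈⟨ ∙-congʳ (pow-neg g b) ⟨
        γ (ℤ.- b) ∙ γ d                              ≈⟨ pow-+ g (ℤ.- b) d ⟨
        γ (ℤ.- b ℤ.+ d)                              ≡⟨ ≡.cong γ (ℤ.+-comm (ℤ.- b) d) ⟩
        γ (d ℤ.- b)                                  ∎
        where open SetoidReasoning setoid

      rotate : ∀ t a b → t ∙ γ a ∙ (t ∙ γ b) ≈ ε → t ∙ γ b ∙ (t ∙ γ a) ≈ ε
      rotate t a b p = via (t ∙ γ b) ((t ∙ γ b) ⁻¹) p
        (solve 3 (λ t a b → t ⊕ b ⊕ (t ⊕ a) ⊜ t ⊕ b ⊕ (t ⊕ a ⊕ (t ⊕ b)) ⊕ ⊝ (t ⊕ b)) refl t (γ a) (γ b))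
        (solve 1 (λ u → u ⊕ e ⊕ ⊝ u ⊜ e) refl (t ∙ γ b))

    -- If k ≠ w violate cleanness of t, then t commutes with gᵈ for d = w − k, and a
    -- violation for t gˣ, where x = 5W d, would force gᵐ = 1 for a small m ≠ 0.
    clean-shift : ∀ t → ∃ λ x → Clean (t ∙ γ x)
    clean-shift t with em {P = ∃₂ λ k w → (∣ k ∣ ℕ.≤ W × ∣ w ∣ ℕ.≤ W) × t ∙ γ k ∙ (t ∙ γ w) ≈ ε × ¬ k ≡ w}
    ... | no ¬viol = + 0 , λ k w k≤W w≤W p → case k ℤ.≟ w of λ
          { (yes k≡w) → k≡w
          ; (no  k≢w) → contradiction (k , w , (k≤W , w≤W)
              , trans (solve 3 (λ t a b → t ⊕ a ⊕ (t ⊕ b) ⊜ t ⊕ e ⊕ a ⊕ (t ⊕ e ⊕ b)) refl t (γ k) (γ w)) p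
              , k≢w) ¬viol }
    ... | yes (k , w , (k≤W , w≤W) , p , k≢w) = x , λ k′ w′ k′≤W w′≤W p′ → ⊥-elim (absurd k′ w′ k′≤W w′≤W p′)
      where
      d x : ℤ
      d = w ℤ.- k
      x = + (5 ℕ.* W) ℤ.* d
      d≢0 : ¬ d ≡ + 0
      d≢0 d≡0 = k≢w (≡.sym (ℤ.i-j≡0⇒i≡j w k d≡0))
      d≤ : ∣ d ∣ ℕ.≤ W ℕ.+ W
      d≤ = ∣-∣-mono w k w≤W k≤W
      -- A violation remains one when `k` and `w` are exchanged; the quotient of the two is this
      -- commutation.
      comm-d : t ∙ γ d ∙ t ⁻¹ ≈ γ d
      comm-d = quotient t w k k w (rotate t k w p) p
      absurd : ∀ k′ w′ → ∣ k′ ∣ ℕ.≤ W → ∣ w′ ∣ ℕ.≤ W → t ∙ γ x ∙ γ k′ ∙ (t ∙ γ x ∙ γ w′) ≈ ε → ⊥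
      -- Comparing the violations at `t` and at `t gˣ` leads to `2x = -z` with `|z| ≤ 4W`, but
      -- `|2x| = 10W |d| ≥ 10W`.
      absurd k′ w′ k′≤W w′≤W p′ = ℕ.<-irrefl ≡.refl (begin-strict
        ∣ z ∣                        ≤⟨ z≤ ⟩
        W ℕ.+ W ℕ.+ W ℕ.+ W          ≡⟨ 4W≡ W ⟩
        4 ℕ.* W                      <⟨ ℕ.*-monoˡ-< W ⦃ ℕ.>-nonZero 1≤W ⦄ {4} {10} (s≤s (s≤s (s≤s (s≤s (s≤s z≤n))))) ⟩
        10 ℕ.* W                     ≡⟨ ℕ.*-identityʳ (10 ℕ.* W) ⟨
        10 ℕ.* W ℕ.* 1               ≤⟨ ℕ.*-monoʳ-≤ (10 ℕ.* W) (ℕ.n≢0⇒n>0 (d≢0 ∘ ℤ.∣i∣≡0⇒i≡0)) ⟩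
        10 ℕ.* W ℕ.* ∣ d ∣           ≡⟨ 10Wd≡ W ∣ d ∣ ⟩
        2 ℕ.* (5 ℕ.* W ℕ.* ∣ d ∣)    ≡⟨ ≡.cong (2 ℕ.*_) (ℤ.abs-* (+ (5 ℕ.* W)) d) ⟨
        2 ℕ.* ∣ x ∣                  ≡⟨ ℤ.abs-* (+ 2) x ⟨
        ∣ + 2 ℤ.* x ∣                ≡⟨ ≡.cong ∣_∣ 2x≡ ⟩
        ∣ ℤ.- z ∣                    ≡⟨ ℤ.∣-i∣≡∣i∣ z ⟩
        ∣ z ∣                        ∎)
        where
        open ℕ.≤-Reasoning
        z a b : ℤ
        z = k′ ℤ.- k ℤ.- w ℤ.+ w′
        a = x ℤ.+ k′ ℤ.- k
        b = w ℤ.- (x ℤ.+ w′)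
        z≤ : ∣ z ∣ ℕ.≤ W ℕ.+ W ℕ.+ W ℕ.+ W
        z≤ = ∣+∣-mono (k′ ℤ.- k ℤ.- w) w′ (∣-∣-mono (k′ ℤ.- k) w (∣-∣-mono k′ k k′≤W k≤W) w≤W) w′≤W
        conj-a : t ∙ γ a ∙ t ⁻¹ ≈ γ b
        conj-a = quotient t (x ℤ.+ k′) (x ℤ.+ w′) k w
          (trans (∙-cong (∙-congˡ (pow-+ g x k′)) (∙-congˡ (pow-+ g x w′)))
            (trans (solve 4 (λ t x a b → t ⊕ (x ⊕ a) ⊕ (t ⊕ (x ⊕ b)) ⊜ t ⊕ x ⊕ a ⊕ (t ⊕ x ⊕ b))
              refl t (γ x) (γ k′) (γ w′)) p′)) p
        -- Conjugation by `t` fixes the powers of `γ d`, and it sends `γ a` to `γ b`; apply both to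
        -- the exponent `a d`.
        ad≈bd : γ (a ℤ.* d) ≈ γ (b ℤ.* d)
        ad≈bd = trans (reflexive (≡.cong γ (ℤ.*-comm a d)))
          (trans (sym (conj-pow t g d d a comm-d)) (trans (reflexive (≡.cong (λ i → t ∙ γ i ∙ t ⁻¹) (ℤ.*-comm d a)))
            (conj-pow t g a b d conj-a)))
        a-b : a ℤ.- b ≡ + 2 ℤ.* x ℤ.+ z
        a-b = lemma x k k′ w w′
          where
          lemma : ∀ x k k′ w w′ → x ℤ.+ k′ ℤ.- k ℤ.- (w ℤ.- (x ℤ.+ w′)) ≡ + 2 ℤ.* x ℤ.+ (k′ ℤ.- k ℤ.- w ℤ.+ w′)
          lemma = ℤ-Ring.solve-∀
        -- Origin of `48W³`: `|a - b| ≤ 20W² + 4W` and `|d| ≤ 2W`, so the product is at most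
        -- `40W³ + 8W²`.
        bound : ∣ a ℤ.* d ℤ.- b ℤ.* d ∣ ℕ.< N
        bound = begin-strict
          ∣ a ℤ.* d ℤ.- b ℤ.* d ∣              ≡⟨ ≡.cong ∣_∣ (*-distribʳ-minus a b d) ⟨
          ∣ (a ℤ.- b) ℤ.* d ∣                  ≡⟨ ≡.cong (λ i → ∣ i ℤ.* d ∣) a-b ⟩
          ∣ (+ 2 ℤ.* x ℤ.+ z) ℤ.* d ∣          ≡⟨ ℤ.abs-* (+ 2 ℤ.* x ℤ.+ z) d ⟩
          ∣ + 2 ℤ.* x ℤ.+ z ∣ ℕ.* ∣ d ∣        ≤⟨ ℕ.*-mono-≤ (∣+∣-mono (+ 2 ℤ.* x) z 2x≤ z≤) d≤ ⟩
          (2 ℕ.* (5 ℕ.* W ℕ.* (W ℕ.+ W)) ℕ.+ (W ℕ.+ W ℕ.+ W ℕ.+ W)) ℕ.* (W ℕ.+ W)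
                                               ≡⟨ expand W ⟩
          40 ℕ.* (W ℕ.* W ℕ.* W) ℕ.+ 8 ℕ.* (W ℕ.* W ℕ.* 1)
            ≤⟨ ℕ.+-monoʳ-≤ (40 ℕ.* (W ℕ.* W ℕ.* W)) (ℕ.*-monoʳ-≤ 8 (ℕ.*-monoʳ-≤ (W ℕ.* W) 1≤W)) ⟩
          40 ℕ.* (W ℕ.* W ℕ.* W) ℕ.+ 8 ℕ.* (W ℕ.* W ℕ.* W)
                                               ≡⟨ ℕ.*-distribʳ-+ (W ℕ.* W ℕ.* W) 40 8 ⟨
          48 ℕ.* (W ℕ.* W ℕ.* W)               <⟨ 48W³<N ⟩
          N                                    ∎
          where
          2x≤ : ∣ + 2 ℤ.* x ∣ ℕ.≤ 2 ℕ.* (5 ℕ.* W ℕ.* (W ℕ.+ W))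
          2x≤ = begin
            ∣ + 2 ℤ.* x ∣                 ≡⟨ ℤ.abs-* (+ 2) x ⟩
            2 ℕ.* ∣ x ∣                   ≡⟨ ≡.cong (2 ℕ.*_) (ℤ.abs-* (+ (5 ℕ.* W)) d) ⟩
            2 ℕ.* (5 ℕ.* W ℕ.* ∣ d ∣)     ≤⟨ ℕ.*-monoʳ-≤ 2 (ℕ.*-monoʳ-≤ (5 ℕ.* W) d≤) ⟩
            2 ℕ.* (5 ℕ.* W ℕ.* (W ℕ.+ W)) ∎
        a≡b : a ≡ b
        a≡b = ℤ.*-cancelʳ-≡ a b d ⦃ ℤ.≢-nonZero d≢0 ⦄ (γ-injective (a ℤ.* d) (b ℤ.* d) bound ad≈bd)
        2x≡ : + 2 ℤ.* x ≡ ℤ.- z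
        2x≡ = ℤ.i-j≡0⇒i≡j (+ 2 ℤ.* x) (ℤ.- z) (≡.trans (≡.cong (λ i → + 2 ℤ.* x ℤ.+ i) (ℤ.neg-involutive z))
          (≡.trans (≡.sym a-b) (ℤ.i≡j⇒i-j≡0 a≡b)))

-- Double cosets, frames and marks

private
  x-[x+i]≡-i : ∀ x i → x ℤ.- (x ℤ.+ i) ≡ ℤ.- i
  x-[x+i]≡-i = ℤ-Ring.solve-∀

  -1*j*-1≡j : ∀ j → ℤ.- + 1 ℤ.* (j ℤ.* ℤ.- + 1) ≡ j
  -1*j*-1≡j = ℤ-Ring.solve-∀

  4+2x≡ : ∀ x → 4 ℕ.+ 2 ℕ.* x ≡ 2 ℕ.+ 2 ℕ.* suc x
  4+2x≡ = ℕ-Ring.solve-∀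

-- With W = 8n bounding the exponents under consideration, 48W³ bounds those in clean-shift.
Large : ℕ → ℕ → Set
Large n N = 48 ℕ.* (8 ℕ.* n ℕ.* (8 ℕ.* n) ℕ.* (8 ℕ.* n)) ℕ.< N

module Frames (em : ∀ {a} → ExcludedMiddle a) {c ℓ} (G : Group c ℓ) (g : Group.Carrier G)
  (n : ℕ) (1≤n : 1 ℕ.≤ n) (N : ℕ) (large : Large n N) (g-order : NoSmallPower G g N) where
  open Group G
  open Power G
  open GroupProperties G
  open GroupSolver G using (solve; _⊜_; _⊕_; ⊝_; e)
  open Cyclic G g N g-order
  open Cleaning em (8 ℕ.* n) (ℕ.≤-trans 1≤n (ℕ.m≤n*m n 8)) large public

  DoubleCoset : Carrier → Carrier → Set ℓ
  DoubleCoset s t = ∃₂ λ a b → s ≈ γ a ∙ t ∙ γ b ⊎ s ≈ γ a ∙ t ⁻¹ ∙ γ b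

  dc-shift : ∀ {s t} a b → DoubleCoset s t → DoubleCoset (γ a ∙ s ∙ γ b) t
  dc-shift {s} {t} a b (a′ , b′ , p) = a ℤ.+ a′ , b′ ℤ.+ b ,
    [ (λ q → inj₁ (shift q)) , (λ q → inj₂ (shift q)) ]′ p
    where
    shift : ∀ {u} → s ≈ γ a′ ∙ u ∙ γ b′ → γ a ∙ s ∙ γ b ≈ γ (a ℤ.+ a′) ∙ u ∙ γ (b′ ℤ.+ b)
    shift {u} q = trans (∙-congʳ (∙-congˡ q))
      (trans (solve 5 (λ a a′ u b′ b → a ⊕ (a′ ⊕ u ⊕ b′) ⊕ b ⊜ a ⊕ a′ ⊕ u ⊕ (b′ ⊕ b))
          refl (γ a) (γ a′) u (γ b′) (γ b))
        (sym (∙-cong (∙-congʳ (pow-+ g a a′)) (pow-+ g b′ b))))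

  dc-resp : ∀ {s s′ t} → s ≈ s′ → DoubleCoset s t → DoubleCoset s′ t
  dc-resp s≈s′ (a , b , p) = a , b ,
    [ (λ q → inj₁ (trans (sym s≈s′) q)) , (λ q → inj₂ (trans (sym s≈s′) q)) ]′ p

  dc-⁻¹ : ∀ {s t} → DoubleCoset s t → DoubleCoset (s ⁻¹) t
  dc-⁻¹ {s} {t} (a , b , p) = ℤ.- b , ℤ.- a ,
    [ (λ q → inj₂ (invert q)) , (λ q → inj₁ (trans (invert q) (∙-congʳ (∙-congˡ (⁻¹-involutive t))))) ]′ p
    where
    invert : ∀ {u} → s ≈ γ a ∙ u ∙ γ b → s ⁻¹ ≈ γ (ℤ.- b) ∙ u ⁻¹ ∙ γ (ℤ.- a)
    invert {u} q = trans (⁻¹-cong q)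
      (trans (solve 3 (λ a u b → ⊝ (a ⊕ u ⊕ b) ⊜ ⊝ b ⊕ ⊝ u ⊕ ⊝ a) refl (γ a) u (γ b))
        (sym (∙-cong (∙-congʳ (pow-neg g b)) (pow-neg g a))))

  dc-refl : ∀ s → DoubleCoset s s
  dc-refl s = + 0 , + 0 , inj₁ (solve 1 (λ s → s ⊜ e ⊕ s ⊕ e) refl s)

  dc-trans : ∀ {s t u} → DoubleCoset s t → DoubleCoset t u → DoubleCoset s u
  dc-trans (a , b , inj₁ p) q = dc-resp (sym p) (dc-shift a b q)
  dc-trans (a , b , inj₂ p) q = dc-resp (sym p) (dc-shift a b (dc-⁻¹ q))

  dc-sym : ∀ {s t} → DoubleCoset s t → DoubleCoset t s
  dc-sym {s} {t} (a , b , p) = [ (λ q → dc-resp (undo q) shifted) ,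
      (λ q → dc-resp (trans (⁻¹-cong (undo q)) (⁻¹-involutive t)) (dc-⁻¹ shifted)) ]′ p
    where
    shifted = dc-shift (ℤ.- a) (ℤ.- b) (dc-refl s)
    undo : ∀ {u} → s ≈ γ a ∙ u ∙ γ b → γ (ℤ.- a) ∙ s ∙ γ (ℤ.- b) ≈ u
    undo {u} q = trans (∙-cong (∙-cong (pow-neg g a) q) (pow-neg g b))
      (solve 3 (λ a u b → ⊝ a ⊕ (a ⊕ u ⊕ b) ⊕ ⊝ b ⊜ u) refl (γ a) u (γ b))

  dc-right : ∀ t b → DoubleCoset (t ∙ γ b) t
  dc-right t b = dc-resp (solve 2 (λ t b → e ⊕ t ⊕ b ⊜ t ⊕ b) refl t (γ b)) (dc-shift (+ 0) b (dc-refl t))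

  record Frame (m : ℕ) : Set (c ⊔ ℓ) where
    field
      t         : Fin m → Carrier
      outside   : ∀ i a → ¬ (t i ≈ γ a)
      separated : ∀ i j → DoubleCoset (t i) (t j) → i ≡ j
      clean     : ∀ i → Clean (t i)

  Covered : ∀ {m} → Frame m → Carrier → Set ℓ
  Covered F h = (∃ λ a → h ≈ γ a) ⊎ (∃ λ i → DoubleCoset h (Frame.t F i))

  extend : ∀ {m} (F : Frame m) s → ¬ Covered F s → ∃ λ (F′ : Frame (suc m)) →
           (∀ {h} → Covered F h → Covered F′ h) × Covered F′ s
  extend F s ¬covered = F′ , (λ { (inj₁ p) → inj₁ p ; (inj₂ (i , p)) → inj₂ (suc i , p) })
                           , inj₂ (zero , dc-sym s′~s)
    where
    open Frame F
    -- The cleaned representative stays in the double coset of `s`, so separation and covering are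
    -- unaffected.
    x = proj₁ (clean-shift s)
    s′ = s ∙ γ x
    s′~s : DoubleCoset s′ s
    s′~s = dc-right s x
    t′ : Fin _ → Carrier
    t′ zero    = s′
    t′ (suc i) = t i
    F′ : Frame _
    F′ = record
      { t = t′
      ; outside = λ
        { zero a p → ¬covered (inj₁ (a ℤ.- x , trans (sym (//-rightDividesʳ (γ x) s))
            (trans (∙-congʳ p) (sym (pow-- g a x)))))
        ; (suc i) → outside i }
      ; separated = λ
        { zero zero _ → ≡.refl
        ; zero (suc j) p → contradiction (inj₂ (j , dc-trans (dc-sym s′~s) p)) ¬covered
        ; (suc i) zero p → contradiction (inj₂ (i , dc-sym (dc-trans p s′~s))) ¬covered
        ; (suc i) (suc j) p → ≡.cong suc (separated i j p) }
      ; clean = λ { zero → proj₂ (clean-shift s) ; (suc i) → clean i }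
      }

  covered-resp : ∀ {m} (F : Frame m) {h k} → h ≈ k → Covered F h → Covered F k
  covered-resp F h≈k (inj₁ (a , p)) = inj₁ (a , trans (sym h≈k) p)
  covered-resp F h≈k (inj₂ (i , p)) = inj₂ (i , dc-resp h≈k p)

  frame : ∀ K (f : Fin K → Carrier) → ∃ λ m → m ℕ.≤ K × ∃ λ (F : Frame m) → ∀ i → Covered F (f i)
  frame zero f = 0 , z≤n , record { t = λ () ; outside = λ () ; separated = λ () ; clean = λ () } , λ ()
  frame (suc K) f = let (m , m≤ , F , covers) = frame K (f ∘ suc) in add m≤ F covers em
    where
    add : ∀ {m} → m ℕ.≤ K → (F : Frame m) → (∀ i → Covered F (f (suc i))) → Dec (Covered F (f zero)) →
          ∃ λ m → m ℕ.≤ suc K × ∃ λ (F : Frame m) → ∀ i → Covered F (f i)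
    add m≤ F covers (yes p) = _ , ℕ.m≤n⇒m≤1+n m≤ , F , λ { zero → p ; (suc i) → covers i }
    add m≤ F covers (no ¬p) = let (F′ , mono , p) = extend F (f zero) ¬p in
      _ , s≤s m≤ , F′ , λ { zero → p ; (suc i) → mono (covers i) }

  module Marks {m : ℕ} (m≤n : m ℕ.≤ n) (F : Frame m) where
    open Frame F public

    -- Starting at 4 keeps the distances `far` and `far - 1` to the third mark at least 3, away from
    -- 1. Stepping by 2 makes all of them distinct over all `i`.
    far : Fin m → ℕ
    far i = 4 ℕ.+ 2 ℕ.* toℕ i

    far≤4n : ∀ i → far i ℕ.≤ 4 ℕ.* n
    far≤4n i = begin
      4 ℕ.+ 2 ℕ.* toℕ i          ≡⟨ 4+2x≡ (toℕ i) ⟩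
      2 ℕ.+ 2 ℕ.* suc (toℕ i)    ≤⟨ ℕ.+-mono-≤ (ℕ.*-monoʳ-≤ 2 1≤n) (ℕ.*-monoʳ-≤ 2 (ℕ.≤-trans (Fin.toℕ<n i) m≤n)) ⟩
      2 ℕ.* n ℕ.+ 2 ℕ.* n        ≡⟨ ℕ.*-distribʳ-+ n 2 2 ⟨
      4 ℕ.* n                    ∎
      where
      open ℕ.≤-Reasoning

    far-injective : ∀ {i j} → far i ≡ far j → i ≡ j
    far-injective {i} {j} p = Fin.toℕ-injective
      (ℕ.*-cancelˡ-≡ (toℕ i) (toℕ j) 2 (ℕ.+-cancelˡ-≡ 4 (2 ℕ.* toℕ i) (2 ℕ.* toℕ j) p))

    -- The values of far are even.
    far≢1+far : ∀ i j → ¬ far i ≡ suc (far j)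
    far≢1+far i j p = ℕ.even≢odd (toℕ i) (toℕ j)
      (ℕ.+-cancelˡ-≡ 4 (2 ℕ.* toℕ i) (suc (2 ℕ.* toℕ j)) (≡.trans p (≡.sym (ℕ.+-suc 4 (2 ℕ.* toℕ j)))))

    pos : Fin m → Fin 3 → ℕ
    pos i zero             = 0
    pos i (suc zero)       = 1
    pos i (suc (suc zero)) = far i

    pos≤4n : ∀ i k → pos i k ℕ.≤ 4 ℕ.* n
    pos≤4n i zero             = z≤n
    pos≤4n i (suc zero)       = ℕ.≤-trans 1≤n (ℕ.m≤n*m n 4)
    pos≤4n i (suc (suc zero)) = far≤4n i

    dist : Fin m → Fin 3 → Fin 3 → ℕ
    dist i k l = ∣ + pos i k ℤ.- + pos i l ∣

    -- `d` is the distance to the third mark. That mark itself is left out, having no mark of its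
    -- coset at distance 1.
    data Near (p : Fin m) (d : ℕ) : Fin 3 → Set where
      at-0 : d ≡ far p → Near p d zero
      at-1 : suc d ≡ far p → Near p d (suc zero)

    private
      too-far : ∀ {a d b} → 3 ℕ.≤ a → 3 ℕ.≤ d → b ℕ.≤ suc a → a ℕ.* d ≡ b → ⊥
      too-far {a} {d} {b} 3≤a 3≤d b≤ p = ℕ.<-irrefl ≡.refl (begin-strict
        suc a            <⟨ ℕ.+-monoˡ-≤ a (ℕ.≤-trans (s≤s (s≤s z≤n)) 3≤a) ⟩
        a ℕ.+ a          ≡⟨ ≡.cong (a ℕ.+_) (ℕ.+-identityʳ a) ⟨
        2 ℕ.* a          ≤⟨ ℕ.*-monoˡ-≤ a {2} {3} (s≤s (s≤s z≤n)) ⟩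
        3 ℕ.* a          ≤⟨ ℕ.*-monoˡ-≤ a 3≤d ⟩
        d ℕ.* a          ≡⟨ ℕ.*-comm d a ⟩
        a ℕ.* d          ≡⟨ p ⟩
        b                ≤⟨ b≤ ⟩
        suc a            ∎)
        where open ℕ.≤-Reasoning

      3≤3+ : ∀ {x} → 3 ℕ.≤ 3 ℕ.+ x
      3≤3+ = s≤s (s≤s (s≤s z≤n))

    -- The distances are 1, `far p - 1` and `far p`, so a ratio of at least 3 between two nonzero
    -- ones forces the smaller to be 1. Ratios are used because in a coset of inverse marks the
    -- distances are known only after conjugation, that is, up to a common factor.
    dist-ratio : ∀ p k l k′ {d} → 3 ℕ.≤ d → 0 ℕ.< dist p k k′ → dist p k l ℕ.* d ≡ dist p k k′ →
                 dist p k l ≡ 1 × Near p d k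
    dist-ratio p zero zero k′ _ 0< eq = contradiction (≡.subst (0 ℕ.<_) (≡.sym eq) 0<) (λ ())
    dist-ratio p (suc zero) (suc zero) k′ _ 0< eq = contradiction (≡.subst (0 ℕ.<_) (≡.sym eq) 0<) (λ ())
    dist-ratio p (suc (suc zero)) (suc (suc zero)) k′ {d} _ 0< eq = contradiction
      (≡.subst (0 ℕ.<_) (≡.trans (≡.sym eq) (≡.cong (λ i → ∣ i ∣ ℕ.* d) (ℤ.+-inverseʳ (+ far p)))) 0<) (λ ())
    dist-ratio p zero (suc zero) (suc zero) 3≤d _ eq with ≡.trans (≡.sym (ℕ.+-identityʳ _)) eq
    dist-ratio p zero (suc zero) (suc zero) (s≤s ()) _ eq | ≡.refl
    dist-ratio p zero (suc zero) (suc (suc zero)) {d} _ _ eq = ≡.refl , at-0 (≡.trans (≡.sym (ℕ.+-identityʳ _)) eq)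
    dist-ratio p zero (suc (suc zero)) (suc zero) 3≤d _ eq = ⊥-elim (too-far {far p} 3≤3+ 3≤d (s≤s z≤n) eq)
    dist-ratio p zero (suc (suc zero)) (suc (suc zero)) 3≤d _ eq = ⊥-elim (too-far 3≤3+ 3≤d (ℕ.n≤1+n _) eq)
    dist-ratio p (suc zero) zero zero 3≤d _ eq with ≡.trans (≡.sym (ℕ.+-identityʳ _)) eq
    dist-ratio p (suc zero) zero zero (s≤s ()) _ eq | ≡.refl
    dist-ratio p (suc zero) zero (suc (suc zero)) {d} _ _ eq =
      ≡.refl , at-1 (≡.cong suc (≡.trans (≡.sym (ℕ.+-identityʳ _)) eq))
    dist-ratio p (suc zero) (suc (suc zero)) zero 3≤d _ eq =
      ⊥-elim (too-far {3 ℕ.+ 2 ℕ.* toℕ p} 3≤3+ 3≤d (s≤s z≤n) eq)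
    dist-ratio p (suc zero) (suc (suc zero)) (suc (suc zero)) 3≤d _ eq = ⊥-elim (too-far 3≤3+ 3≤d (ℕ.n≤1+n _) eq)
    dist-ratio p (suc (suc zero)) zero zero 3≤d _ eq = ⊥-elim (too-far 3≤3+ 3≤d (ℕ.n≤1+n _) eq)
    dist-ratio p (suc (suc zero)) zero (suc zero) 3≤d _ eq =
      ⊥-elim (too-far 3≤3+ 3≤d (ℕ.≤-trans (ℕ.n≤1+n _) (ℕ.≤-trans (ℕ.m≤m+n (far p) 0) (ℕ.n≤1+n _))) eq)
    dist-ratio p (suc (suc zero)) (suc zero) zero 3≤d _ eq =
      ⊥-elim (too-far 3≤3+ 3≤d (ℕ.≤-reflexive (ℕ.+-identityʳ (far p))) eq)
    dist-ratio p (suc (suc zero)) (suc zero) (suc zero) 3≤d _ eq = ⊥-elim (too-far 3≤3+ 3≤d (ℕ.n≤1+n _) eq)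
    dist-ratio p zero (suc zero) zero _ () _
    dist-ratio p zero (suc (suc zero)) zero _ () _
    dist-ratio p (suc zero) zero (suc zero) _ () _
    dist-ratio p (suc zero) (suc (suc zero)) (suc zero) _ () _
    dist-ratio p (suc (suc zero)) zero (suc (suc zero)) _ 0< eq =
      contradiction (≡.subst (0 ℕ.<_) (≡.cong ∣_∣ (ℤ.+-inverseʳ (+ far p))) 0<) (λ ())
    dist-ratio p (suc (suc zero)) (suc zero) (suc (suc zero)) _ 0< eq =
      contradiction (≡.subst (0 ℕ.<_) (≡.cong ∣_∣ (ℤ.+-inverseʳ (+ far p))) 0<) (λ ())

    mark : Fin m → Fin 3 → Carrier
    mark p k = t p ∙ γ (+ pos p k)

    Marked : Carrier → Set ℓ
    Marked u = ∃₂ λ p k → u ≈ mark p k ⊎ u ≈ mark p k ⁻¹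

    Marked-resp : ∀ {u v} → u ≈ v → Marked u → Marked v
    Marked-resp u≈v (p , k , inj₁ eq) = p , k , inj₁ (trans (sym u≈v) eq)
    Marked-resp u≈v (p , k , inj₂ eq) = p , k , inj₂ (trans (sym u≈v) eq)

    Marked-⁻¹ : ∀ {u} → Marked u → Marked (u ⁻¹)
    Marked-⁻¹ (p , k , inj₁ eq) = p , k , inj₂ (⁻¹-cong eq)
    Marked-⁻¹ (p , k , inj₂ eq) = p , k , inj₁ (trans (⁻¹-cong eq) (⁻¹-involutive _))

    mark-marked : ∀ p k → Marked (mark p k)
    mark-marked p k = p , k , inj₁ refl

    mark-dc : ∀ {u} p k → u ≈ mark p k ⊎ u ≈ mark p k ⁻¹ → DoubleCoset u (t p)
    mark-dc p k (inj₁ eq) = dc-resp (sym eq) (dc-right (t p) (+ pos p k))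
    mark-dc p k (inj₂ eq) = dc-resp (sym eq) (dc-⁻¹ (dc-right (t p) (+ pos p k)))

    marked-outside : ∀ {u} → Marked u → ¬ (∃ λ a → u ≈ γ a)
    marked-outside (p , k , eq) (a , u≈γa) with dc-sym (mark-dc p k eq)
    ... | (x , y , inj₁ q) = outside p (x ℤ.+ a ℤ.+ y) (trans q (trans (∙-congʳ (∙-congˡ u≈γa))
            (trans (∙-congʳ (sym (pow-+ g x a))) (sym (pow-+ g (x ℤ.+ a) y)))))
    ... | (x , y , inj₂ q) = outside p (x ℤ.+ ℤ.- a ℤ.+ y) (trans q (trans
            (∙-congʳ (∙-congˡ (trans (⁻¹-cong u≈γa) (sym (pow-neg g a)))))
            (trans (∙-congʳ (sym (pow-+ g x (ℤ.- a)))) (sym (pow-+ g (x ℤ.+ ℤ.- a) y)))))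

    bound : 8 ℕ.* n ℕ.* (4 ℕ.* n) ℕ.+ 12 ℕ.* n ℕ.< N
    bound = begin-strict
      V ℕ.* (4 ℕ.* n) ℕ.+ 12 ℕ.* n      ≤⟨ ℕ.+-mono-≤ (ℕ.*-monoʳ-≤ V (ℕ.*-monoˡ-≤ n {4} {8} (ℕ.m≤m+n 4 4)))
                                                       (ℕ.*-monoʳ-≤ 12 (ℕ.m≤n*m n 8)) ⟩
      V ℕ.* V ℕ.+ 12 ℕ.* V              ≤⟨ ℕ.+-mono-≤ V²≤V³ (ℕ.*-monoʳ-≤ 12 (ℕ.≤-trans V≤V² V²≤V³)) ⟩
      V³ ℕ.+ 12 ℕ.* V³                  ≡⟨⟩
      13 ℕ.* V³                         ≤⟨ ℕ.*-monoˡ-≤ V³ {13} {48} (ℕ.m≤m+n 13 35) ⟩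
      48 ℕ.* V³                         <⟨ large ⟩
      N                                 ∎
      where
      open ℕ.≤-Reasoning
      V = 8 ℕ.* n
      V³ = V ℕ.* V ℕ.* V
      instance
        V≢0 : ℕ.NonZero V
        V≢0 = ℕ.>-nonZero (ℕ.≤-trans 1≤n (ℕ.m≤n*m n 8))
      V≤V² : V ℕ.≤ V ℕ.* V
      V≤V² = ℕ.m≤m*n V V
      V²≤V³ : V ℕ.* V ℕ.≤ V³
      V²≤V³ = ℕ.m≤m*n (V ℕ.* V) V

    bound-8+4 : 8 ℕ.* n ℕ.+ 4 ℕ.* n ℕ.< N
    bound-8+4 = ℕ.≤-<-trans
      (ℕ.≤-trans (ℕ.≤-reflexive (≡.sym (ℕ.*-distribʳ-+ n 8 4))) (ℕ.m≤n+m (12 ℕ.* n) (8 ℕ.* n ℕ.* (4 ℕ.* n)))) bound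

    bound-4 : 4 ℕ.* n ℕ.< N
    bound-4 = ℕ.≤-<-trans (ℕ.m≤n+m (4 ℕ.* n) (8 ℕ.* n)) bound-8+4

    bound-32+8 : 8 ℕ.* n ℕ.* (4 ℕ.* n) ℕ.+ 8 ℕ.* n ℕ.< N
    bound-32+8 = ℕ.≤-<-trans
      (ℕ.+-monoʳ-≤ (8 ℕ.* n ℕ.* (4 ℕ.* n)) (ℕ.*-monoˡ-≤ n {8} {12} (ℕ.m≤m+n 8 4))) bound

    4n+4n≡8n : 4 ℕ.* n ℕ.+ 4 ℕ.* n ≡ 8 ℕ.* n
    4n+4n≡8n = ≡.sym (ℕ.*-distribʳ-+ n 4 4)

    4n≤8n : 4 ℕ.* n ℕ.≤ 8 ℕ.* n
    4n≤8n = ℕ.*-monoˡ-≤ n {4} {8} (s≤s (s≤s (s≤s (s≤s z≤n))))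

    -- Separation fixes the index. Direct marks are compared through the bound on `N`; an inverse
    -- mark in this range is handled by cleanness.
    marked-in-coset : ∀ p w → ∣ w ∣ ℕ.≤ 8 ℕ.* n → Marked (t p ∙ γ w) → ∃ λ k → w ≡ + pos p k
    marked-in-coset p w w≤ (q , k , eq)
      with separated p q (dc-trans (dc-sym (dc-right (t p) w)) (mark-dc q k eq))
    marked-in-coset p w w≤ (.p , k , inj₁ eq) | ≡.refl = k ,
      γ-injective-bounded w (+ pos p k) w≤ (pos≤4n p k) bound-8+4
        (∙-cancelˡ (t p) _ _ eq)
    marked-in-coset p w w≤ (.p , k , inj₂ eq) | ≡.refl = k ,
      clean p w (+ pos p k) w≤ (ℕ.≤-trans (pos≤4n p k) 4n≤8n) (trans (∙-congʳ eq) (inverseˡ _))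

    direct-step : ∀ {u} p k i → u ≈ mark p k → ∣ i ∣ ℕ.≤ 4 ℕ.* n → Marked (u ∙ γ i) →
                  ∃ λ l → dist p k l ≡ ∣ i ∣
    direct-step {u} p k i u≈ i≤ marked = proj₁ found ,
      ≡.trans (≡.cong (λ j → ∣ + pos p k ℤ.- j ∣) (≡.sym (proj₂ found)))
        (≡.trans (≡.cong ∣_∣ (x-[x+i]≡-i (+ pos p k) i)) (ℤ.∣-i∣≡∣i∣ i))
      where
      found : ∃ λ l → + pos p k ℤ.+ i ≡ + pos p l
      found = marked-in-coset p (+ pos p k ℤ.+ i)
        (≡.subst (∣ + pos p k ℤ.+ i ∣ ℕ.≤_) 4n+4n≡8n (∣+∣-mono (+ pos p k) i (pos≤4n p k) i≤))
        (Marked-resp (trans (∙-congʳ u≈) (trans (assoc _ _ _) (∙-congˡ (sym (pow-+ g (+ pos p k) i))))) marked)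

    -- If `u ∙ γ i` is a direct mark, then `u` lies in `t p C` and cleanness identifies it with
    -- `mark p k`. If it is an inverse mark, the quotient of the two inverse marks is a power of `g`
    -- conjugated by `t p`.
    inverse-step : ∀ {u} p k i → u ≈ mark p k ⁻¹ → ∣ i ∣ ℕ.≤ 4 ℕ.* n → Marked (u ∙ γ i) →
                   u ≈ mark p k ⊎ ∃ λ l → t p ∙ γ (+ pos p k ℤ.- + pos p l) ∙ t p ⁻¹ ≈ γ i
    inverse-step {u} p k i u≈ i≤ (q , l , eq) = go (separated p q (dc-trans
        (dc-sym (mark-dc p k (inj₂ u≈))) (dc-trans (dc-sym (dc-right u i)) (mark-dc q l eq)))) eq
      where
      go : p ≡ q → u ∙ γ i ≈ mark q l ⊎ u ∙ γ i ≈ mark q l ⁻¹ →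
           u ≈ mark p k ⊎ ∃ λ l → t p ∙ γ (+ pos p k ℤ.- + pos p l) ∙ t p ⁻¹ ≈ γ i
      go ≡.refl (inj₁ eq) =
        inj₁ (trans u≈′ (∙-congˡ (reflexive (≡.cong γ (≡.sym k≡)))))
        where
        u≈′ : u ≈ t p ∙ γ (+ pos p l ℤ.- i)
        u≈′ = trans (trans (sym (//-rightDividesʳ (γ i) u)) (∙-congʳ eq))
                (trans (assoc _ _ _) (∙-congˡ (sym (pow-- g (+ pos p l) i))))
        k≡ : + pos p k ≡ + pos p l ℤ.- i
        k≡ = clean p (+ pos p k) (+ pos p l ℤ.- i) (ℕ.≤-trans (pos≤4n p k) 4n≤8n)
               (≡.subst (∣ + pos p l ℤ.- i ∣ ℕ.≤_) 4n+4n≡8n (∣-∣-mono (+ pos p l) i (pos≤4n p l) i≤))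
               (trans (∙-congˡ (trans (sym u≈′) u≈)) (inverseʳ _))
      go ≡.refl (inj₂ eq) = inj₂ (l , (begin
        t p ∙ γ (+ pos p k ℤ.- + pos p l) ∙ t p ⁻¹         ≈⟨ ∙-congʳ (∙-congˡ (pow-- g (+ pos p k) (+ pos p l))) ⟩
        t p ∙ (γ (+ pos p k) ∙ γ (+ pos p l) ⁻¹) ∙ t p ⁻¹  ≈⟨ solve 3 (λ t a b →
          t ⊕ (a ⊕ ⊝ b) ⊕ ⊝ t ⊜ t ⊕ a ⊕ ⊝ (t ⊕ b)) refl
                                                               (t p) (γ (+ pos p k)) (γ (+ pos p l)) ⟩
        mark p k ∙ mark p l ⁻¹                             ≈⟨ ∙-congˡ (trans (sym eq) (∙-congʳ u≈)) ⟩
        mark p k ∙ (mark p k ⁻¹ ∙ γ i)                     ≈⟨ \\-leftDividesˡ (mark p k) (γ i) ⟩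
        γ i                                                ∎))
        where open SetoidReasoning setoid

    open Normalizer G g

    conj-unit⇒norm : ∀ t a i → ∣ a ∣ ≡ 1 → ∣ i ∣ ≡ 1 → t ∙ γ a ∙ t ⁻¹ ≈ γ i → Norm t
    conj-unit⇒norm t a i ∣a∣≡1 ∣i∣≡1 eq = go (i ℤ.* a) (≡.trans (ℤ.abs-* i a) (≡.cong₂ ℕ._*_ ∣i∣≡1 ∣a∣≡1))
      (trans (∙-congʳ (∙-congˡ (trans (sym (pow-1 g)) (reflexive (≡.cong γ (≡.sym (a*a≡1 a ∣a∣≡1)))))))
        (conj-pow t g a i a eq))
      where
      a*a≡1 : ∀ a → ∣ a ∣ ≡ 1 → a ℤ.* a ≡ + 1
      a*a≡1 (+ 1)    _ = ≡.refl
      a*a≡1 -[1+ 0 ] _ = ≡.refl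
      unconj : ∀ {x} → t ∙ g ∙ t ⁻¹ ≈ x → t ∙ g ≈ x ∙ t
      unconj p = trans (sym (//-rightDividesˡ t (t ∙ g))) (∙-congʳ p)
      go : ∀ j → ∣ j ∣ ≡ 1 → t ∙ g ∙ t ⁻¹ ≈ γ j → Norm t
      go (+ 1)    _ p = inj₁ (unconj (trans p (pow-1 g)))
      go -[1+ 0 ] _ p = inj₂ (unconj (trans p (⁻¹-cong (identityʳ g))))

    -- The signs of the exponents are left open, since `δ` may reverse the direction of the coset
    -- `u C`.
    Spaced : ℕ → Carrier → Set ℓ
    Spaced d u = Marked u × (∃ λ i → ∣ i ∣ ≡ 1 × Marked (u ∙ γ i)) × (∃ λ j → ∣ j ∣ ≡ d × Marked (u ∙ γ j))

    spaced⇒mark : ∀ {d u} → 3 ℕ.≤ d → d ℕ.≤ 4 ℕ.* n → Spaced d u →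
                  ∃₂ λ p k → Near p d k × (u ≈ mark p k ⊎ Norm (t p) × u ≈ mark p k ⁻¹)
    spaced⇒mark {d} {u} 3≤d d≤ ((p , k , eq) , (i , ∣i∣≡1 , Mi) , (j , ∣j∣≡d , Mj)) = p , k , go eq
      where
      i≤ : ∣ i ∣ ℕ.≤ 4 ℕ.* n
      i≤ = ℕ.≤-trans (ℕ.≤-reflexive ∣i∣≡1) (ℕ.≤-trans 1≤n (ℕ.m≤n*m n 4))
      j≤ : ∣ j ∣ ℕ.≤ 4 ℕ.* n
      j≤ = ℕ.≤-trans (ℕ.≤-reflexive ∣j∣≡d) d≤
      0<d : 0 ℕ.< d
      0<d = ℕ.≤-trans (s≤s z≤n) 3≤d
      direct : u ≈ mark p k → Near p d k × (u ≈ mark p k ⊎ Norm (t p) × u ≈ mark p k ⁻¹)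
      direct u≈ = proj₂ (dist-ratio p k l l′ 3≤d (≡.subst (0 ℕ.<_) (≡.sym dl′) 0<d)
          (≡.trans (≡.cong (ℕ._* d) dl) (≡.trans (ℕ.*-identityˡ d) (≡.sym dl′)))) , inj₁ u≈
        where
        stepᵢ = direct-step p k i u≈ i≤ Mi
        stepⱼ = direct-step p k j u≈ j≤ Mj
        l l′ : Fin 3
        l = proj₁ stepᵢ
        l′ = proj₁ stepⱼ
        dl : dist p k l ≡ 1
        dl = ≡.trans (proj₂ stepᵢ) ∣i∣≡1
        dl′ : dist p k l′ ≡ d
        dl′ = ≡.trans (proj₂ stepⱼ) ∣j∣≡d
      go : u ≈ mark p k ⊎ u ≈ mark p k ⁻¹ → Near p d k × (u ≈ mark p k ⊎ Norm (t p) × u ≈ mark p k ⁻¹)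
      go (inj₁ u≈) = direct u≈
      go (inj₂ u≈) = both (inverse-step p k i u≈ i≤ Mi) (inverse-step p k j u≈ j≤ Mj)
        where
        both : (u ≈ mark p k ⊎ ∃ λ l → t p ∙ γ (+ pos p k ℤ.- + pos p l) ∙ t p ⁻¹ ≈ γ i) →
               (u ≈ mark p k ⊎ ∃ λ l → t p ∙ γ (+ pos p k ℤ.- + pos p l) ∙ t p ⁻¹ ≈ γ j) →
               Near p d k × (u ≈ mark p k ⊎ Norm (t p) × u ≈ mark p k ⁻¹)
        both (inj₁ u≈′) _         = direct u≈′
        both (inj₂ _) (inj₁ u≈′)  = direct u≈′
        both (inj₂ (l , ci)) (inj₂ (l′ , cj)) =
          proj₂ ratio , inj₂ (conj-unit⇒norm (t p) a i (proj₁ ratio) ∣i∣≡1 ci , u≈)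
          where
          a b : ℤ
          a = + pos p k ℤ.- + pos p l
          b = + pos p k ℤ.- + pos p l′
          dist≤ : ∀ l → dist p k l ℕ.≤ 8 ℕ.* n
          dist≤ l = ≡.subst (dist p k l ℕ.≤_) 4n+4n≡8n (∣-∣-mono (+ pos p k) (+ pos p l) (pos≤4n p k) (pos≤4n p l))
          i*ji≡j : ∀ i → ∣ i ∣ ≡ 1 → i ℤ.* (j ℤ.* i) ≡ j
          i*ji≡j (+ 1)    _ = ≡.trans (ℤ.*-identityˡ _) (ℤ.*-identityʳ j)
          i*ji≡j -[1+ 0 ] _ = -1*j*-1≡j j
          abs-aji : ∣ a ℤ.* (j ℤ.* i) ∣ ≡ dist p k l ℕ.* d
          abs-aji = ≡.trans (ℤ.abs-* a (j ℤ.* i)) (≡.cong (dist p k l ℕ.*_)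
            (≡.trans (ℤ.abs-* j i) (≡.trans (≡.cong₂ ℕ._*_ ∣j∣≡d ∣i∣≡1) (ℕ.*-identityʳ d))))
          -- Conjugation by `t p` sends `γ a` to `γ i` with `i = ±1`, hence `γ (a j i)` to `γ j`,
          -- which is also the image of `γ b`. So `|a| d = |b|`, as `dist-ratio` requires.
          aji≈b : γ (a ℤ.* (j ℤ.* i)) ≈ γ b
          aji≈b = ∙-cancelˡ (t p) _ _ (∙-cancelʳ (t p ⁻¹) _ _ (trans (conj-pow (t p) g a i (j ℤ.* i) ci)
            (trans (reflexive (≡.cong γ (i*ji≡j i ∣i∣≡1))) (sym cj))))
          aji≡b : a ℤ.* (j ℤ.* i) ≡ b
          aji≡b = γ-injective-bounded (a ℤ.* (j ℤ.* i)) b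
            (ℕ.≤-trans (ℕ.≤-reflexive abs-aji) (ℕ.*-mono-≤ (dist≤ l) d≤)) (dist≤ l′) bound-32+8
            aji≈b
          j≡0 : dist p k l′ ≡ 0 → j ≡ + 0
          j≡0 eq = γ≈ε⇒≡0 j (ℕ.≤-<-trans j≤ bound-4)
            (trans (sym cj) (trans (reflexive (≡.cong (λ x → t p ∙ γ x ∙ t p ⁻¹) (ℤ.∣i∣≡0⇒i≡0 {b} eq)))
              (solve 1 (λ t → t ⊕ e ⊕ ⊝ t ⊜ e) refl (t p))))
          0<dist : 0 ℕ.< dist p k l′
          0<dist = ℕ.n≢0⇒n>0 (λ eq → ℕ.>⇒≢ 0<d (≡.trans (≡.sym ∣j∣≡d) (≡.cong ∣_∣ (j≡0 eq))))
          ratio = dist-ratio p k l l′ 3≤d 0<dist (≡.trans (≡.sym abs-aji) (≡.cong ∣_∣ aji≡b))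

-- From preserved marks to signs on covered words

private
  x+[y-x]≡y : ∀ x y → x ℤ.+ (y ℤ.- x) ≡ y
  x+[y-x]≡y = ℤ-Ring.solve-∀

module Transfer (em : ∀ {a} → ExcludedMiddle a) {c ℓ} (G : Group c ℓ) (g : Group.Carrier G)
  (n : ℕ) (1≤n : 1 ℕ.≤ n) (N : ℕ) (large : Large n N) (g-order : NoSmallPower G g N) (4<N : 4 ℕ.< N)
  {m : ℕ} (m≤n : m ℕ.≤ n) (F : Frames.Frame em G g n 1≤n N large g-order m) (Δ : Cocycle G) where
  open Group G
  open Power G
  open Cyclic G g N g-order
  open Frames em G g n 1≤n N large g-order
  open Marks m≤n F
  open GroupProperties G
  open GroupSolver G using (solve; _⊜_; _⊕_; ⊝_)
  open Conversion G
  open Generation G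
  open Normalizer G g
  open Cocycle Δ
  open SubgroupPredicate fixed-subgroup using () renaming (∙∈ to fixed-∙; ⁻¹∈ to fixed-⁻¹; resp∈ to fixed-resp)
  open Torsion (λ m 0<m m<5 → g-order m 0<m (ℕ.≤-trans m<5 4<N))

  covered-∙g : ∀ {h} → Covered F h → Covered F (h ∙ g)
  covered-∙g (inj₁ (a , h≈γa)) = inj₁ (a ℤ.+ + 1 , trans (∙-cong h≈γa (sym (pow-1 g))) (sym (pow-+ g a (+ 1))))
  covered-∙g {h} (inj₂ (p , dc)) = inj₂ (p , dc-resp (∙-cong (identityˡ h) (pow-1 g)) (dc-shift (+ 0) (+ 1) dc))

  norm-∙g : ∀ {h} → Norm h → Norm (h ∙ g)
  norm-∙g norm = norm-∙ norm (inj₁ refl)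

  module _
    (δ-γ : ∀ x → (∀ i → δ x (γ i) ≈ γ i) ⊎ (∀ i → δ x (γ i) ≈ γ (ℤ.- i)))
    (δ-marked : ∀ {x u} → Marked u → Marked (δ x u))
    where

    δ-shift : ∀ x u i → ∃ λ j → ∣ j ∣ ≡ ∣ i ∣ × δ x (u ∙ γ i) ≈ δ x u ∙ γ j
    δ-shift x u i = [ (λ p → i , ≡.refl , trans (δ-∙ x u (γ i)) (∙-congˡ (p i)))
                    , (λ p → ℤ.- i , ℤ.∣-i∣≡∣i∣ i , trans (δ-∙ x u (γ i)) (∙-congˡ (p i))) ]′ (δ-γ (x ∙ u))

    δ-spaced : ∀ {d x u} → Spaced d u → Spaced d (δ x u)
    δ-spaced {d} {x} {u} (M , near , far) = δ-marked M , move near , move far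
      where
      move : ∀ {d} → (∃ λ i → ∣ i ∣ ≡ d × Marked (u ∙ γ i)) → ∃ λ i → ∣ i ∣ ≡ d × Marked (δ x u ∙ γ i)
      move (i , ∣i∣≡d , Mi) = let (j , ∣j∣≡∣i∣ , eq) = δ-shift x u i in
        j , ≡.trans ∣j∣≡∣i∣ ∣i∣≡d , Marked-resp eq (δ-marked Mi)

    mark-spaced : ∀ {p d k} → Near p d k → Spaced d (mark p k)
    mark-spaced {p} {d} {k} near = mark-marked p k , at near
      where
      step : ∀ k l {d} → dist p l k ≡ d → ∃ λ i → ∣ i ∣ ≡ d × Marked (mark p k ∙ γ i)
      step k l dist≡d = + pos p l ℤ.- + pos p k , dist≡d , Marked-resp
        (sym (trans (assoc _ _ _) (∙-congˡ (trans (sym (pow-+ g (+ pos p k) (+ pos p l ℤ.- + pos p k)))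
          (reflexive (≡.cong γ (x+[y-x]≡y (+ pos p k) (+ pos p l))))))))
        (mark-marked p l)
      at : ∀ {k} → Near p d k →
           (∃ λ i → ∣ i ∣ ≡ 1 × Marked (mark p k ∙ γ i)) × (∃ λ j → ∣ j ∣ ≡ d × Marked (mark p k ∙ γ j))
      at (at-0 d≡far)   = step zero (suc zero) ≡.refl ,
                          step zero (suc (suc zero)) (≡.trans (ℕ.+-identityʳ (far p)) (≡.sym d≡far))
      at (at-1 1+d≡far) = step (suc zero) zero ≡.refl ,
                          step (suc zero) (suc (suc zero)) (≡.sym (ℕ.suc-injective 1+d≡far))

    -- The parity of `d` decides the position and its size the index.
    near-unique : ∀ {p q d k l} → Near p d k → Near q d l → p ≡ q × k ≡ l
    near-unique (at-0 x) (at-0 y) = far-injective (≡.trans (≡.sym x) y) , ≡.refl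
    near-unique (at-1 x) (at-1 y) = far-injective (≡.trans (≡.sym x) y) , ≡.refl
    near-unique {p} {q} (at-0 x) (at-1 y) = contradiction (≡.trans (≡.sym y) (≡.cong suc x)) (far≢1+far q p)
    near-unique {p} {q} (at-1 x) (at-0 y) = contradiction (≡.trans (≡.sym x) (≡.cong suc y)) (far≢1+far p q)

    δ-mark : ∀ {p d k} → 3 ℕ.≤ d → d ℕ.≤ 4 ℕ.* n → Near p d k → ∀ x →
             δ x (mark p k) ≈ mark p k ⊎ Norm (t p) × δ x (mark p k) ≈ mark p k ⁻¹
    δ-mark {p} {d} {k} 3≤d d≤ near x = go (spaced⇒mark 3≤d d≤ (δ-spaced (mark-spaced near)))
      where
      go : (∃₂ λ q l → Near q d l × (δ x (mark p k) ≈ mark q l ⊎ Norm (t q) × δ x (mark p k) ≈ mark q l ⁻¹)) →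
           δ x (mark p k) ≈ mark p k ⊎ Norm (t p) × δ x (mark p k) ≈ mark p k ⁻¹
      go (q , l , near′ , result) with near-unique near near′
      ... | ≡.refl , ≡.refl = result

    δ-mark₀ : ∀ p x → δ x (t p) ≈ t p ⊎ Norm (t p) × δ x (t p) ≈ t p ⁻¹
    δ-mark₀ p x = [ (λ q → inj₁ (trans t≈ (trans q (identityʳ _)))) ,
                    (λ (norm , q) → inj₂ (norm , trans t≈ (trans q (⁻¹-cong (identityʳ _))))) ]′
                  (δ-mark (s≤s (s≤s (s≤s z≤n))) (far≤4n p) (at-0 ≡.refl) x)
      where
      t≈ : δ x (t p) ≈ δ x (t p ∙ ε)
      t≈ = δ-cong refl (sym (identityʳ (t p)))

    δ-mark₁ : ∀ p x → δ x (t p ∙ γ (+ 1)) ≈ t p ∙ γ (+ 1) ⊎ Norm (t p) × δ x (t p ∙ γ (+ 1)) ≈ (t p ∙ γ (+ 1)) ⁻¹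
    δ-mark₁ p = δ-mark (s≤s (s≤s (s≤s z≤n))) (ℕ.≤-trans (ℕ.n≤1+n _) (far≤4n p)) (at-1 ≡.refl)

    γ-cent : ∀ a → Cent (γ a)
    γ-cent a = trans (∙-congˡ (sym (pow-1 g))) (trans (pow-comm g a (+ 1)) (∙-congʳ (pow-1 g)))

    γ1≉γ-1 : ¬ (γ (+ 1) ≈ γ (ℤ.- + 1))
    γ1≉γ-1 p = contradiction (γ-injective (+ 1) (ℤ.- + 1) (ℕ.≤-<-trans (s≤s (s≤s z≤n)) 4<N) p) (λ ())

    cent-γ : ∀ {t} → Cent t → ∀ k → t ∙ γ k ≈ γ k ∙ t
    cent-γ {t} p k = trans (sym (//-rightDividesˡ t _)) (∙-congʳ (trans (pow-conj t g k)
      (pow-cong (trans (∙-congʳ p) (//-rightDividesʳ t g)) k)))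

    flip-γ : ∀ {t} → Flip t → ∀ k → t ∙ γ k ≈ γ (ℤ.- k) ∙ t
    flip-γ {t} p k = trans (sym (//-rightDividesˡ t _)) (∙-congʳ (trans (pow-conj t g k)
      (trans (pow-cong (trans (∙-congʳ p) (trans (//-rightDividesʳ t (g ⁻¹)) (sym (⁻¹-cong (pow-1 g))))) k)
        (trans (sym (pow-* g (ℤ.- + 1) k)) (reflexive (≡.cong γ (ℤ.-1*i≡-i k)))))))

    -- `δ x` maps the coset `u C` to `v C`, where `v = δ x u`, with exponents kept or reversed
    -- throughout. The values at exponents 0 and 1 then settle every `k`: unwanted combinations give
    -- `u = u⁻¹`, which is harmless, or contradict `g ≠ g⁻¹` or `flip-square`.
    norm⇒signed : ∀ p → Norm (t p) → ∀ k → Signed (t p ∙ γ k)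
    norm⇒signed p norm k x = go norm (drop (δ-mark₀ p x)) (drop (δ-mark₁ p x)) (δ-γ (x ∙ u))
      where
      u = t p
      a b : Carrier
      a = γ (+ 1)
      b = γ (ℤ.- + 1)
      drop : ∀ {P Q R : Set ℓ} → P ⊎ Q × R → P ⊎ R
      drop = [ inj₁ , (λ (_ , r) → inj₂ r) ]′
      same : ∀ {v} → δ x u ≈ v → (∀ i → δ (x ∙ u) (γ i) ≈ γ i) → ∀ k → δ x (u ∙ γ k) ≈ v ∙ γ k
      same q σ k = trans (δ-∙ x u (γ k)) (∙-cong q (σ k))
      opposite : ∀ {v} → δ x u ≈ v → (∀ i → δ (x ∙ u) (γ i) ≈ γ (ℤ.- i)) → ∀ k → δ x (u ∙ γ k) ≈ v ∙ γ (ℤ.- k)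
      opposite q σ k = trans (δ-∙ x u (γ k)) (∙-cong q (σ k))
      cent⁻¹ : Cent u → ∀ k → (u ∙ γ k) ⁻¹ ≈ u ⁻¹ ∙ γ (ℤ.- k)
      cent⁻¹ cent k = trans (⁻¹-cong (cent-γ cent k)) (trans (⁻¹-anti-homo-∙ _ _) (∙-congˡ (sym (pow-neg g k))))
      flip⁻¹ : Flip u → ∀ k → (u ∙ γ k) ⁻¹ ≈ u ⁻¹ ∙ γ k
      flip⁻¹ flip k = trans (⁻¹-cong (flip-γ flip k)) (trans (⁻¹-anti-homo-∙ _ _)
        (∙-congˡ (trans (⁻¹-cong (pow-neg g k)) (⁻¹-involutive _))))
      a≈g : a ≈ g
      a≈g = pow-1 g
      no-square : ∀ {v} → Flip v → ¬ (v ∙ b ≈ v ⁻¹ ∙ a)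
      no-square {v} flip q = flip-square flip (trans (via v a q
        (solve 2 (λ v a → v ⊕ v ⊜ v ⊕ (v ⊕ ⊝ a) ⊕ a) refl v a)
        (solve 2 (λ v a → v ⊕ (⊝ v ⊕ a) ⊕ a ⊜ a ⊕ a) refl v a)) (∙-cong a≈g a≈g))
      go : Norm u → δ x u ≈ u ⊎ δ x u ≈ u ⁻¹ →
           δ x (u ∙ a) ≈ u ∙ a ⊎ δ x (u ∙ a) ≈ (u ∙ a) ⁻¹ →
           (∀ i → δ (x ∙ u) (γ i) ≈ γ i) ⊎ (∀ i → δ (x ∙ u) (γ i) ≈ γ (ℤ.- i)) →
           δ x (u ∙ γ k) ≈ u ∙ γ k ⊎ δ x (u ∙ γ k) ≈ (u ∙ γ k) ⁻¹
      go _ (inj₁ q) _ (inj₁ σ) = inj₁ (same q σ k)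
      go _ (inj₁ q) (inj₁ r) (inj₂ σ) =
        contradiction (∙-cancelˡ u _ _ (trans (sym r) (opposite q σ (+ 1)))) γ1≉γ-1
      go (inj₁ cent) (inj₁ q) (inj₂ r) (inj₂ σ) = inj₂ (trans (opposite q σ k)
        (trans (∙-congʳ (∙-cancelʳ b _ _ (trans (sym (opposite q σ (+ 1))) (trans r (cent⁻¹ cent (+ 1))))))
               (sym (cent⁻¹ cent k))))
      go (inj₂ flip) (inj₁ q) (inj₂ r) (inj₂ σ) =
        contradiction (trans (sym (opposite q σ (+ 1))) (trans r (flip⁻¹ flip (+ 1)))) (no-square flip)
      go (inj₁ cent) (inj₂ q) _ (inj₂ σ) = inj₂ (trans (opposite q σ k) (sym (cent⁻¹ cent k)))
      go (inj₁ cent) (inj₂ q) (inj₁ r) (inj₁ σ) = inj₁ (trans (same q σ k)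
        (∙-congʳ (∙-cancelʳ a _ _ (trans (sym (same q σ (+ 1))) r))))
      go (inj₁ cent) (inj₂ q) (inj₂ r) (inj₁ σ) = contradiction
        (∙-cancelˡ (u ⁻¹) _ _ (trans (sym (same q σ (+ 1))) (trans r (cent⁻¹ cent (+ 1))))) γ1≉γ-1
      go (inj₂ flip) (inj₂ q) _ (inj₁ σ) = inj₂ (trans (same q σ k) (sym (flip⁻¹ flip k)))
      go (inj₂ flip) (inj₂ q) (inj₂ r) (inj₂ σ) = contradiction
        (∙-cancelˡ (u ⁻¹) _ _ (trans (sym (trans r (flip⁻¹ flip (+ 1)))) (opposite q σ (+ 1)))) γ1≉γ-1
      go (inj₂ flip) (inj₂ q) (inj₁ r) (inj₂ σ) = contradiction
        (trans (sym (opposite q σ (+ 1))) (trans r (∙-congʳ (sym (⁻¹-involutive u))))) (no-square (flip-⁻¹ flip))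

    -- `g` is the quotient of the first two marks, both of which are fixed.
    ¬norm⇒fixed : ∀ p → ¬ Norm (t p) → Fixed (t p) × Fixed g
    ¬norm⇒fixed p ¬norm = fixed₀ , fixed-resp
      (trans (\\-leftDividesʳ (t p) (γ (+ 1))) (pow-1 g)) (fixed-∙ (fixed-⁻¹ fixed₀) fixed₁)
      where
      fixed₀ : Fixed (t p)
      fixed₀ x = [ (λ q → q) , (λ (norm , _) → contradiction norm ¬norm) ]′ (δ-mark₀ p x)
      fixed₁ : Fixed (t p ∙ γ (+ 1))
      fixed₁ x = [ (λ q → q) , (λ (norm , _) → contradiction norm ¬norm) ]′ (δ-mark₁ p x)

    fixed-γ : Fixed g → ∀ a → Fixed (γ a)
    fixed-γ fix a x = [ (λ p → p a) , (λ p → contradiction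
      (trans (pow-1 g) (trans (sym (fix x)) (trans (δ-cong refl (sym (pow-1 g))) (p (+ 1))))) γ1≉γ-1) ]′ (δ-γ x)

    norm-γ∙γ : ∀ {s u} a b → s ≈ γ a ∙ u ∙ γ b → Norm s → Norm u
    norm-γ∙γ {s} {u} a b eq norm = norm-resp
      (trans (∙-cong (∙-congˡ eq) refl) (solve 3 (λ a u b → ⊝ a ⊕ (a ⊕ u ⊕ b) ⊕ ⊝ b ⊜ u) refl (γ a) u (γ b)))
      (norm-∙ (norm-∙ (norm-⁻¹ (inj₁ (γ-cent a))) norm) (norm-⁻¹ (inj₁ (γ-cent b))))

    signed-double : ∀ {s} p a b → s ≈ γ a ∙ t p ∙ γ b → Norm s → Signed s
    signed-double {s} p a b eq norm = signed-resp (sym (proj₂ (normal (norm-γ∙γ a b eq norm))))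
                                        (norm⇒signed p (norm-γ∙γ a b eq norm) (proj₁ (normal (norm-γ∙γ a b eq norm))))
      where
      merge : ∀ a′ → t p ∙ γ a′ ≈ γ a ∙ t p → s ≈ t p ∙ γ (a′ ℤ.+ b)
      merge a′ q = trans eq (trans (∙-congʳ (sym q)) (trans (assoc _ _ _) (∙-congˡ (sym (pow-+ g a′ b)))))
      normal : Norm (t p) → ∃ λ k → s ≈ t p ∙ γ k
      normal (inj₁ cent) = a ℤ.+ b , merge a (cent-γ cent a)
      normal (inj₂ flip) = ℤ.- a ℤ.+ b , merge (ℤ.- a)
        (trans (flip-γ flip (ℤ.- a)) (∙-congʳ (reflexive (≡.cong γ (ℤ.neg-involutive a)))))

    covered-signed : ∀ {h} → Covered F h → Norm h → Signed h
    covered-signed (inj₁ (a , h≈γa)) _ = signed-resp (sym h≈γa) (λ x →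
      [ (λ p → inj₁ (p a)) , (λ p → inj₂ (trans (p a) (pow-neg g a))) ]′ (δ-γ x))
    covered-signed (inj₂ (p , a , b , inj₁ eq)) norm = signed-double p a b eq norm
    covered-signed {h} (inj₂ (p , a , b , inj₂ eq)) norm = signed-resp (⁻¹-involutive h) (signed-⁻¹
      (signed-double p (ℤ.- b) (ℤ.- a)
        (trans (⁻¹-cong eq) (trans (solve 3 (λ a t b → ⊝ (a ⊕ ⊝ t ⊕ b) ⊜ ⊝ b ⊕ t ⊕ ⊝ a) refl (γ a) (t p) (γ b))
          (sym (∙-cong (∙-congʳ (pow-neg g b)) (pow-neg g a)))))
        (norm-⁻¹ norm)))

    covered-fixed : ∀ {h} → Covered F h → ¬ Norm h → Fixed h × Fixed g
    covered-fixed (inj₁ (a , h≈γa)) ¬norm = contradiction (norm-resp (sym h≈γa) (inj₁ (γ-cent a))) ¬norm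
    covered-fixed {h} (inj₂ (p , a , b , eq)) ¬norm = go eq
      where
      norm-h : ∀ {u} → h ≈ γ a ∙ u ∙ γ b → Norm u → Norm h
      norm-h q norm = norm-resp (sym q) (norm-∙ (norm-∙ (inj₁ (γ-cent a)) norm) (inj₁ (γ-cent b)))
      fixed-h : ∀ {u} → h ≈ γ a ∙ u ∙ γ b → Fixed g → Fixed u → Fixed h
      fixed-h q fix-g fix-u = fixed-resp (sym q) (fixed-∙ (fixed-∙ (fixed-γ fix-g a) fix-u) (fixed-γ fix-g b))
      go : h ≈ γ a ∙ t p ∙ γ b ⊎ h ≈ γ a ∙ t p ⁻¹ ∙ γ b → Fixed h × Fixed g
      go (inj₁ q) = let (ft , fg) = ¬norm⇒fixed p (¬norm ∘ norm-h q) in fixed-h q fg ft , fg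
      go (inj₂ q) = let (ft , fg) = ¬norm⇒fixed p (¬norm ∘ norm-h q ∘ norm-⁻¹) in fixed-h q fg (fixed-⁻¹ ft) , fg

-- Triangles, balls and the action on cosets of `C`

private
  54n≡ : ∀ n → 2 ℕ.* n ℕ.+ 2 ℕ.* (13 ℕ.* n) ℕ.+ 2 ℕ.* (13 ℕ.* n) ≡ 54 ℕ.* n
  54n≡ = ℕ-Ring.solve-∀

  x-k-[y-k]≡x-y : ∀ x y k → (x ℤ.- k) ℤ.- (y ℤ.- k) ≡ x ℤ.- y
  x-k-[y-k]≡x-y = ℤ-Ring.solve-∀

module Symmetries (em : ∀ {a} → ExcludedMiddle a) {c ℓ} (G : Group c ℓ) (g : Group.Carrier G)
  (n : ℕ) (1≤n : 1 ℕ.≤ n) (N : ℕ) (large : Large n N) (g-order : NoSmallPower G g N)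
  {m : ℕ} (m≤n : m ℕ.≤ n) (F : Frames.Frame em G g n 1≤n N large g-order m) where
  open Group G
  open Power G
  open Cyclic G g N g-order
  open Frames em G g n 1≤n N large g-order
  open Marks m≤n F
  open GroupProperties G
  open GroupSolver G using (solve; _⊜_; _⊕_; ⊝_)

  -- A marked edge lies on at most `12n` triangles, so `13n` is a separating threshold. Twice the
  -- threshold as segment length lets every segment edge reach it.
  L M : ℕ
  L = 13 ℕ.* n
  M = 2 ℕ.* L

  bound-M : (2 ℕ.+ M) ℕ.+ M ℕ.< N
  bound-M = begin-strict
    2 ℕ.+ M ℕ.+ M                   ≤⟨ ℕ.+-monoˡ-≤ M (ℕ.+-monoˡ-≤ M (ℕ.*-monoʳ-≤ 2 1≤n)) ⟩
    2 ℕ.* n ℕ.+ M ℕ.+ M             ≡⟨ 54n≡ n ⟩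
    54 ℕ.* n                        ≤⟨ ℕ.*-monoˡ-≤ n {54} {384} (ℕ.m≤m+n 54 330) ⟩
    384 ℕ.* n                       ≡⟨ ℕ.*-assoc 48 8 n ⟩
    48 ℕ.* V                        ≤⟨ ℕ.*-monoʳ-≤ 48 (ℕ.≤-trans (ℕ.m≤m*n V V) (ℕ.m≤m*n (V ℕ.* V) V)) ⟩
    48 ℕ.* (V ℕ.* V ℕ.* V)          <⟨ large ⟩
    N                               ∎
    where
    open ℕ.≤-Reasoning
    V = 8 ℕ.* n
    instance
      V≢0 : ℕ.NonZero V
      V≢0 = ℕ.>-nonZero (ℕ.≤-trans 1≤n (ℕ.m≤n*m n 8))

  1≤M : 1 ℕ.≤ M
  1≤M = ℕ.≤-trans 1≤n (ℕ.≤-trans (ℕ.m≤n*m n 13) (ℕ.m≤n*m L 2))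

  Segment Ball Connection : Carrier → Set ℓ
  Ball u       = ∃ λ z → ∣ z ∣ ℕ.≤ M × u ≈ γ z
  Segment u    = ∃ λ z → ¬ z ≡ + 0 × ∣ z ∣ ℕ.≤ M × u ≈ γ z
  Connection u = Segment u ⊎ Marked u

  segment-resp : ∀ {u v} → u ≈ v → Segment u → Segment v
  segment-resp u≈v (z , z≢0 , z≤ , eq) = z , z≢0 , z≤ , trans (sym u≈v) eq

  ball-resp : ∀ {u v} → u ≈ v → Ball u → Ball v
  ball-resp u≈v (z , z≤ , eq) = z , z≤ , trans (sym u≈v) eq

  connection-resp : ∀ {u v} → u ≈ v → Connection u → Connection v
  connection-resp u≈v (inj₁ p) = inj₁ (segment-resp u≈v p)
  connection-resp u≈v (inj₂ p) = inj₂ (Marked-resp u≈v p)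

  connection-⁻¹ : ∀ {u} → Connection u → Connection (u ⁻¹)
  connection-⁻¹ (inj₁ (z , z≢0 , z≤ , eq)) = inj₁
    ( ℤ.- z , (λ -z≡0 → z≢0 (≡.trans (≡.sym (ℤ.neg-involutive z)) (≡.cong ℤ.-_ -z≡0)))
    , ℕ.≤-trans (ℕ.≤-reflexive (ℤ.∣-i∣≡∣i∣ z)) z≤ , trans (⁻¹-cong eq) (sym (pow-neg g z)) )
  connection-⁻¹ (inj₂ p) = inj₂ (Marked-⁻¹ p)

  ball-bound : ∀ {a b} → a ℕ.≤ 2 ℕ.+ M → b ℕ.≤ M → a ℕ.+ b ℕ.< N
  ball-bound a≤ b≤ = ℕ.≤-<-trans (ℕ.+-mono-≤ a≤ b≤) bound-M

  γ-injective-ball : ∀ i j → ∣ i ∣ ℕ.≤ 2 ℕ.+ M → ∣ j ∣ ℕ.≤ M → γ i ≈ γ j → i ≡ j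
  γ-injective-ball i j i≤ j≤ = γ-injective-bounded i j i≤ j≤ bound-M

  ε∉Connection : ¬ Connection ε
  ε∉Connection (inj₁ (z , z≢0 , z≤ , eq)) = z≢0 (≡.sym (γ-injective-ball (+ 0) z z≤n z≤ eq))
  ε∉Connection (inj₂ p) = marked-outside p (+ 0 , refl)

  -- The inverse map is part of the data so that each preservation statement can be reversed by
  -- `flip`.
  record Symmetry : Set (c ⊔ ℓ) where
    field
      to from   : Carrier → Carrier
      to-cong   : ∀ {x y} → x ≈ y → to x ≈ to y
      from-cong : ∀ {x y} → x ≈ y → from x ≈ from y
      to-from   : ∀ y → to (from y) ≈ y
      from-to   : ∀ x → from (to x) ≈ x
      to-edge   : ∀ x y → Connection (x ⁻¹ ∙ y) → Connection (to x ⁻¹ ∙ to y)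
      from-edge : ∀ x y → Connection (x ⁻¹ ∙ y) → Connection (from x ⁻¹ ∙ from y)

    cocycle : Cocycle G
    cocycle = record
      { δ      = λ x h → to x ⁻¹ ∙ to (x ∙ h)
      ; δ-cong = λ x≈y h≈k → ∙-cong (⁻¹-cong (to-cong x≈y)) (to-cong (∙-cong x≈y h≈k))
      ; δ-∙    = λ x h k → trans (∙-congˡ (to-cong (sym (assoc x h k))))
          (solve 3 (λ a b c → ⊝ a ⊕ c ⊜ ⊝ a ⊕ b ⊕ (⊝ b ⊕ c)) refl (to x) (to (x ∙ h)) (to (x ∙ h ∙ k)))
      }
    open Cocycle cocycle public using (δ; δ-cong; δ-∙; δ-ε)

    δ-quotient : ∀ x u v → δ x u ⁻¹ ∙ δ x v ≈ δ (x ∙ u) (u ⁻¹ ∙ v)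
    δ-quotient x u v = trans (∙-congˡ (trans (δ-cong refl (sym (\\-leftDividesˡ u v))) (δ-∙ x u (u ⁻¹ ∙ v))))
      (\\-leftDividesʳ (δ x u) _)

    δ-connection : ∀ {x h} → Connection h → Connection (δ x h)
    δ-connection {x} {h} p = to-edge x (x ∙ h) (connection-resp (sym (\\-leftDividesʳ x h)) p)

  flip : Symmetry → Symmetry
  flip σ = record
    { to = from ; from = to ; to-cong = from-cong ; from-cong = to-cong
    ; to-from = from-to ; from-to = to-from ; to-edge = from-edge ; from-edge = to-edge }
    where open Symmetry σ

  undo : ∀ σ x h → Symmetry.δ (flip σ) (Symmetry.to σ x) (Symmetry.δ σ x h) ≈ h
  undo σ x h = trans (∙-cong (⁻¹-cong (from-to x)) (trans (from-cong (\\-leftDividesˡ (to x) _)) (from-to (x ∙ h))))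
    (\\-leftDividesʳ x h)
    where open Symmetry σ

  -- The common neighbours of `1` and `u`: at least `L` triangles lie on this edge.
  Many : Carrier → Set (c ⊔ ℓ)
  Many u = ∃ λ (f : Fin L → Carrier) → (∀ {a b} → f a ≈ f b → a ≡ b) ×
           (∀ a → Connection (f a) × Connection (u ⁻¹ ∙ f a))

  δ-injective : ∀ σ x {h k} → Symmetry.δ σ x h ≈ Symmetry.δ σ x k → h ≈ k
  δ-injective σ x {h} {k} p = trans (sym (undo σ x h)) (trans (Symmetry.δ-cong (flip σ) refl p) (undo σ x k))

  δ-many : ∀ σ {x u} → Many u → Many (Symmetry.δ σ x u)
  δ-many σ {x} {u} (f , f-inj , conn) = (λ a → δ x (f a)) , (λ p → f-inj (δ-injective σ x p)) ,
    λ a → δ-connection (proj₁ (conn a)) , connection-resp (sym (δ-quotient x u (f a))) (δ-connection (proj₂ (conn a)))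
    where open Symmetry σ

  side : Fin 2 → Carrier → Carrier
  side zero       x = x
  side (suc zero) x = x ⁻¹

  value : Fin (m ℕ.* (3 ℕ.* 2)) → Carrier
  value i = at (proj₁ pj) (remQuot {3} 2 (proj₂ pj))
    where
    pj = remQuot (3 ℕ.* 2) i
    at : Fin m → Fin 3 × Fin 2 → Carrier
    at p (k , s) = side s (mark p k)

  value-combine : ∀ p k s → value (combine p (combine k s)) ≡ side s (mark p k)
  value-combine p k s = ≡.trans
    (≡.cong (λ pj → side (proj₂ (remQuot {3} 2 (proj₂ pj))) (mark (proj₁ pj) (proj₁ (remQuot {3} 2 (proj₂ pj)))))
      (Fin.remQuot-combine {m} {3 ℕ.* 2} p (combine k s)))
    (≡.cong (λ ks → side (proj₂ ks) (mark p (proj₁ ks))) (Fin.remQuot-combine {3} {2} k s))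

  marked-value : ∀ {u} → Marked u → ∃ λ i → u ≈ value i
  marked-value (p , k , inj₁ eq) = _ , trans eq (reflexive (≡.sym (value-combine p k zero)))
  marked-value (p , k , inj₂ eq) = _ , trans eq (reflexive (≡.sym (value-combine p k (suc zero))))

  -- A triangle with a marked side has a second one, since otherwise `u` would be a quotient of
  -- powers of `g`. The third vertex is therefore a marked element or `u` times one, which leaves at
  -- most `6m + 6m ≤ 12n` choices.
  marked-few : ∀ {u} → Marked u → ¬ Many u
  marked-few {u} Mu (f , f-inj , conn) =
    let (a , b , a<b , eq) = Fin.pigeonhole K<L (λ a → proj₁ (code a)) in
    Fin.<⇒≢ a<b (f-inj (trans (proj₂ (code a)) (trans (reflexive (≡.cong decode eq)) (sym (proj₂ (code b))))))
    where
    K = m ℕ.* (3 ℕ.* 2)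
    K<L : K ℕ.+ K ℕ.< L
    K<L = begin-strict
      K ℕ.+ K                             ≤⟨ ℕ.+-mono-≤ K≤6n K≤6n ⟩
      n ℕ.* 6 ℕ.+ n ℕ.* 6                 ≡⟨ ℕ.*-distribˡ-+ n 6 6 ⟨
      n ℕ.* 12                            ≡⟨ ℕ.*-comm n 12 ⟩
      12 ℕ.* n                            <⟨ ℕ.*-monoˡ-< n ⦃ ℕ.>-nonZero 1≤n ⦄ {12} {13} ℕ.≤-refl ⟩
      13 ℕ.* n                            ∎
      where
      open ℕ.≤-Reasoning
      K≤6n : K ℕ.≤ n ℕ.* 6
      K≤6n = ℕ.*-monoˡ-≤ 6 m≤n
    decode : Fin (K ℕ.+ K) → Carrier
    decode i = [ value , (λ j → u ∙ value j) ]′ (splitAt K i)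
    code : ∀ a → ∃ λ i → f a ≈ decode i
    code a = go (proj₁ (conn a)) (proj₂ (conn a))
      where
      left : ∀ i → f a ≈ value i → f a ≈ decode (i ↑ˡ K)
      left i p rewrite Fin.splitAt-↑ˡ K i K = p
      right : ∀ i → f a ≈ u ∙ value i → f a ≈ decode (K ↑ʳ i)
      right i p rewrite Fin.splitAt-↑ʳ K K i = p
      go : Connection (f a) → Connection (u ⁻¹ ∙ f a) → ∃ λ i → f a ≈ decode i
      go (inj₂ p) _ = let (i , eq) = marked-value p in i ↑ˡ K , left i eq
      go (inj₁ _) (inj₂ p) = let (i , eq) = marked-value p in
        K ↑ʳ i , right i (trans (sym (\\-leftDividesˡ u (f a))) (∙-congˡ eq))
      go (inj₁ (y , _ , _ , p)) (inj₁ (z , _ , _ , q)) = contradiction (y ℤ.- z , trans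
        (solve 2 (λ u f → u ⊜ f ⊕ ⊝ (⊝ u ⊕ f)) refl u (f a)) (trans (∙-cong p (⁻¹-cong q)) (sym (pow-- g y z))))
        (marked-outside Mu)

  Offsets : ℤ → Set
  Offsets z = ∃ λ (y : Fin L → ℤ) → (∀ {a b} → y a ≡ y b → a ≡ b) ×
    (∀ a → (¬ y a ≡ + 0 × ∣ y a ∣ ℕ.≤ M) × (¬ y a ≡ z × ∣ y a ℤ.- z ∣ ℕ.≤ M))

  -- For |z| ≤ L the offsets lie on the far side of 0 from z, otherwise between 0 and z.
  offsets : ∀ z → ¬ z ≡ + 0 → ∣ z ∣ ℕ.≤ M → Offsets z
  offsets (+ zero)  z≢0 _ = contradiction ≡.refl z≢0
  offsets (+ suc k) _ k≤M = positive k k≤M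
    where
    positive : ∀ k → suc k ℕ.≤ M → Offsets (+ suc k)
    positive k k≤M with suc k ℕ.≤? L
    ... | yes k≤L = (λ a → -[1+ toℕ a ]) , (λ p → Fin.toℕ-injective (ℤ.-[1+-injective p)) ,
          λ a → ((λ ()) , ℕ.≤-trans (Fin.toℕ<n a) (ℕ.m≤n*m L 2)) ,
                ((λ ()) , ∣-∣-mono -[1+ toℕ a ] (+ suc k) (Fin.toℕ<n a)
                  (ℕ.≤-trans k≤L (ℕ.≤-reflexive (≡.sym (ℕ.+-identityʳ L)))))
    ... | no k≰L = (λ a → + suc (toℕ a)) , (λ p → Fin.toℕ-injective (ℕ.suc-injective (ℤ.+-injective p))) ,
          λ a → ((λ ()) , ℕ.≤-trans (Fin.toℕ<n a) (ℕ.m≤n*m L 2)) ,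
                ((λ p → ℕ.<⇒≢ (ℕ.≤-<-trans (Fin.toℕ<n a) (ℕ.≰⇒> k≰L)) (ℤ.+-injective p)) ,
                 ℕ.≤-trans (ℤ.∣m⊝n∣≤m⊔n (suc (toℕ a)) (suc k))
                   (ℕ.⊔-lub (ℕ.≤-trans (Fin.toℕ<n a) (ℕ.m≤n*m L 2)) k≤M))
  offsets -[1+ k ] z≢0 k≤M with offsets (+ suc k) (λ ()) k≤M
  ... | y , y-inj , bounds = (λ a → ℤ.- y a) , (λ p → y-inj (ℤ.neg-injective p)) ,
        λ a → let ((y≢0 , y≤) , (y≢z , y-z≤)) = bounds a in
          ((λ p → y≢0 (ℤ.neg-injective p)) , ℕ.≤-trans (ℕ.≤-reflexive (ℤ.∣-i∣≡∣i∣ (y a))) y≤) ,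
          ((λ p → y≢z (ℤ.neg-injective p)) ,
           ℕ.≤-trans (ℕ.≤-reflexive (≡.trans (≡.cong ∣_∣ (≡.sym (ℤ.neg-distrib-+ (y a) -[1+ k ])))
                                              (ℤ.∣-i∣≡∣i∣ (y a ℤ.- + suc k)))) y-z≤)

  segment-many : ∀ {u} → Segment u → Many u
  segment-many {u} (z , z≢0 , z≤ , u≈γz) = let (y , y-inj , bounds) = offsets z z≢0 z≤ in
    (λ a → γ (y a))
    , (λ {a} {b} p → y-inj (γ-injective-ball (y a) (y b)
        (ℕ.≤-trans (proj₂ (proj₁ (bounds a))) (ℕ.m≤n+m M 2)) (proj₂ (proj₁ (bounds b))) p))
    , λ a → let ((y≢0 , y≤) , (y≢z , y-z≤)) = bounds a in
        inj₁ (y a , y≢0 , y≤ , refl) ,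
        inj₁ (y a ℤ.- z , (λ p → y≢z (ℤ.i-j≡0⇒i≡j (y a) z p)) , y-z≤ , (begin
          u ⁻¹ ∙ γ (y a)         ≈⟨ ∙-congʳ (trans (⁻¹-cong u≈γz) (sym (pow-neg g z))) ⟩
          γ (ℤ.- z) ∙ γ (y a)    ≈⟨ pow-comm g (ℤ.- z) (y a) ⟩
          γ (y a) ∙ γ (ℤ.- z)    ≈⟨ pow-+ g (y a) (ℤ.- z) ⟨
          γ (y a ℤ.- z)          ∎))
    where open SetoidReasoning setoid

  δ-segment : ∀ σ {x u} → Segment u → Segment (Symmetry.δ σ x u)
  δ-segment σ {x} {u} p = [ (λ q → q) , (λ q → contradiction (δ-many σ (segment-many p)) (marked-few q)) ]′
    (Symmetry.δ-connection σ (inj₁ p))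

  δ-segment⁻ : ∀ σ {x u} → Segment (Symmetry.δ σ x u) → Segment u
  δ-segment⁻ σ {x} {u} p = segment-resp (undo σ x u) (δ-segment (flip σ) p)

  δ-marked : ∀ σ {x u} → Marked u → Marked (Symmetry.δ σ x u)
  δ-marked σ {x} {u} p = [ (λ q → let (z , _ , _ , u≈γz) = δ-segment⁻ σ q in
      contradiction (z , u≈γz) (marked-outside p)) , (λ q → q) ]′ (Symmetry.δ-connection σ (inj₂ p))

  δ-ball : ∀ σ {x u} → Ball u → Ball (Symmetry.δ σ x u)
  δ-ball σ {x} {u} (z , z≤ , u≈γz) with z ℤ.≟ + 0
  ... | yes ≡.refl = + 0 , z≤n , trans (δ-cong refl u≈γz) (δ-ε x)
    where open Symmetry σ
  ... | no z≢0 = let (w , _ , w≤ , eq) = δ-segment σ {x} (z , z≢0 , z≤ , u≈γz) in w , w≤ , eq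

  δ-ball⁻ : ∀ σ {x u} → Ball (Symmetry.δ σ x u) → Ball u
  δ-ball⁻ σ {x} {u} p = ball-resp (undo σ x u) (δ-ball (flip σ) p)

  boundary : ∀ {h} → Ball (γ (+ 1) ⁻¹ ∙ h) → ¬ Ball h → h ≈ γ (+ suc M)
  boundary {h} (y , y≤ , eq) h∉ = go y y≤ eq′
    where
    eq′ : h ≈ γ (+ 1 ℤ.+ y)
    eq′ = trans (sym (\\-leftDividesˡ (γ (+ 1)) h)) (trans (∙-congˡ eq) (sym (pow-+ g (+ 1) y)))
    go : ∀ y → ∣ y ∣ ℕ.≤ M → h ≈ γ (+ 1 ℤ.+ y) → h ≈ γ (+ suc M)
    go (+ y) y≤ eq with suc y ℕ.≤? M
    ... | yes y<M = contradiction (+ suc y , y<M , eq) h∉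
    ... | no y≮M = trans eq (reflexive (≡.cong (λ k → γ (+ suc k)) (ℕ.≤-antisym y≤ (ℕ.≮⇒≥ y≮M))))
    go -[1+ zero ]  y≤ eq = contradiction (+ 0 , z≤n , eq) h∉
    go -[1+ suc y ] y≤ eq = contradiction (-[1+ y ] , ℕ.≤-trans (ℕ.n≤1+n _) y≤ , eq) h∉

  module _ (σ : Symmetry) where
    open Symmetry σ

    -- The ball around γ k meets the complement of the ball around 1 in |k| points, and
    -- this number is preserved.
    no-two-boundary : ∀ {x} k w₁ w₂ → ¬ w₁ ≡ w₂ → δ x (γ (+ 1)) ≈ γ k →
      (∀ w → w ≡ w₁ ⊎ w ≡ w₂ → M ℕ.< ∣ w ∣ × ∣ w ∣ ℕ.≤ 2 ℕ.+ M × ∣ w ℤ.- k ∣ ℕ.≤ M) → ⊥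
    no-two-boundary {x} k w₁ w₂ w₁≢w₂ δγ≈γk bounds = w₁≢w₂
      (γ-injective w₁ w₂ w₁-w₂< (δ-injective (flip σ) (to x)
        (trans (at w₁ (inj₁ ≡.refl)) (sym (at w₂ (inj₂ ≡.refl))))))
      where
      open Symmetry (flip σ) using () renaming (δ to δ′; δ-cong to δ′-cong; δ-quotient to δ′-quotient)
      w₁-w₂< : ∣ w₁ ℤ.- w₂ ∣ ℕ.< N
      w₁-w₂< = ℕ.≤-<-trans (≡.subst (λ i → ∣ i ∣ ℕ.≤ M ℕ.+ M) (x-k-[y-k]≡x-y w₁ w₂ k)
          (∣-∣-mono (w₁ ℤ.- k) (w₂ ℤ.- k)
            (proj₂ (proj₂ (bounds w₁ (inj₁ ≡.refl)))) (proj₂ (proj₂ (bounds w₂ (inj₂ ≡.refl))))))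
        (ball-bound (ℕ.m≤n+m M 2) ℕ.≤-refl)
      -- Pulled back, `γ w` lies in the ball around `γ (+ 1)` and outside the ball around 1, where
      -- there is only one point.
      at : ∀ w → w ≡ w₁ ⊎ w ≡ w₂ → δ′ (to x) (γ w) ≈ γ (+ suc M)
      at w w≡ = boundary
        (ball-resp (trans (sym (δ′-quotient (to x) (γ k) (γ w)))
            (∙-congʳ (⁻¹-cong (trans (δ′-cong refl (sym δγ≈γk)) (undo σ x (γ (+ 1)))))))
          (δ-ball (flip σ) (w ℤ.- k , w-k≤ , trans (∙-congʳ (sym (pow-neg g k)))
            (trans (pow-comm g (ℤ.- k) w) (sym (pow-+ g w (ℤ.- k)))))))
        (λ p → w∉ (δ-ball⁻ (flip σ) p))
        where
        w-k≤ = proj₂ (proj₂ (bounds w w≡))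
        w∉ : ¬ Ball (γ w)
        w∉ (y , y≤ , eq) = ℕ.<⇒≱ (proj₁ (bounds w w≡))
          (≡.subst (λ i → ∣ i ∣ ℕ.≤ M) (≡.sym (γ-injective-ball w y (proj₁ (proj₂ (bounds w w≡))) y≤ eq)) y≤)

    δ-γ1 : ∀ x → δ x (γ (+ 1)) ≈ γ (+ 1) ⊎ δ x (γ (+ 1)) ≈ γ (ℤ.- + 1)
    δ-γ1 x = let (k , k≢0 , k≤ , eq) = δ-segment σ {x} (+ 1 , (λ ()) , 1≤M , refl) in go k k≢0 k≤ eq
      where
      gap : ∀ a k → 2 ℕ.≤ k → k ℕ.≤ a → a ℕ.≤ 2 ℕ.+ M → ∣ + a ℤ.- + k ∣ ℕ.≤ M
      gap a k 2≤k k≤a a≤ = begin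
        ∣ + a ℤ.- + k ∣   ≡⟨ ≡.cong ∣_∣ (≡.trans (ℤ.[+m]-[+n]≡m⊖n a k) (ℤ.⊖-≥ k≤a)) ⟩
        a ℕ.∸ k           ≤⟨ ℕ.∸-mono a≤ 2≤k ⟩
        M                 ∎
        where open ℕ.≤-Reasoning
      gap₁ : ∀ k → 2 ℕ.+ k ℕ.≤ M → ∣ + (1 ℕ.+ M) ℤ.- + (2 ℕ.+ k) ∣ ℕ.≤ M
      gap₁ k k≤ = gap (1 ℕ.+ M) (2 ℕ.+ k) (s≤s (s≤s z≤n)) (ℕ.m≤n⇒m≤1+n k≤) (ℕ.n≤1+n _)
      gap₂ : ∀ k → 2 ℕ.+ k ℕ.≤ M → ∣ + (2 ℕ.+ M) ℤ.- + (2 ℕ.+ k) ∣ ℕ.≤ M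
      gap₂ k k≤ = gap (2 ℕ.+ M) (2 ℕ.+ k) (s≤s (s≤s z≤n)) (ℕ.m≤n⇒m≤1+n (ℕ.m≤n⇒m≤1+n k≤)) ℕ.≤-refl
      go : ∀ k → ¬ k ≡ + 0 → ∣ k ∣ ℕ.≤ M → δ x (γ (+ 1)) ≈ γ k →
           δ x (γ (+ 1)) ≈ γ (+ 1) ⊎ δ x (γ (+ 1)) ≈ γ (ℤ.- + 1)
      go (+ 0)    k≢0 _ _  = contradiction ≡.refl k≢0
      go (+ 1)    _   _ eq = inj₁ eq
      go -[1+ 0 ] _   _ eq = inj₂ eq
      -- At distance at least 2 the shifted ball contains both exponents `M + 1` and `M + 2`.
      go (+ suc (suc k)) _ k≤ eq = ⊥-elim (no-two-boundary (+ (2 ℕ.+ k)) (+ (1 ℕ.+ M)) (+ (2 ℕ.+ M))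
        (ℕ.<⇒≢ ℕ.≤-refl ∘ ℤ.+-injective) eq λ
        { w (inj₁ ≡.refl) → ℕ.≤-refl , ℕ.n≤1+n _ , gap₁ k k≤
        ; w (inj₂ ≡.refl) → ℕ.n≤1+n _ , ℕ.≤-refl , gap₂ k k≤ })
      go -[1+ suc k ] _ k≤ eq = ⊥-elim (no-two-boundary -[1+ 1 ℕ.+ k ] -[1+ M ] -[1+ 1 ℕ.+ M ]
        (ℕ.<⇒≢ ℕ.≤-refl ∘ ℤ.-[1+-injective) eq λ
        { w (inj₁ ≡.refl) → ℕ.≤-refl , ℕ.n≤1+n _ ,
            ≡.subst (ℕ._≤ M) (ℤ.∣i-j∣≡∣j-i∣ (+ (1 ℕ.+ M)) (+ (2 ℕ.+ k))) (gap₁ k k≤)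
        ; w (inj₂ ≡.refl) → ℕ.n≤1+n _ , ℕ.≤-refl ,
            ≡.subst (ℕ._≤ M) (ℤ.∣i-j∣≡∣j-i∣ (+ (2 ℕ.+ M)) (+ (2 ℕ.+ k))) (gap₂ k k≤) })

    δ-g : ∀ x → δ x g ≈ g ⊎ δ x g ≈ g ⁻¹
    δ-g x = [ (λ p → inj₁ (trans g≈ (trans p (pow-1 g))))
            , (λ p → inj₂ (trans g≈ (trans p (⁻¹-cong (pow-1 g))))) ]′ (δ-γ1 x)
      where
      g≈ : δ x g ≈ δ x (γ (+ 1))
      g≈ = δ-cong refl (sym (pow-1 g))

    gg≉ε : ¬ (g ∙ g ≈ ε)
    gg≉ε p = contradiction (γ-injective-ball (+ 2) (+ 0) (ℕ.m≤m+n 2 M) z≤n (trans (∙-congˡ (identityʳ g)) p)) (λ ())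

    -- A change of direction would fold the path `x`, `x g`, `x g²` onto itself, against
    -- injectivity. Thus the sign at `g` is constant along `x C`.
    opposite-signs : ∀ {x b} → δ x g ≈ b → δ (x ∙ g) g ≈ b ⁻¹ → ⊥
    opposite-signs {x} {b} p q = gg≉ε (δ-injective σ x (begin
      δ x (g ∙ g)              ≈⟨ δ-∙ x g g ⟩
      δ x g ∙ δ (x ∙ g) g      ≈⟨ ∙-cong p q ⟩
      b ∙ b ⁻¹                 ≈⟨ inverseʳ b ⟩
      ε                        ≈⟨ δ-ε x ⟨
      δ x ε                    ∎))
      where open SetoidReasoning setoid

    δ-g-next : ∀ {x b} → b ≈ g ⊎ b ≈ g ⁻¹ → δ x g ≈ b → δ (x ∙ g) g ≈ b
    δ-g-next {x} (inj₁ b≈) p = [ (λ q → trans q (sym b≈))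
      , (λ q → ⊥-elim (opposite-signs p (trans q (⁻¹-cong (sym b≈))))) ]′ (δ-g (x ∙ g))
    δ-g-next {x} (inj₂ b≈) p = [
        (λ q → ⊥-elim (opposite-signs p (trans q (trans (sym (⁻¹-involutive g)) (⁻¹-cong (sym b≈))))))
      , (λ q → trans q (sym b≈)) ]′ (δ-g (x ∙ g))

    δ-g-prev : ∀ {x b} → b ≈ g ⊎ b ≈ g ⁻¹ → δ (x ∙ g) g ≈ b → δ x g ≈ b
    δ-g-prev {x} (inj₁ b≈) p = [ (λ q → trans q (sym b≈))
      , (λ q → ⊥-elim (opposite-signs q (trans p (trans b≈ (sym (⁻¹-involutive g)))))) ]′ (δ-g x)
    δ-g-prev {x} (inj₂ b≈) p = [ (λ q → ⊥-elim (opposite-signs q (trans p b≈))) , (λ q → trans q (sym b≈)) ]′ (δ-g x)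

    -- The induction carries the sign at the current point as a second component, in both directions
    -- along the coset.
    δ-pow : ∀ x {b} → b ≈ g ⊎ b ≈ g ⁻¹ → δ x g ≈ b → ∀ i → δ x (γ i) ≈ pow b i
    δ-pow x {b} b≈ p = proj₁ ∘ ℤ-induction (λ i → δ x (γ i) ≈ pow b i × δ (x ∙ γ i) g ≈ b)
      (δ-ε x , trans (δ-cong (identityʳ x) refl) p)
      (λ i (q , r) → trans (δ-cong refl (pow-sucʳ g i)) (trans (δ-∙ x (γ i) g)
                       (trans (∙-cong q r) (sym (pow-sucʳ b i))))
                   , trans (δ-cong (trans (∙-congˡ (pow-sucʳ g i)) (sym (assoc _ _ _))) refl) (δ-g-next b≈ r))
      (λ i (q , r) → let s = δ-g-prev b≈ (trans (δ-cong (trans (assoc _ _ _) (∙-congˡ (pow-predʳ g i))) refl) r) in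
                     ∙-cancelʳ b _ _ (trans (∙-congˡ (sym s)) (trans (sym (δ-∙ x (γ (ℤ.pred i)) g))
                       (trans (δ-cong refl (pow-predʳ g i)) (trans q (sym (pow-predʳ b i)))))) , s)

    δ-γ : ∀ x → (∀ i → δ x (γ i) ≈ γ i) ⊎ (∀ i → δ x (γ i) ≈ γ (ℤ.- i))
    δ-γ x = [ (λ p → inj₁ (δ-pow x (inj₁ refl) p))
            , (λ p → inj₂ (λ i → trans (δ-pow x (inj₂ refl) p i) (pow-⁻¹ g i))) ]′ (δ-g x)

-- Finiteness from coverings

module FiniteCovers (em : ∀ {a} → ExcludedMiddle a) {a ℓ} (A : Setoid a ℓ) where
  open Setoid A

  -- Repetitions and values outside `P` are allowed, which makes unions easy; excluded middle thins
  -- a covering to an exact enumeration afterwards.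
  Covering : ∀ {p} → (Carrier → Set p) → Set (a ⊔ ℓ ⊔ p)
  Covering P = ∃₂ λ K (f : Fin K → Carrier) → ∀ x → P x → ∃ λ i → x ≈ f i

  covering-⊎ : ∀ {p q} {P : Carrier → Set p} {Q : Carrier → Set q} →
               Covering P → Covering Q → Covering (λ x → P x ⊎ Q x)
  covering-⊎ {P = P} {Q} (K , f , coversP) (L , g , coversQ) = K ℕ.+ L , h , covers
    where
    h : Fin (K ℕ.+ L) → Carrier
    h i = [ f , g ]′ (splitAt K i)
    left : ∀ {x} i → x ≈ f i → x ≈ h (i ↑ˡ L)
    left i p rewrite Fin.splitAt-↑ˡ K i L = p
    right : ∀ {x} i → x ≈ g i → x ≈ h (K ↑ʳ i)
    right i p rewrite Fin.splitAt-↑ʳ K L i = p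
    covers : ∀ x → P x ⊎ Q x → ∃ λ i → x ≈ h i
    covers x (inj₁ p) = let (i , eq) = coversP x p in i ↑ˡ L , left i eq
    covers x (inj₂ q) = let (i , eq) = coversQ x q in K ↑ʳ i , right i eq

  module _ {p} (S : Subset A p) where
    private
      Selection : ∀ {K} → (Fin K → Carrier) → Set (a ⊔ ℓ ⊔ p)
      Selection f = ∃₂ λ n (s : Fin n → Σ Carrier (_∈ S)) →
        (∀ {i j} → proj₁ (s i) ≈ proj₁ (s j) → i ≡ j) × (∀ i → f i ∈ S → ∃ λ j → f i ≈ proj₁ (s j))

      select : ∀ K (f : Fin K → Carrier) → Selection f
      select zero    f = 0 , (λ ()) , (λ {}) , λ ()
      select (suc K) f = let (n , s , s-inj , covers) = select K (f ∘ suc) in add s s-inj covers em em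
        where
        add : ∀ {n} (s : Fin n → Σ Carrier (_∈ S)) → (∀ {i j} → proj₁ (s i) ≈ proj₁ (s j) → i ≡ j) →
              (∀ i → f (suc i) ∈ S → ∃ λ j → f (suc i) ≈ proj₁ (s j)) →
              Dec (f zero ∈ S) → Dec (∃ λ j → f zero ≈ proj₁ (s j)) → Selection f
        add s s-inj covers (no ∉S) _ = _ , s , s-inj ,
          λ { zero p → contradiction p ∉S ; (suc i) → covers i }
        add s s-inj covers (yes _) (yes q) = _ , s , s-inj , λ { zero _ → q ; (suc i) → covers i }
        add s s-inj covers (yes ∈S) (no ¬q) = _ , s′ , s′-inj ,
          λ { zero _ → zero , refl ; (suc i) p → let (j , eq) = covers i p in suc j , eq }
          where
          s′ : Fin (suc _) → Σ Carrier (_∈ S)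
          s′ zero    = f zero , ∈S
          s′ (suc i) = s i
          s′-inj : ∀ {i j} → proj₁ (s′ i) ≈ proj₁ (s′ j) → i ≡ j
          s′-inj {zero}  {zero}  _ = ≡.refl
          s′-inj {zero}  {suc j} q = contradiction (j , q) ¬q
          s′-inj {suc i} {zero}  q = contradiction (i , sym q) ¬q
          s′-inj {suc i} {suc j} q = ≡.cong suc (s-inj q)

    covering⇒finite : Covering (_∈ S) → Finite (subsetSetoid S)
    covering⇒finite (K , f , covers) = let (n , s , s-inj , selects) = select K f in n , record
      { to = s
      ; cong = λ { ≡.refl → refl }
      ; bijective = s-inj , λ (x , x∈S) →
          let (i , x≈fi) = covers x x∈S
              (j , fi≈sj) = selects i (Subset.resp S x≈fi x∈S)
          in j , λ { ≡.refl → sym (trans x≈fi fi≈sj) }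
      }

-- The Cayley graph and its automorphisms

-- `8 ≤ q³` and `n ≤ q⁵` give `8n ≤ q⁸`, and the factor 48 is absorbed by `2⁶ ≤ q⁶`.
order-bound : ∀ q n → 2 ℕ.≤ q → n ℕ.≤ q ℕ.^ 5 → Large n (q ℕ.^ 36)
order-bound q n 2≤q n≤ = begin-strict
  48 ℕ.* (8 ℕ.* n ℕ.* (8 ℕ.* n) ℕ.* (8 ℕ.* n))   ≤⟨ ℕ.*-monoʳ-≤ 48 (ℕ.*-mono-≤ (ℕ.*-mono-≤ V≤ V≤) V≤) ⟩
  48 ℕ.* (q ℕ.^ 8 ℕ.* q ℕ.^ 8 ℕ.* q ℕ.^ 8)       ≡⟨ ≡.cong (λ x → 48 ℕ.* (x ℕ.* q ℕ.^ 8)) (ℕ.^-distribˡ-+-* q 8 8) ⟨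
  48 ℕ.* (q ℕ.^ 16 ℕ.* q ℕ.^ 8)                  ≡⟨ ≡.cong (48 ℕ.*_) (ℕ.^-distribˡ-+-* q 16 8) ⟨
  48 ℕ.* q ℕ.^ 24                                <⟨ ℕ.*-monoˡ-< (q ℕ.^ 24) ⦃ ℕ.m^n≢0 q 24 ⦄ (ℕ.m≤m+n 49 15) ⟩
  2 ℕ.^ 6 ℕ.* q ℕ.^ 24                           ≤⟨ ℕ.*-monoˡ-≤ (q ℕ.^ 24) (ℕ.^-monoˡ-≤ 6 2≤q) ⟩
  q ℕ.^ 6 ℕ.* q ℕ.^ 24                           ≡⟨ ℕ.^-distribˡ-+-* q 6 24 ⟨
  q ℕ.^ 30                                       ≤⟨ ℕ.^-monoʳ-≤ q (ℕ.m≤m+n 30 6) ⟩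
  q ℕ.^ 36                                       ∎
  where
  open ℕ.≤-Reasoning
  instance
    q≢0 : ℕ.NonZero q
    q≢0 = ℕ.>-nonZero (ℕ.≤-trans (s≤s z≤n) 2≤q)
  V≤ : 8 ℕ.* n ℕ.≤ q ℕ.^ 8
  V≤ = ℕ.≤-trans (ℕ.*-mono-≤ (ℕ.^-monoˡ-≤ 3 2≤q) n≤) (ℕ.≤-reflexive (≡.sym (ℕ.^-distribˡ-+-* q 3 5)))

module Construction (em : ∀ {a} → ExcludedMiddle a) {c ℓ} (G : Group c ℓ)
  (¬abelian : ¬ Abelian G) (¬dicyclic : ¬ IsGeneralizedDicyclic G)
  {r : ℕ} (1≤r : 1 ℕ.≤ r)
  (X : Fin r → Group.Carrier G) (X-generates : Generates G (Generation.image G X))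
  (g : Group.Carrier G) (g-order : NoSmallPower G g ((2 * r) ^ 36))
  where
  open Group G
  open Generation G
  open GroupProperties G
  open GroupSolver G using (solve; _⊜_; _⊕_; ⊝_)
  open Power G
  open Words G X

  -- `n` counts the padded words of length five, and so bounds the number of representatives.
  n N : ℕ
  n = suc r ℕ.^ 5
  N = (2 ℕ.* r) ℕ.^ 36

  1≤n : 1 ℕ.≤ n
  1≤n = ℕ.m^n>0 (suc r) 5

  1+r≤2r : suc r ℕ.≤ 2 ℕ.* r
  1+r≤2r = ℕ.≤-trans (ℕ.+-monoˡ-≤ r 1≤r) (ℕ.≤-reflexive (≡.cong (r ℕ.+_) (≡.sym (ℕ.+-identityʳ r))))

  large : Large n N
  large = order-bound (2 ℕ.* r) n (ℕ.*-monoʳ-≤ 2 1≤r) (ℕ.^-monoˡ-≤ 5 1+r≤2r)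

  open Cyclic G g N g-order
  open Frames em G g n 1≤n N large g-order

  framed = frame n (word 5)
  F = proj₁ (proj₂ (proj₂ framed))
  m≤n = proj₁ (proj₂ framed)

  open Marks m≤n F
  open Symmetries em G g n 1≤n N large g-order m≤n F

  4<N : 4 ℕ.< N
  4<N = ℕ.≤-<-trans (ℕ.≤-trans (ℕ.*-monoˡ-≤ 1 {4} {26} (ℕ.m≤m+n 4 22)) (ℕ.≤-trans (ℕ.*-monoʳ-≤ 26 1≤n)
          (ℕ.≤-reflexive (ℕ.*-assoc 2 13 n)))) (ℕ.≤-<-trans (ℕ.≤-trans (ℕ.m≤n+m M 2) (ℕ.m≤m+n (2 ℕ.+ M) M)) bound-M)

  word-covered : ∀ {h} → Word 5 h → Covered F h
  word-covered w = let (i , h≈) = word-covers w in covered-resp F (sym h≈) (proj₂ (proj₂ (proj₂ framed)) i)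

  S : Subset setoid (c ⊔ ℓ)
  S = record { Member = λ u → Lift (c ⊔ ℓ) (Connection u)
             ; resp   = λ u≈v (lift p) → lift (connection-resp u≈v p) }

  ε∉S : ε ∉ S
  ε∉S (lift p) = ε∉Connection p

  generated-subgroup : SubgroupPredicate (Generated G S)
  generated-subgroup = record { ε∈ = unit ; ∙∈ = mul ; ⁻¹∈ = inv ; resp∈ = resp }

  γ-generated : ∀ a → Generated G S (γ a)
  γ-generated = ℤ-induction (λ a → Generated G S (γ a)) unit
    (λ a p → resp (sym (pow-suc g a)) (mul g-generated p))
    (λ a p → resp (sym (pow-pred g a)) (mul (inv g-generated) p))
    where
    g-generated : Generated G S g
    g-generated = gen (lift (inj₁ (+ 1 , (λ ()) , 1≤M , sym (pow-1 g))))

  covered-generated : ∀ {h} → Covered F h → Generated G S h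
  covered-generated (inj₁ (a , p)) = resp (sym p) (γ-generated a)
  covered-generated (inj₂ (p , a , b , eq)) = [ double t-generated , double (inv t-generated) ]′ eq
    where
    t-generated : Generated G S (t p)
    t-generated = resp (identityʳ (t p)) (gen (lift (inj₂ (mark-marked p zero))))
    double : ∀ {h u} → Generated G S u → h ≈ γ a ∙ u ∙ γ b → Generated G S h
    double u∈ q = resp (sym q) (mul (mul (γ-generated a) u∈) (γ-generated b))

  S-generates : Generates G S
  S-generates h = generated-induction generated-subgroup
    (λ { (i , h≈Xi) → resp (sym h≈Xi) (covered-generated (word-covered (word-mono (s≤s z≤n) (letter-word i)))) })
    (X-generates h)

  -- The connection set is closed under inverses, so `S ∪ S⁻¹` adds no edges.
  edge⇒connection : ∀ {u} → u ∈ S ∪ inverses G S → Connection u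
  edge⇒connection (inj₁ (lift p)) = p
  edge⇒connection (inj₂ (s , lift p , u≈s⁻¹)) = connection-resp (sym u≈s⁻¹) (connection-⁻¹ p)

  open FiniteCovers em

  ball-covering : Covering setoid Segment
  ball-covering = suc M ℕ.+ suc M , (λ i → γ ([ (λ j → + toℕ j) , (λ j → ℤ.- + toℕ j) ]′ (splitAt (suc M) i))) ,
    λ u (z , _ , z≤ , u≈γz) → let (i , z≡) = index z z≤ in i , trans u≈γz (reflexive (≡.cong γ z≡))
    where
    index : ∀ z → ∣ z ∣ ℕ.≤ M → ∃ λ i → z ≡ [ (λ j → + toℕ j) , (λ j → ℤ.- + toℕ j) ]′ (splitAt (suc M) {suc M} i)
    index (+ k) k≤ = fromℕ< (s≤s k≤) ↑ˡ suc M , ≡.trans (≡.cong +_ (≡.sym (Fin.toℕ-fromℕ< (s≤s k≤))))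
      (≡.cong [ (λ j → + toℕ j) , (λ j → ℤ.- + toℕ j) ]′ (≡.sym (Fin.splitAt-↑ˡ (suc M) (fromℕ< (s≤s k≤)) (suc M))))
    index -[1+ k ] k≤ = suc M ↑ʳ fromℕ< (s≤s k≤) , ≡.trans (≡.cong (λ x → ℤ.- + x) (≡.sym (Fin.toℕ-fromℕ< (s≤s k≤))))
      (≡.cong [ (λ j → + toℕ j) , (λ j → ℤ.- + toℕ j) ]′ (≡.sym (Fin.splitAt-↑ʳ (suc M) (suc M) (fromℕ< (s≤s k≤)))))

  connection-covering : Covering setoid Connection
  connection-covering = covering-⊎ setoid ball-covering (_ , value , λ _ → marked-value)

  Γ : Graph c ℓ (c ⊔ ℓ)
  Γ = Cay G S ε∉S

  locallyFinite : LocallyFinite Γ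
  locallyFinite x = covering⇒finite (setoid ×ₛ setoid) (incidentEdges Γ x)
    -- Each edge at `x` occurs as two ordered pairs, with `x` in first or in second place, hence two
    -- coverings.
    (let (K , f , covers) = covering-⊎ (setoid ×ₛ setoid) from-x to-x in K , f , λ yz (E , at-x) → covers yz
      ([ (λ x≈y → inj₁ (x≈y , edge⇒connection E))
       , (λ x≈z → inj₂ (x≈z , edge⇒connection (Graph.symmetric Γ E))) ]′ at-x))
    where
    from-x : Covering (setoid ×ₛ setoid) (λ (y , z) → x ≈ y × Connection (y ⁻¹ ∙ z))
    from-x = let (K , f , covers) = connection-covering in K , (λ i → x , x ∙ f i) ,
      λ (y , z) (x≈y , p) → let (i , eq) = covers _ p in
        i , sym x≈y , trans (sym (\\-leftDividesˡ y z)) (∙-cong (sym x≈y) eq)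
    to-x : Covering (setoid ×ₛ setoid) (λ (y , z) → x ≈ z × Connection (z ⁻¹ ∙ y))
    to-x = let (K , f , covers) = connection-covering in K , (λ i → x ∙ f i , x) ,
      λ (y , z) (x≈z , p) → let (i , eq) = covers _ p in
        i , trans (sym (\\-leftDividesˡ z y)) (∙-cong (sym x≈z) eq) , sym x≈z

  module _ (φ : Bijection setoid setoid) where
    open Bijection φ using (to; cong; injective; surjective)

    automorphism⇒symmetry : IsAutomorphism Γ φ → Symmetry
    automorphism⇒symmetry auto = record
      { to = to
      ; from = from
      ; to-cong = cong
      ; from-cong = λ {x} {y} x≈y → injective (trans (to-from x) (trans x≈y (sym (to-from y))))
      ; to-from = to-from
      ; from-to = λ x → injective (to-from (to x))
      ; to-edge = λ x y p → edge⇒connection (Equivalence.to (auto x y) (inj₁ (lift p)))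
      ; from-edge = λ x y p → edge⇒connection (Equivalence.from (auto (from x) (from y))
          (inj₁ (lift (connection-resp (sym (∙-cong (⁻¹-cong (to-from x)) (to-from y))) p))))
      }
      where
      from : Carrier → Carrier
      from y = proj₁ (surjective y)
      to-from : ∀ y → to (from y) ≈ y
      to-from y = proj₂ (surjective y) refl

    automorphism⇒translation : IsAutomorphism Γ φ → IsLeftMultiplication G φ
    automorphism⇒translation auto = to ε , λ x → begin
      to x                          ≈⟨ cong (identityˡ x) ⟨
      to (ε ∙ x)                    ≈⟨ \\-leftDividesˡ (to ε) _ ⟨
      to ε ∙ δ ε x                  ≈⟨ ∙-congˡ (all-fixed x ε) ⟩
      to ε ∙ x                      ∎
      where
      open SetoidReasoning setoid
      σ = automorphism⇒symmetry auto
      open Symmetry σ using (δ; δ-cong; cocycle)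
      open Transfer em G g n 1≤n N large g-order 4<N m≤n F cocycle
      open Rigidity em G ¬abelian ¬dicyclic X X-generates g
        (λ m 0<m m<5 → g-order m 0<m (ℕ.≤-trans m<5 4<N))
        using () renaming (all-fixed to rigid)
      g²≈ : g ∙ g ≈ γ (+ 2)
      g²≈ = ∙-congˡ (sym (identityʳ g))
      all-fixed : ∀ h x → δ x h ≈ h
      all-fixed = rigid cocycle
        (λ x → [ (λ p → inj₁ ( trans (δ-cong refl (sym (pow-1 g))) (trans (p (+ 1)) (pow-1 g))
                             , trans (δ-cong refl g²≈) (trans (p (+ 2)) (sym g²≈)) ))
               , (λ p → inj₂ ( trans (δ-cong refl (sym (pow-1 g))) (trans (p (+ 1)) (⁻¹-cong (pow-1 g)))
                             , trans (δ-cong refl g²≈) (trans (p (+ 2)) (⁻¹-cong (sym g²≈))) )) ]′ (δ-γ σ x))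
        (covered-fixed (δ-γ σ) (δ-marked σ) ∘ word-covered)
        (λ w norm → covered-signed (δ-γ σ) (δ-marked σ) (word-covered w) norm
                  , covered-signed (δ-γ σ) (δ-marked σ) (covered-∙g (word-covered w)) (norm-∙g norm))

    translation⇒automorphism : IsLeftMultiplication G φ → IsAutomorphism Γ φ
    translation⇒automorphism (a , to≈) x y =
      mk⇔ (Subset.resp (S ∪ inverses G S) (sym shift)) (Subset.resp (S ∪ inverses G S) shift)
      where
      shift : to x ⁻¹ ∙ to y ≈ x ⁻¹ ∙ y
      shift = trans (∙-cong (⁻¹-cong (to≈ x)) (to≈ y))
        (solve 3 (λ a x y → ⊝ (a ⊕ x) ⊕ (a ⊕ y) ⊜ ⊝ x ⊕ y) refl a x y)

rank-zero⇒abelian : ∀ {c ℓ} (G : Group c ℓ) (X : Fin 0 → Group.Carrier G) →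
                    Generates G (Generation.image G X) → Abelian G
rank-zero⇒abelian G X generates x y =
  Generation.generated-commute G (λ { (() , _) _ }) (generates x) (generates y)

HasGraphicalRepresentation : ∀ {c ℓ} → Group c ℓ → Set (Level.suc (c ⊔ ℓ))
HasGraphicalRepresentation {c} {ℓ} G =
  Σ (Subset (Group.setoid G) (c ⊔ ℓ)) λ S →
    Generates G S ×
    Σ (Group.ε G ∉ S) λ ε∉S →
      LocallyFinite (Cay G S ε∉S) ×
      (∀ (φ : Bijection (Group.setoid G) (Group.setoid G)) →
         IsAutomorphism (Cay G S ε∉S) φ ⇔ IsLeftMultiplication G φ)

theorem1 :
  (∀ {a} → ExcludedMiddle a) →
  ∀ {c ℓ} (G : Group c ℓ) →
  FinitelyGenerated G →
  ¬ Abelian G →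
  ¬ IsGeneralizedDicyclic G →
  (r : ℕ) → IsRank G r →
  (∃ λ g → HasOrderAtLeast G g ((2 * r) ^ 36)) →
  Σ (Subset (Group.setoid G) (c ⊔ ℓ)) λ S →
    Generates G S ×
    Σ (Group.ε G ∉ S) λ ε∉S →
      LocallyFinite (Cay G S ε∉S) ×
      (∀ (φ : Bijection (Group.setoid G) (Group.setoid G)) →
         IsAutomorphism (Cay G S ε∉S) φ ⇔ IsLeftMultiplication G φ)
theorem1 em G _ ¬abelian ¬dicyclic r ((S₀ , S₀-generates , S₀-card) , _) (g , order) = go r X X-generates order
  where
  open Group G
  open Generation G
  open Bijection S₀-card using (to; surjective)
  X : Fin r → Carrier
  X i = proj₁ (to i)
  X-generates : Generates G (image X)
  X-generates h = generated-induction
    (record { ε∈ = unit ; ∙∈ = mul ; ⁻¹∈ = inv ; resp∈ = resp })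
    (λ {s} s∈S₀ → let (i , eq) = surjective (s , s∈S₀) in gen (i , sym (eq ≡.refl)))
    (S₀-generates h)
  go : ∀ r (X : Fin r → Carrier) → Generates G (image X) → HasOrderAtLeast G g ((2 * r) ^ 36) →
       HasGraphicalRepresentation G
  -- In rank zero the order bound degenerates to `0³⁶`; here the group is trivial, hence abelian.
  go zero    X generates _     = contradiction (rank-zero⇒abelian G X generates) ¬abelian
  go (suc r) X generates order = S , S-generates , ε∉S , locallyFinite ,
    λ φ → mk⇔ (automorphism⇒translation φ) (translation⇒automorphism φ)
    where
    g-order : ∀ m → 0 < m → m < (2 * suc r) ^ 36 → ¬ (_^ᴳ_ G g m ≈ ε)
    g-order m 0<m m<N gᵐ≈ε = [ (λ infinite → infinite m 0<m gᵐ≈ε)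
      , (λ (k , (_ , _ , minimal) , N≤k) → ℕ.<⇒≱ (ℕ.<-≤-trans m<N N≤k) (minimal m 0<m gᵐ≈ε)) ]′ order
    open Construction em G ¬abelian ¬dicyclic {suc r} (s≤s z≤n) X generates g g-order
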